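{- The algorithm ALG2 (defined in the context) is $4.62$-competitive for the problem BipartiteMatching2. That is, for every complete bipartite graph $G=(L,R,W)$ with $|R|=n$, $|L|=n/2$, every vertex of $L$ of capacity $2$, and arbitrary non-negative edge weights $W$, if the vertices of $R$ arrive in uniformly random order, then the capacitated matching $M$ output by ALG2 satisfies $\mathbb{E}[w(M)]\ge \mathrm{OPT}/4.62$, where $w(M)$ is the total weight of $M$, $\mathrm{OPT}$ is the maximum weight of a capacitated matching of $G$ matching all of $R$, and the expectation is over the arrival order and the random choices of the algorithm.
   Context: BipartiteMatching2 (no rejections): $G=(L,R,W)$ is a complete bipartite graph with non-negative edge weights, $|R|=n$ ($n$ even), $|L|=n/2$. The vertices of $L$ are offline (known from the outset), each with capacity $2$, meaning that it may be matched to at most two vertices of $R$. The vertices of $R$ are online: they arrive one at a time in a uniformly random order, revealing on arrival the weights of their edges to $L$. Each arriving vertex must be matched irrevocably, upon arrival, to exactly one vertex of $L$ with remaining capacity. A (valid) capacitated matching is a set of edges in which each vertex of $R$ has degree at most $1$ and each vertex of $L$ has degree at most $2$; its weight $w(M)$ is the sum of its edge weights. Online vertices are named $1,\dots,n$ in order of arrival. ALG2. Start with $M=\emptyset$ and $L_a=L$. For each arriving vertex $v=1,\dots,n$, let $R'=\{1,\dots,v\}$. - If $v<\lfloor n/4\rfloor$ (exploration): choose $v'\in L_a$ uniformly at random, add $(v',v)$ to $M$, and remove $v'$ from $L_a$. - Otherwise (exploitation): compute $M^v$, a maximum-weight capacitated matching between $L$ and $R'$ that matches every vertex of $R'$ (ties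 broken by a fixed rule depending only on the set $R'$ and not on the arrival order). Let $e^v$ be the edge of $M^v$ incident to $v$ and $l(e^v)\in L$ its offline endpoint. If $M\cup\{e^v\}$ is a valid capacitated matching, add $e^v$ to $M$ and set $L_a\leftarrow L_a\setminus\{l(e^v)\}$. Otherwise choose $v'\in L_a$ uniformly at random, add $(v',v)$ to $M$, and remove $v'$ from $L_a$. - At the end of the step, if $L_a=\emptyset$, reset $L_a$ to the set of vertices of $L$ that are not matched to full capacity in $M$. Output $M$. The random choices of the algorithm are independent of the arrival order. -}

module Defs where

open import Level using (Level; suc; _⊔_)
open import Algebra.Bundles using (CommutativeRing)
open import Data.Bool.Base using (if_then_else_)
open import Data.Fin.Base using (Fin; zero; toℕ)
open import Data.Fin.Permutation using (Permutation′; id; insert; _⟨$⟩ʳ_; _⟨$⟩ˡ_)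
import Data.Fin.Properties as Fin
open import Data.Fin.Subset using (Subset; ⊤; _∈_; _∉_; _-_)
open import Data.Fin.Subset.Properties using (_∈?_; nonempty?)
open import Data.List.Base as List using (List; []; _∷_; length; concatMap; allFin; filter)
open import Data.Maybe using (Maybe; just; nothing; maybe′; Is-just)
open import Data.Maybe.Properties using (≡-dec)
open import Data.Nat.Base as ℕ using (ℕ)
import Data.Nat.DivMod as ℕ
import Data.Nat.Properties as ℕ
open import Data.Product.Base using (_×_; _,_; proj₁)
open import Data.Vec.Base using (Vec; count; lookup; replicate; tabulate; _[_]≔_)
open import Relation.Binary.Core using (Rel)
open import Relation.Binary.PropositionalEquality.Core using (_≡_)
open import Relation.Binary.Structures using (IsTotalOrder)
open import Relation.Nullary.Decidable.Core using (Dec; does)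

import Algebra.Properties.CommutativeMonoid.Sum as Sum
import Algebra.Properties.Semiring.Mult as Mult

-- The library has no real numbers, so weights and probabilities live in an
-- arbitrary totally ordered field; ℚ and the classical ℝ are examples.
-- Inversion is total, with no law imposed on the value of 0# ⁻¹.
record OrderedField c ℓ₁ ℓ₂ : Set (suc (c ⊔ ℓ₁ ⊔ ℓ₂)) where
  infix  4 _≤_
  infixl 7 _/_
  infix  8 _⁻¹
  field
    commutativeRing : CommutativeRing c ℓ₁
  open CommutativeRing commutativeRing public hiding (_-_)
  field
    _⁻¹          : Carrier → Carrier
    ⁻¹-cong      : ∀ {x y} → x ≈ y → x ⁻¹ ≈ y ⁻¹
    ⁻¹-inverseʳ  : ∀ {x} → x ≉ 0# → x * x ⁻¹ ≈ 1#
    0≉1          : 0# ≉ 1#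
    _≤_          : Rel Carrier ℓ₂
    isTotalOrder : IsTotalOrder _≈_ _≤_
    +-monoˡ-≤    : ∀ z {x y} → x ≤ y → x + z ≤ y + z
    *-nonneg     : ∀ {x y} → 0# ≤ x → 0# ≤ y → 0# ≤ x * y

  _/_ : Carrier → Carrier → Carrier
  x / y = x * y ⁻¹

  open Sum +-commutativeMonoid public using (sum)

  fromℕ : ℕ → Carrier
  fromℕ k = k · 1#
    where open Mult semiring renaming (_×_ to _·_)

private
  variable
    a b : Level
    A : Set a
    B : Set b
    m n : ℕ

-- A set of edges between L = Fin m and R = Fin n in which every vertex of R
-- has degree at most 1, given by the partner (if any) of each vertex of R.
Edges : ℕ → ℕ → Set
Edges m n = Vec (Maybe (Fin m)) n

degree : Edges m n → Fin m → ℕ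
degree M l = count (λ e → ≡-dec Fin._≟_ e (just l)) M

IsMatching : Edges m n → Set
IsMatching M = ∀ l → degree M l ℕ.≤ 2

isMatching? : (M : Edges m n) → Dec (IsMatching M)
isMatching? M = Fin.all? (λ l → degree M l ℕ.≤? 2)

record IsMatchingOf (S : Subset n) (M : Edges m n) : Set where
  field
    isMatching : IsMatching M
    matchesAll : ∀ {r} → r ∈ S → Is-just (lookup M r)
    onlyWithin : ∀ {r} → r ∉ S → lookup M r ≡ nothing

-- An arrival order σ sends a time (0-based) to the vertex arriving then.
arrivalOrders : ∀ n → List (Permutation′ n)
arrivalOrders ℕ.zero    = id ∷ []
arrivalOrders (ℕ.suc n) =
  concatMap (λ r → List.map (insert zero r) (arrivalOrders n)) (allFin (ℕ.suc n))

arrivedBy : Permutation′ n → Fin n → Subset n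
arrivedBy σ t = tabulate (λ r → does ((σ ⟨$⟩ˡ r) Fin.≤? t))

unsaturated : Edges m n → Subset m
unsaturated M = tabulate (λ l → does (degree M l ℕ.<? 2))

module _ {c ℓ₁ ℓ₂} (K : OrderedField c ℓ₁ ℓ₂) where
  open OrderedField K

  Weights : ℕ → ℕ → Set c
  Weights m n = Fin m → Fin n → Carrier

  weight : Weights m n → Edges m n → Carrier
  weight w M = sum (λ r → maybe′ (λ l → w l r) 0# (lookup M r))

  record IsMaxWeightMatchingOf (w : Weights m n) (S : Subset n) (M : Edges m n)
         : Set ℓ₂ where
    field
      isMatchingOf : IsMatchingOf S M
      isMaximum    : ∀ N → IsMatchingOf S N → weight w N ≤ weight w M

  -- Finitely supported distributions, as lists of probabilities and outcomes.
  Dist : Set a → Set (a ⊔ c)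
  Dist A = List (Carrier × A)

  return : A → Dist A
  return x = (1# , x) ∷ []

  infixl 1 _>>=_
  _>>=_ : Dist A → (A → Dist B) → Dist B
  d >>= f = concatMap (λ (p , x) → List.map (λ (q , y) → (p * q , y)) (f x)) d

  -- Meaningful for nonempty lists only.
  uniform : List A → Dist A
  uniform xs = List.map (λ x → (1# / fromℕ (length xs) , x)) xs

  𝔼 : Dist A → (A → Carrier) → Carrier
  𝔼 d f = List.foldr (λ (p , x) s → p * f x + s) 0# d

  -- opt R′ is the maximum-weight matching between L and R′ that the algorithm
  -- computes; it depends on R′ alone, by the tie-breaking convention.
  module _ {m n} (opt : Subset n → Edges m n) where

    -- The current matching M and the set L_a.
    State : Set
    State = Edges m n × Subset m

    resetIfEmpty : State → State
    resetIfEmpty (M , Lₐ) = M , (if does (nonempty? Lₐ) then Lₐ else unsaturated M)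

    match : Fin n → Fin m → State → State
    match v l (M , Lₐ) = resetIfEmpty (M [ v ]≔ just l , Lₐ - l)

    -- When |R| = 2|L|, L_a is nonempty before every step.
    explore : Fin n → State → Dist State
    explore v (M , Lₐ) =
      uniform (filter (_∈? Lₐ) (allFin m)) >>= λ l → return (match v l (M , Lₐ))

    -- The second argument is the partner l(eᵛ) of v in opt R′, which is never
    -- nothing when opt R′ matches every vertex of R′.
    exploit : Fin n → Maybe (Fin m) → State → Dist State
    exploit v nothing  s        = explore v s
    exploit v (just l) (M , Lₐ) =
      if does (isMatching? (M [ v ]≔ just l))
      then return (match v l (M , Lₐ))
      else explore v (M , Lₐ)

    -- Time t is 0-based, so the arriving vertex has number suc (toℕ t).
    step : Permutation′ n → Fin n → State → Dist State
    step σ t s =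
      if does (ℕ.suc (toℕ t) ℕ.<? n ℕ./ 4)
      then explore v s
      else exploit v (lookup (opt (arrivedBy σ t)) v) s
      where v = σ ⟨$⟩ʳ t

    ALG2-on : Permutation′ n → Dist (Edges m n)
    ALG2-on σ =
      List.foldl (λ d t → d >>= step σ t) (return (replicate n nothing , ⊤)) (allFin n)
      >>= λ s → return (proj₁ s)

    ALG2 : Dist (Edges m n)
    ALG2 = uniform (arrivalOrders n) >>= ALG2-on

{-# OPTIONS --safe #-}

-- Condition on the set S of the first t arrivals. The last of them is uniform in S, so expectations
-- after t steps are averages, over r in S, of expectations given that S without r arrived before r.
-- Removing a uniform vertex of S from an optimal matching of S costs a fraction 1 / t of its weight,
-- so at every exploitation step the proposed edge has expected weight at least OPT / n.
--
-- The proposed edge is added if its end l in L is unsaturated. An optimal matching has at most two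
-- edges at l, so the edge proposed at time t ends at l with probability at most 2 / t. A random
-- choice hits l only if the end l′ of the proposed edge is saturated, and then with probability
-- 1 / |L_a|, where L_a consists of the vertices of degree 0 in a first round and of those of degree 1
-- in a second one. Hence lower bounds, uniform in S, l and l′, on the probabilities of five events
-- about the degrees of l and l′ obey a linear recursion. If b_t is the bound for "l is unsaturated",
-- it remains to show that the sum of b_t over the exploitation steps is at least n / 4.62.
--
-- For m < 600 the recursion is evaluated. For larger m the recursion telescopes over blocks of q
-- consecutive steps, and the result is bounded below, independently of q, by one step of a similar
-- recursion; with p blocks in each quarter of the arrivals, 300 ≤ p < 600, this one is evaluated.
module Submission where

open import Defs

import Level
open import Data.Bool.Base using (Bool; true; false; if_then_else_; _∧_; T)
import Data.Bool.Properties as Bool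
open import Data.Fin.Base as Fin using (Fin; zero; suc; toℕ; punchIn)
open import Data.Fin.Permutation
  using (Permutation′; insert; insert-punchIn; inverseˡ; inverseʳ; _⟨$⟩ʳ_; _⟨$⟩ˡ_)
import Data.Fin.Properties as Fin
open import Data.Fin.Subset using (Subset; ⊤; ⊥; ∣_∣; _-_; _∈_)
import Data.Fin.Subset.Properties as Subset
open import Data.Fin.Subset.Properties using (_∈?_; nonempty?)
open import Data.List.Base as List using (List; []; _∷_; _∷ʳ_; length; allFin)
import Data.List.Properties as List
open import Data.List.Relation.Unary.All using (All; []; _∷_)
open import Data.Maybe using (Maybe; just; nothing; maybe′; Is-just)
open import Data.Maybe.Properties using (≡-dec)
open import Data.Maybe.Relation.Unary.Any using (just)
open import Data.Nat.Base as ℕ using (ℕ; _!; _<ᵇ_; _≤ᵇ_)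
import Data.Nat.DivMod as ℕ
import Data.Nat.Properties as ℕ
open import Data.Nat.Tactic.RingSolver using (solve-∀)
open import Data.Product.Base using (_×_; _,_; ∃; Σ-syntax; proj₁; proj₂)
open import Data.Sum.Base using (inj₁; inj₂)
open import Data.Unit.Base using (tt)
open import Data.Vec.Base as Vec using (Vec; []; _∷_; lookup; replicate; _[_]≔_)
import Data.Vec.Properties as Vec
open import Function.Base using (_∘_; id)
open import Function.Bundles using (mk⇔)
open import Function.Definitions using (Injective)
open import Function.Strict using (force; force-≡)
open import Relation.Binary.Bundles using (Poset)
open import Relation.Binary.PropositionalEquality as ≡ using (_≡_; _≢_)
import Relation.Binary.Reasoning.PartialOrder as PosetReasoning
open import Relation.Binary.Structures using (IsTotalOrder)
open import Relation.Nullary.Decidable using (does; yes; no; dec-true; dec-false; does-⇔)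
open import Relation.Nullary.Negation using (¬_; contradiction)

-- Since `opt S` is a function of the set `S`, the edge proposed by the last arrival `r` is fixed by
-- `S` and `r`, whatever the order of the others. Conditioning on sets therefore separates the
-- proposal from the state of the algorithm.
--
-- The obstacle is that a step does not act on one vertex alone. Whether a random choice endangers
-- `l` depends on the saturation of the proposed `l′`, so a bound for `l` calls for the joint event
-- of `l` and `l′`. The system closes after five events because, for pairs, the terms that would
-- need a third vertex are dropped.
--
-- The rounds are not tied to the time either. A proposal may fill the second place of a vertex
-- while others are still unmatched, so the first round can outlast `m` arrivals, and the bounds
-- used from time `m` on have to hold in both rounds.
--
-- Finally `n` is unbounded while the margin is below two percent. The homogeneous factors of the
-- recursion multiply to ratios of falling factorials, and these can be compared with factors that
-- mention numbers of blocks only; this removes the block length from the final check.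

-- Ordered fields and multiples by natural numbers

module OrderedFieldProperties {c ℓ₁ ℓ₂} (K : OrderedField c ℓ₁ ℓ₂) where

  open OrderedField K hiding (zero)
  open import Algebra.Properties.Ring ring using (-‿distribˡ-*; -‿involutive)
  open import Algebra.Properties.Semiring.Mult semiring public
    using (×-congʳ; ×-homo-+; ×-assocˡ; ×-assoc-*; ×-comm-*; ×-homo-1) renaming (_×_ to _·_)
  import Algebra.Properties.CommutativeMonoid.Mult +-commutativeMonoid as CMult
  open IsTotalOrder isTotalOrder public
    using (antisym; total; isPartialOrder)
    renaming (refl to ≤-refl; trans to ≤-trans; reflexive to ≤-reflexive)

  poset : Poset _ _ _
  poset = record { isPartialOrder = isPartialOrder }

  module ≤-Reasoning = PosetReasoning poset

  +-mono-≤ : ∀ {x y u v} → x ≤ y → u ≤ v → x + u ≤ y + v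
  +-mono-≤ {x} {y} {u} {v} p q = begin
    x + u ≤⟨ +-monoˡ-≤ u p ⟩
    y + u ≈⟨ +-comm y u ⟩
    u + y ≤⟨ +-monoˡ-≤ y q ⟩
    v + y ≈⟨ +-comm v y ⟩
    y + v ∎
    where open ≤-Reasoning

  +-monoʳ-≤ : ∀ z {x y} → x ≤ y → z + x ≤ z + y
  +-monoʳ-≤ z = +-mono-≤ ≤-refl

  x+y-y≈x : ∀ x y → (x + y) + - y ≈ x
  x+y-y≈x x y = begin-equality
    (x + y) + - y ≈⟨ +-assoc x y (- y) ⟩
    x + (y + - y) ≈⟨ +-congˡ (-‿inverseʳ y) ⟩
    x + 0#        ≈⟨ +-identityʳ x ⟩
    x             ∎
    where open ≤-Reasoning

  +-cancelʳ-≤ : ∀ z {x y} → x + z ≤ y + z → x ≤ y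
  +-cancelʳ-≤ z {x} {y} p = begin
    x             ≈⟨ x+y-y≈x x z ⟨
    (x + z) + - z ≤⟨ +-monoˡ-≤ (- z) p ⟩
    (y + z) + - z ≈⟨ x+y-y≈x y z ⟩
    y             ∎
    where open ≤-Reasoning

  +-nonneg : ∀ {x y} → 0# ≤ x → 0# ≤ y → 0# ≤ x + y
  +-nonneg {x} {y} p q = ≤-trans (≤-reflexive (sym (+-identityˡ 0#))) (+-mono-≤ p q)

  x≤x+y : ∀ {x y} → 0# ≤ y → x ≤ x + y
  x≤x+y {x} p = ≤-trans (≤-reflexive (sym (+-identityʳ x))) (+-monoʳ-≤ x p)

  y≤x+y : ∀ {x y} → 0# ≤ x → y ≤ x + y
  y≤x+y {x} {y} p = ≤-trans (x≤x+y p) (≤-reflexive (+-comm y x))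

  *-monoˡ-≤ : ∀ {z x y} → 0# ≤ z → x ≤ y → z * x ≤ z * y
  *-monoˡ-≤ {z} {x} {y} 0≤z x≤y = begin
    z * x                    ≈⟨ +-identityˡ (z * x) ⟨
    0# + z * x               ≤⟨ +-monoˡ-≤ (z * x) (*-nonneg 0≤z 0≤y-x) ⟩
    z * (y + - x) + z * x    ≈⟨ distribˡ z (y + - x) x ⟨
    z * ((y + - x) + x)      ≈⟨ *-congˡ (trans (+-assoc y (- x) x) (trans (+-congˡ (-‿inverseˡ x)) (+-identityʳ y))) ⟩
    z * y                    ∎
    where
    open ≤-Reasoning
    0≤y-x : 0# ≤ y + - x
    0≤y-x = ≤-trans (≤-reflexive (sym (-‿inverseʳ x))) (+-monoˡ-≤ (- x) x≤y)

  0≤1 : 0# ≤ 1#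
  0≤1 with total 0# 1#
  ... | inj₁ p = p
  ... | inj₂ 1≤0 = begin
      0#              ≤⟨ *-nonneg 0≤-1 0≤-1 ⟩
      (- 1#) * (- 1#) ≈⟨ -‿distribˡ-* 1# (- 1#) ⟨
      - (1# * (- 1#)) ≈⟨ -‿cong (*-identityˡ (- 1#)) ⟩
      - (- 1#)        ≈⟨ -‿involutive 1# ⟩
      1#              ∎
    where
    open ≤-Reasoning
    0≤-1 : 0# ≤ - 1#
    0≤-1 = begin
      0#          ≈⟨ -‿inverseʳ 1# ⟨
      1# + - 1#   ≤⟨ +-monoˡ-≤ (- 1#) 1≤0 ⟩
      0# + - 1#   ≈⟨ +-identityˡ (- 1#) ⟩
      - 1#        ∎

  ·-nonneg : ∀ k {x} → 0# ≤ x → 0# ≤ k · x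
  ·-nonneg ℕ.zero    p = ≤-refl
  ·-nonneg (ℕ.suc k) p = +-nonneg p (·-nonneg k p)

  ·-monoʳ-≤ : ∀ k {x y} → x ≤ y → k · x ≤ k · y
  ·-monoʳ-≤ ℕ.zero    p = ≤-refl
  ·-monoʳ-≤ (ℕ.suc k) p = +-mono-≤ p (·-monoʳ-≤ k p)

  ·-monoˡ-≤ : ∀ {j k x} → 0# ≤ x → j ℕ.≤ k → j · x ≤ k · x
  ·-monoˡ-≤ {k = k} 0≤x ℕ.z≤n = ·-nonneg k 0≤x
  ·-monoˡ-≤ 0≤x (ℕ.s≤s p) = +-monoʳ-≤ _ (·-monoˡ-≤ 0≤x p)

  ·-mono-≤ : ∀ {j k x y} → 0# ≤ x → j ℕ.≤ k → x ≤ y → j · x ≤ k · y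
  ·-mono-≤ {k = k} 0≤x j≤k x≤y = ≤-trans (·-monoˡ-≤ 0≤x j≤k) (·-monoʳ-≤ k x≤y)

  -- Totality does the work: if `y ≤ x`, then `k · y ≤ k · x`, and the remaining copies cancel from
  -- both sides.
  ·-cancel-≤ : ∀ k .{{_ : ℕ.NonZero k}} {x y} → k · x ≤ k · y → x ≤ y
  ·-cancel-≤ (ℕ.suc k) {x} {y} p with total x y
  ... | inj₁ x≤y = x≤y
  ... | inj₂ y≤x = +-cancelʳ-≤ (k · x) (≤-trans p (+-monoʳ-≤ y (·-monoʳ-≤ k y≤x)))

  ·-distrib-+ : ∀ k x y → k · (x + y) ≈ k · x + k · y
  ·-distrib-+ k x y = CMult.×-distrib-+ x y k

  ·-congˡ : ∀ {j k x} → j ≡ k → j · x ≈ k · x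
  ·-congˡ ≡.refl = refl

  ·-zeroʳ : ∀ k → k · 0# ≈ 0#
  ·-zeroʳ ℕ.zero    = refl
  ·-zeroʳ (ℕ.suc k) = trans (+-identityˡ _) (·-zeroʳ k)

  fromℕ-* : ∀ k x → fromℕ k * x ≈ k · x
  fromℕ-* k x = trans (×-assoc-* k 1# x) (×-congʳ k (*-identityˡ x))

  fromℕ-nonneg : ∀ k → 0# ≤ fromℕ k
  fromℕ-nonneg k = ·-nonneg k 0≤1

  fromℕ≉0 : ∀ k .{{_ : ℕ.NonZero k}} → fromℕ k ≉ 0#
  fromℕ≉0 (ℕ.suc k) eq = 0≉1 (antisym 0≤1 (≤-trans (x≤x+y (fromℕ-nonneg k)) (≤-reflexive eq)))

  infixl 7 _÷_
  _÷_ : Carrier → ℕ → Carrier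
  x ÷ k = fromℕ k ⁻¹ * x

  ·-÷ : ∀ k .{{_ : ℕ.NonZero k}} x → k · (x ÷ k) ≈ x
  ·-÷ k x = begin-equality
    k · (fromℕ k ⁻¹ * x)     ≈⟨ fromℕ-* k _ ⟨
    fromℕ k * (fromℕ k ⁻¹ * x) ≈⟨ *-assoc _ _ _ ⟨
    fromℕ k * fromℕ k ⁻¹ * x ≈⟨ *-congʳ (⁻¹-inverseʳ (fromℕ≉0 k)) ⟩
    1# * x                   ≈⟨ *-identityˡ x ⟩
    x                        ∎
    where open ≤-Reasoning

  ÷-cong : ∀ k {x y} → x ≈ y → x ÷ k ≈ y ÷ k
  ÷-cong k = *-congˡ

  ÷-≤ : ∀ k .{{_ : ℕ.NonZero k}} {x y} → x ≤ k · y → x ÷ k ≤ y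
  ÷-≤ k {x} p = ·-cancel-≤ k (≤-trans (≤-reflexive (·-÷ k x)) p)

  ≤-÷ : ∀ k .{{_ : ℕ.NonZero k}} {x y} → k · y ≤ x → y ≤ x ÷ k
  ≤-÷ k {x} p = ·-cancel-≤ k (≤-trans p (≤-reflexive (sym (·-÷ k x))))

  ÷-nonneg : ∀ k .{{_ : ℕ.NonZero k}} {x} → 0# ≤ x → 0# ≤ x ÷ k
  ÷-nonneg k p = ≤-÷ k (≤-trans (≤-reflexive (·-zeroʳ k)) p)

  ·-comm-· : ∀ j k x → j · (k · x) ≈ k · (j · x)
  ·-comm-· j k x = trans (×-assocˡ x j k) (trans (·-congˡ (ℕ.*-comm j k)) (sym (×-assocˡ x k j)))

  /-≤ : ∀ j k .{{_ : ℕ.NonZero j}} .{{_ : ℕ.NonZero k}} {x y} → j · x ≤ k · y → x / (fromℕ k / fromℕ j) ≤ y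
  /-≤ j k {x} {y} p = ·-cancel-≤ k (≤-trans (≤-reflexive eq) p)
    where
    open ≤-Reasoning
    q = fromℕ k / fromℕ j
    j·q : j · q ≈ fromℕ k
    j·q = trans (×-congʳ j (*-comm _ _)) (·-÷ j (fromℕ k))
    q≉0 : q ≉ 0#
    q≉0 q≈0 = fromℕ≉0 k (trans (sym j·q) (trans (×-congʳ j q≈0) (·-zeroʳ j)))
    eq : k · (x / q) ≈ j · x
    eq = begin-equality
      k · (x * q ⁻¹)       ≈⟨ fromℕ-* k _ ⟨
      fromℕ k * (x * q ⁻¹) ≈⟨ *-congʳ j·q ⟨
      j · q * (x * q ⁻¹)   ≈⟨ ×-assoc-* j q _ ⟩
      j · (q * (x * q ⁻¹)) ≈⟨ ×-congʳ j (trans (sym (*-assoc _ _ _)) (trans (*-congʳ (*-comm q x)) (*-assoc _ _ _))) ⟩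
      j · (x * (q * q ⁻¹)) ≈⟨ ×-congʳ j (trans (*-congˡ (⁻¹-inverseʳ q≉0)) (*-identityʳ x)) ⟩
      j · x                ∎

-- Arrival orders

∣S∣≡0⇒S≡⊥ : ∀ {n} (S : Subset n) → ∣ S ∣ ≡ 0 → S ≡ ⊥
∣S∣≡0⇒S≡⊥ []          eq = ≡.refl
∣S∣≡0⇒S≡⊥ (false ∷ S) eq = ≡.cong (false ∷_) (∣S∣≡0⇒S≡⊥ S eq)

∣S∣-remove : ∀ {n} (S : Subset n) r → lookup S r ≡ true → ∣ S ∣ ≡ ℕ.suc ∣ S [ r ]≔ false ∣
∣S∣-remove (true  ∷ S) zero    r∈S = ≡.refl
∣S∣-remove (true  ∷ S) (suc r) r∈S = ≡.cong ℕ.suc (∣S∣-remove S r r∈S)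
∣S∣-remove (false ∷ S) (suc r) r∈S = ∣S∣-remove S r r∈S

remove-insert : ∀ {n} (S : Subset n) r → lookup S r ≡ true → (S [ r ]≔ false) [ r ]≔ true ≡ S
remove-insert S r r∈S = ≡.trans (Vec.[]≔-idempotent S r)
  (≡.trans (≡.cong (S [ r ]≔_) (≡.sym r∈S)) (Vec.[]≔-lookup S r))

∈-remove⇒≢ : ∀ {n} (S : Subset n) r {s} → lookup (S [ r ]≔ false) s ≡ true → r ≢ s
∈-remove⇒≢ S r s∈ ≡.refl = contradiction (≡.trans (≡.sym s∈) (Vec.lookup∘update r S false)) λ ()

lookup-extensionality : ∀ {a} {A : Set a} {n} {xs ys : Vec A n} → (∀ i → lookup xs i ≡ lookup ys i) → xs ≡ ys
lookup-extensionality {xs = xs} {ys} eq =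
  ≡.trans (≡.sym (Vec.tabulate∘lookup xs)) (≡.trans (Vec.tabulate-cong eq) (Vec.tabulate∘lookup ys))

module SumOver {c ℓ₁ ℓ₂} (K : OrderedField c ℓ₁ ℓ₂) where

  open OrderedField K hiding (zero)
  open OrderedFieldProperties K
  open import Algebra.Properties.CommutativeSemigroup +-commutativeSemigroup using (interchange; x∙yz≈y∙xz)
  open import Algebra.Properties.CommutativeMonoid.Sum +-commutativeMonoid using (sum-remove; sum-cong-≋)
  open import Relation.Binary.Reasoning.Setoid setoid

  sumOver : ∀ {n} → Subset n → (Fin n → Carrier) → Carrier
  sumOver []          g = 0#
  sumOver (true  ∷ S) g = g zero + sumOver S (g ∘ suc)
  sumOver (false ∷ S) g = sumOver S (g ∘ suc)

  sumOver-cong : ∀ {n} (S : Subset n) {g h} → (∀ r → lookup S r ≡ true → g r ≈ h r) → sumOver S g ≈ sumOver S h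
  sumOver-cong []          eq = refl
  sumOver-cong (true  ∷ S) eq = +-cong (eq zero ≡.refl) (sumOver-cong S (eq ∘ suc))
  sumOver-cong (false ∷ S) eq = sumOver-cong S (eq ∘ suc)

  sumOver-mono : ∀ {n} (S : Subset n) {g h} → (∀ r → lookup S r ≡ true → g r ≤ h r) → sumOver S g ≤ sumOver S h
  sumOver-mono []          le = ≤-refl
  sumOver-mono (true  ∷ S) le = +-mono-≤ (le zero ≡.refl) (sumOver-mono S (le ∘ suc))
  sumOver-mono (false ∷ S) le = sumOver-mono S (le ∘ suc)

  sumOver-+ : ∀ {n} (S : Subset n) g h → sumOver S (λ r → g r + h r) ≈ sumOver S g + sumOver S h
  sumOver-+ []          g h = sym (+-identityˡ 0#)
  sumOver-+ (true  ∷ S) g h = trans (+-congˡ (sumOver-+ S (g ∘ suc) (h ∘ suc))) (interchange _ _ _ _)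
  sumOver-+ (false ∷ S) g h = sumOver-+ S (g ∘ suc) (h ∘ suc)

  sumOver-* : ∀ {n} (S : Subset n) x g → sumOver S (λ r → x * g r) ≈ x * sumOver S g
  sumOver-* []          x g = sym (zeroʳ x)
  sumOver-* (true  ∷ S) x g = trans (+-congˡ (sumOver-* S x (g ∘ suc))) (sym (distribˡ x _ _))
  sumOver-* (false ∷ S) x g = sumOver-* S x (g ∘ suc)

  sumOver-· : ∀ {n} (S : Subset n) k g → sumOver S (λ r → k · g r) ≈ k · sumOver S g
  sumOver-· S k g = trans (sumOver-cong S λ r _ → sym (fromℕ-* k (g r)))
    (trans (sumOver-* S (fromℕ k) g) (fromℕ-* k (sumOver S g)))

  sumOver-const : ∀ {n} (S : Subset n) x → sumOver S (λ _ → x) ≈ ∣ S ∣ · x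
  sumOver-const []          x = refl
  sumOver-const (true  ∷ S) x = +-congˡ (sumOver-const S x)
  sumOver-const (false ∷ S) x = sumOver-const S x

  sumOver-remove : ∀ {n} (S : Subset n) r g → lookup S r ≡ true → sumOver S g ≈ g r + sumOver (S [ r ]≔ false) g
  sumOver-remove (true  ∷ S) zero    g r∈S = refl
  sumOver-remove (true  ∷ S) (suc r) g r∈S = trans (+-congˡ (sumOver-remove S r (g ∘ suc) r∈S)) (x∙yz≈y∙xz _ _ _)
  sumOver-remove (false ∷ S) (suc r) g r∈S = sumOver-remove S r (g ∘ suc) r∈S

  sumOver-⊤ : ∀ {n} (g : Fin n → Carrier) → sumOver ⊤ g ≈ sum g
  sumOver-⊤ {ℕ.zero}  g = refl
  sumOver-⊤ {ℕ.suc n} g = +-congˡ (sumOver-⊤ (g ∘ suc))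

  -- Both sides range over the ordered pairs of distinct elements of `S`. A head that lies in `S`
  -- contributes the pairs in which it comes first and those in which it comes second; these two
  -- cross terms trade places.
  sumOver-swap : ∀ {n} (S : Subset n) (G : Fin n → Fin n → Carrier) →
    sumOver S (λ r → sumOver (S [ r ]≔ false) (G r)) ≈
    sumOver S (λ s → sumOver (S [ s ]≔ false) (λ r → G r s))
  sumOver-swap []          G = refl
  sumOver-swap (false ∷ S) G = sumOver-swap S (λ r s → G (suc r) (suc s))
  sumOver-swap (true  ∷ S) G = begin
    sumOver S (G zero ∘ suc) + sumOver S (λ r → G (suc r) zero + sumOver (S [ r ]≔ false) (G (suc r) ∘ suc))
      ≈⟨ +-congˡ (sumOver-+ S _ _) ⟩
    sumOver S (G zero ∘ suc) + (sumOver S (λ r → G (suc r) zero) + sumOver S (λ r → sumOver (S [ r ]≔ false) (G (suc r) ∘ suc)))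
      ≈⟨ x∙yz≈y∙xz _ _ _ ⟩
    sumOver S (λ r → G (suc r) zero) + (sumOver S (G zero ∘ suc) + sumOver S (λ r → sumOver (S [ r ]≔ false) (G (suc r) ∘ suc)))
      ≈⟨ +-congˡ (+-congˡ (sumOver-swap S (λ r s → G (suc r) (suc s)))) ⟩
    sumOver S (λ r → G (suc r) zero) + (sumOver S (G zero ∘ suc) + sumOver S (λ s → sumOver (S [ s ]≔ false) (λ r → G (suc r) (suc s))))
      ≈⟨ +-congˡ (sumOver-+ S _ _) ⟨
    sumOver S (λ r → G (suc r) zero) + sumOver S (λ s → G zero (suc s) + sumOver (S [ s ]≔ false) (λ r → G (suc r) (suc s))) ∎

  -- When t is the size of S, both are the sum of H over the orderings of S.
  sumOrderings sumOrderings′ : ∀ {n} → ℕ → Subset n → (List (Fin n) → Carrier) → Carrier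
  sumOrderings ℕ.zero    S H = H []
  sumOrderings (ℕ.suc t) S H = sumOver S λ r → sumOrderings t (S [ r ]≔ false) (λ rs → H (r ∷ rs))
  sumOrderings′ ℕ.zero    S H = H []
  sumOrderings′ (ℕ.suc t) S H = sumOver S λ r → sumOrderings′ t (S [ r ]≔ false) (λ rs → H (rs ∷ʳ r))

  -- `arrivalOrders` picks the first arrival outermost, while conditioning needs the last one
  -- outermost. The induction turns the tail around, exchanges the choices of the first and the last
  -- vertex by `sumOver-swap`, and turns the rest back.
  sumOrderings≈sumOrderings′ : ∀ {n} t (S : Subset n) H → sumOrderings t S H ≈ sumOrderings′ t S H
  sumOrderings≈sumOrderings′ ℕ.zero            S H = refl
  sumOrderings≈sumOrderings′ (ℕ.suc ℕ.zero)    S H = refl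
  sumOrderings≈sumOrderings′ (ℕ.suc (ℕ.suc t)) S H = begin
    sumOver S (λ r → sumOrderings (ℕ.suc t) (S [ r ]≔ false) (λ rs → H (r ∷ rs)))
      ≈⟨ sumOver-cong S (λ r _ → sumOrderings≈sumOrderings′ (ℕ.suc t) (S [ r ]≔ false) (λ rs → H (r ∷ rs))) ⟩
    sumOver S (λ r → sumOver (S [ r ]≔ false) (λ s → sumOrderings′ t (S [ r ]≔ false [ s ]≔ false) (λ rs → H (r ∷ (rs ∷ʳ s)))))
      ≈⟨ sumOver-swap S _ ⟩
    sumOver S (λ s → sumOver (S [ s ]≔ false) (λ r → sumOrderings′ t (S [ r ]≔ false [ s ]≔ false) (λ rs → H (r ∷ (rs ∷ʳ s)))))
      ≈⟨ sumOver-cong S (λ s _ → sumOver-cong (S [ s ]≔ false) (λ r r∈ → exchange s r (∈-remove⇒≢ S s r∈))) ⟩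
    sumOver S (λ s → sumOver (S [ s ]≔ false) (λ r → sumOrderings t (S [ s ]≔ false [ r ]≔ false) (λ rs → H (r ∷ (rs ∷ʳ s)))))
      ≈⟨ sumOver-cong S (λ s _ → sumOrderings≈sumOrderings′ (ℕ.suc t) (S [ s ]≔ false) (λ rs → H (rs ∷ʳ s))) ⟩
    sumOver S (λ s → sumOrderings′ (ℕ.suc t) (S [ s ]≔ false) (λ rs → H (rs ∷ʳ s))) ∎
    where
    exchange : ∀ s r → s ≢ r → sumOrderings′ t (S [ r ]≔ false [ s ]≔ false) (λ rs → H (r ∷ (rs ∷ʳ s))) ≈
                               sumOrderings t (S [ s ]≔ false [ r ]≔ false) (λ rs → H (r ∷ (rs ∷ʳ s)))
    exchange s r s≢r rewrite Vec.[]≔-commutes {x = false} {y = false} S s r s≢r =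
      sym (sumOrderings≈sumOrderings′ t _ _)

  insertAll : ∀ {n} → Subset n → List (Fin n) → Subset n
  insertAll = List.foldl (λ S r → S [ r ]≔ true)

  -- The lists that occur are the orderings of `S`; their length and the set they build up are the
  -- two facts about them that the process uses.
  sumOrderings′-cong : ∀ {n} t (S : Subset n) {H H′} → ∣ S ∣ ≡ t →
    (∀ rs → length rs ≡ t → insertAll ⊥ rs ≡ S → H rs ≈ H′ rs) →
    sumOrderings′ t S H ≈ sumOrderings′ t S H′
  sumOrderings′-cong ℕ.zero    S ∣S∣≡0 eq = eq [] ≡.refl (≡.sym (∣S∣≡0⇒S≡⊥ S ∣S∣≡0))
  sumOrderings′-cong (ℕ.suc t) S ∣S∣≡t eq = sumOver-cong S λ r r∈S →
    sumOrderings′-cong t _ (ℕ.suc-injective (≡.trans (≡.sym (∣S∣-remove S r r∈S)) ∣S∣≡t)) λ rs len ins →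
      eq (rs ∷ʳ r)
        (≡.trans (List.length-++ rs) (≡.trans (ℕ.+-comm _ 1) (≡.cong ℕ.suc len)))
        (≡.trans (List.foldl-∷ʳ _ ⊥ r rs) (≡.trans (≡.cong (_[ r ]≔ true) ins) (remove-insert S r r∈S)))

  sumList : ∀ {a} {A : Set a} → List A → (A → Carrier) → Carrier
  sumList xs g = List.foldr (λ x s → g x + s) 0# xs

  sumList-++ : ∀ {a} {A : Set a} (xs ys : List A) g → sumList (xs List.++ ys) g ≈ sumList xs g + sumList ys g
  sumList-++ []       ys g = sym (+-identityˡ _)
  sumList-++ (x ∷ xs) ys g = trans (+-congˡ (sumList-++ xs ys g)) (sym (+-assoc _ _ _))

  sumList-cong : ∀ {a} {A : Set a} (xs : List A) {g h} → (∀ x → g x ≈ h x) → sumList xs g ≈ sumList xs h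
  sumList-cong []       eq = refl
  sumList-cong (x ∷ xs) eq = +-cong (eq x) (sumList-cong xs eq)

  sumList-concatMap-tabulate : ∀ {a b} {A : Set a} {B : Set b} {k} (f : A → List B) (h : Fin k → A) g →
    sumList (List.concatMap f (List.tabulate h)) g ≈ sum (λ i → sumList (f (h i)) g)
  sumList-concatMap-tabulate {k = ℕ.zero}  f h g = refl
  sumList-concatMap-tabulate {k = ℕ.suc k} f h g =
    trans (sumList-++ (f (h zero)) _ g) (+-congˡ (sumList-concatMap-tabulate f (h ∘ suc) g))

  sumList-map : ∀ {a b} {A : Set a} {B : Set b} (f : A → B) xs g → sumList (List.map f xs) g ≈ sumList xs (g ∘ f)
  sumList-map f []       g = refl
  sumList-map f (x ∷ xs) g = +-congˡ (sumList-map f xs g)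

  -- `arrivalOrders` recurses on the number of vertices and relabels the rest by `punchIn`, whereas
  -- `sumOrderings` keeps the labels and shrinks the set. An enumeration of the vertices still to
  -- come translates between the two.
  record Enumerates {n k} (S : Subset n) (ι : Fin k → Fin n) : Set (c Level.⊔ ℓ₁) where
    field
      injective : Injective _≡_ _≡_ ι
      member    : ∀ i → lookup S (ι i) ≡ true
      sumOver≈  : ∀ g → sumOver S g ≈ sum (g ∘ ι)

  Enumerates-remove : ∀ {n k} {S : Subset n} {ι : Fin (ℕ.suc k) → Fin n} → Enumerates S ι →
    ∀ i → Enumerates (S [ ι i ]≔ false) (ι ∘ punchIn i)
  Enumerates-remove {S = S} {ι} enum i = record
    { injective = λ eq → Fin.punchIn-injective i _ _ (injective eq)
    ; member    = λ j → ≡.trans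
        (Vec.lookup∘update′ (λ eq → Fin.punchInᵢ≢i i j (injective eq)) S false) (member (punchIn i j))
    ; sumOver≈  = λ g → +-cancelˡ (g (ι i)) _ _ (begin
        g (ι i) + sumOver (S [ ι i ]≔ false) g ≈⟨ sumOver-remove S (ι i) g (member i) ⟨
        sumOver S g                            ≈⟨ sumOver≈ g ⟩
        sum (g ∘ ι)                            ≈⟨ sum-remove {i = i} (g ∘ ι) ⟩
        g (ι i) + sum (g ∘ ι ∘ punchIn i)      ∎)
    }
    where
    open Enumerates enum
    open import Algebra.Properties.Group +-group using () renaming (∙-cancelˡ to +-cancelˡ)

  Enumerates-⊤ : ∀ {n} → Enumerates {n} ⊤ id
  Enumerates-⊤ = record
    { injective = id
    ; member    = λ i → Vec.lookup-replicate i true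
    ; sumOver≈  = sumOver-⊤
    }

  sum-arrivalOrders : ∀ {n} k {S : Subset n} {ι : Fin k → Fin n} → Enumerates S ι → ∀ H →
    sumList (arrivalOrders k) (λ σ → H (List.tabulate (ι ∘ (σ ⟨$⟩ʳ_)))) ≈ sumOrderings k S H
  sum-arrivalOrders ℕ.zero    enum H = +-identityʳ _
  sum-arrivalOrders (ℕ.suc k) {S} {ι} enum H = begin
    sumList (arrivalOrders (ℕ.suc k)) G
      ≈⟨ sumList-concatMap-tabulate (λ r → List.map (insert zero r) (arrivalOrders k)) id G ⟩
    sum (λ i → sumList (List.map (insert zero i) (arrivalOrders k)) G)
      ≈⟨ sum-cong-≋ (λ i → trans (sumList-map (insert zero i) (arrivalOrders k) G)
           (sumList-cong (arrivalOrders k) λ π → reflexive (≡.cong (λ rs → H (ι i ∷ rs))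
             (List.tabulate-cong λ j → ≡.cong ι (insert-punchIn zero i π j))))) ⟩
    sum (λ i → sumList (arrivalOrders k) (λ π → H (ι i ∷ List.tabulate (ι ∘ punchIn i ∘ (π ⟨$⟩ʳ_)))))
      ≈⟨ sum-cong-≋ (λ i → sum-arrivalOrders k (Enumerates-remove enum i) (λ rs → H (ι i ∷ rs))) ⟩
    sum (λ i → sumOrderings k (S [ ι i ]≔ false) (λ rs → H (ι i ∷ rs)))
      ≈⟨ Enumerates.sumOver≈ enum _ ⟨
    sumOrderings (ℕ.suc k) S H ∎
    where
    G = λ σ → H (List.tabulate (ι ∘ (σ ⟨$⟩ʳ_)))

length-arrivalOrders : ∀ n → length (arrivalOrders n) ≡ n !
length-arrivalOrders ℕ.zero    = ≡.refl
length-arrivalOrders (ℕ.suc n) = go id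
  where
  go : ∀ {k} (h : Fin k → Fin (ℕ.suc n)) →
    length (List.concatMap (λ r → List.map (insert zero r) (arrivalOrders n)) (List.tabulate h)) ≡ k ℕ.* n !
  go {ℕ.zero}  h = ≡.refl
  go {ℕ.suc k} h = ≡.trans (List.length-++ (List.map (insert zero (h zero)) (arrivalOrders n)))
    (≡.cong₂ ℕ._+_ (≡.trans (List.length-map _ (arrivalOrders n)) (length-arrivalOrders n)) (go (h ∘ suc)))

before : ∀ {n} → Permutation′ n → ℕ → Subset n
before σ t = Vec.tabulate λ r → toℕ (σ ⟨$⟩ˡ r) <ᵇ t

arrivedBy≡before : ∀ {n} (σ : Permutation′ n) t → arrivedBy σ t ≡ before σ (ℕ.suc (toℕ t))
arrivedBy≡before σ t = Vec.tabulate-cong λ r →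
  does-⇔ (mk⇔ ℕ.s≤s ℕ.s≤s⁻¹) ((σ ⟨$⟩ˡ r) Fin.≤? t) (toℕ (σ ⟨$⟩ˡ r) ℕ.<? ℕ.suc (toℕ t))

arrivedBy≡insert : ∀ {n} (σ : Permutation′ n) t → arrivedBy σ t ≡ before σ (toℕ t) [ σ ⟨$⟩ʳ t ]≔ true
arrivedBy≡insert σ t = lookup-extensionality eq
  where
  eq : ∀ r → lookup (arrivedBy σ t) r ≡ lookup (before σ (toℕ t) [ σ ⟨$⟩ʳ t ]≔ true) r
  eq r with r Fin.≟ σ ⟨$⟩ʳ t
  ... | yes ≡.refl = ≡.trans (Vec.lookup∘tabulate _ r) (≡.trans
        (dec-true (_ Fin.≤? t) (ℕ.≤-reflexive (≡.cong toℕ (inverseˡ σ))))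
        (≡.sym (Vec.lookup∘update r (before σ (toℕ t)) true)))
  ... | no r≢ = ≡.trans (Vec.lookup∘tabulate _ r) (≡.trans
        (does-⇔ (mk⇔ (λ le → ℕ.≤∧≢⇒< le λ eq → r≢ (≡.trans (≡.sym (inverseʳ σ)) (≡.cong (σ ⟨$⟩ʳ_) (Fin.toℕ-injective eq)))) ℕ.<⇒≤)
          (_ Fin.≤? t) (_ ℕ.<? _))
        (≡.sym (≡.trans (Vec.lookup∘update′ r≢ (before σ (toℕ t)) true) (Vec.lookup∘tabulate _ r))))

-- Expectations, and conditioning on the set of arrivals

module Distributions {c ℓ₁ ℓ₂} (K : OrderedField c ℓ₁ ℓ₂) where

  open OrderedField K hiding (zero)
  open OrderedFieldProperties K
  open SumOver K
  open import Algebra.Properties.CommutativeSemigroup +-commutativeSemigroup using (interchange)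
  open import Algebra.Properties.CommutativeSemigroup *-commutativeSemigroup using () renaming (x∙yz≈y∙xz to x*yz≈y*xz)
  open import Relation.Binary.Reasoning.Setoid setoid

  private
    variable
      a b : Level.Level
      A : Set a
      B : Set b

  𝔼-cong : (d : Dist K A) {f g : A → Carrier} → (∀ x → f x ≈ g x) → 𝔼 K d f ≈ 𝔼 K d g
  𝔼-cong []            eq = refl
  𝔼-cong ((p , x) ∷ d) eq = +-cong (*-congˡ (eq x)) (𝔼-cong d eq)

  𝔼-++ : (d d′ : Dist K A) (f : A → Carrier) → 𝔼 K (d List.++ d′) f ≈ 𝔼 K d f + 𝔼 K d′ f
  𝔼-++ []            d′ f = sym (+-identityˡ _)
  𝔼-++ ((p , x) ∷ d) d′ f = trans (+-congˡ (𝔼-++ d d′ f)) (sym (+-assoc _ _ _))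

  𝔼-scale : ∀ p (d : Dist K A) (f : A → Carrier) → 𝔼 K (List.map (λ (q , y) → (p * q , y)) d) f ≈ p * 𝔼 K d f
  𝔼-scale p []            f = sym (zeroʳ p)
  𝔼-scale p ((q , y) ∷ d) f = trans (+-cong (*-assoc p q (f y)) (𝔼-scale p d f)) (sym (distribˡ p _ _))

  𝔼->>= : (d : Dist K A) (k : A → Dist K B) (f : B → Carrier) →
    𝔼 K (_>>=_ K d k) f ≈ 𝔼 K d (λ x → 𝔼 K (k x) f)
  𝔼->>= []            k f = refl
  𝔼->>= ((p , x) ∷ d) k f = trans (𝔼-++ (List.map _ (k x)) _ f) (+-cong (𝔼-scale p (k x) f) (𝔼->>= d k f))

  𝔼-return : (x : A) (f : A → Carrier) → 𝔼 K (return K x) f ≈ f x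
  𝔼-return x f = trans (+-identityʳ _) (*-identityˡ _)

  𝔼-+ : (d : Dist K A) (f g : A → Carrier) → 𝔼 K d (λ x → f x + g x) ≈ 𝔼 K d f + 𝔼 K d g
  𝔼-+ []            f g = sym (+-identityˡ 0#)
  𝔼-+ ((p , x) ∷ d) f g = trans (+-cong (distribˡ p _ _) (𝔼-+ d f g)) (interchange _ _ _ _)

  𝔼-* : (d : Dist K A) (y : Carrier) (f : A → Carrier) → 𝔼 K d (λ x → y * f x) ≈ y * 𝔼 K d f
  𝔼-* []            y f = sym (zeroʳ y)
  𝔼-* ((p , x) ∷ d) y f = trans (+-cong (x*yz≈y*xz p y (f x)) (𝔼-* d y f)) (sym (distribˡ y _ _))

  𝔼-uniform : (xs : List A) (f : A → Carrier) → 𝔼 K (uniform K xs) f ≈ sumList xs f ÷ length xs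
  𝔼-uniform xs f = trans (go xs) (*-congʳ (*-identityˡ _))
    where
    p = 1# / fromℕ (length xs)
    go : ∀ ys → 𝔼 K (List.map (λ x → (p , x)) ys) f ≈ p * sumList ys f
    go []       = sym (zeroʳ p)
    go (y ∷ ys) = trans (+-congˡ (go ys)) (sym (distribˡ p _ _))

  module Process {m n} (opt : Subset n → Edges m n) where

    State′ : Set
    State′ = State K opt

    initial : State′
    initial = replicate n nothing , ⊤

    -- S is the set of arrived vertices, including the arriving vertex v.
    stepInto : ℕ → Subset n → Fin n → State′ → Dist K State′
    stepInto t S v s =
      if ℕ.suc t <ᵇ n ℕ./ 4 then explore K opt v s else exploit K opt v (lookup (opt S) v) s

    -- The algorithm on a list of arriving vertices, directly as an expectation, so that it can
    -- serve as the functional `H` in `sumOrderings`.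
    run : ℕ → Subset n → List (Fin n) → State′ → (State′ → Carrier) → Carrier
    run t S []       s f = f s
    run t S (r ∷ rs) s f = 𝔼 K (stepInto t (S [ r ]≔ true) r s) λ s′ → run (ℕ.suc t) (S [ r ]≔ true) rs s′ f

    run-∷ʳ : ∀ t S rs r s f → run t S (rs ∷ʳ r) s f ≈
      run t S rs s (λ s′ → 𝔼 K (stepInto (t ℕ.+ length rs) (insertAll S rs [ r ]≔ true) r s′) f)
    run-∷ʳ t S []        r s f rewrite ℕ.+-identityʳ t = refl
    run-∷ʳ t S (r′ ∷ rs) r s f rewrite ℕ.+-suc t (length rs) =
      𝔼-cong (stepInto t (S [ r′ ]≔ true) r′ s) λ s′ → run-∷ʳ (ℕ.suc t) (S [ r′ ]≔ true) rs r s′ f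

    -- The expectation of f after t steps, given that S is the set of the first t arrivals.
    condE : ℕ → Subset n → (State′ → Carrier) → Carrier
    condE ℕ.zero    S f = f initial
    condE (ℕ.suc t) S f =
      sumOver S (λ r → condE t (S [ r ]≔ false) (λ s → 𝔼 K (stepInto t S r s) f)) ÷ ℕ.suc t

    -- Both sides split off the last arrival `r`. The earlier arrivals enter the last step only
    -- through their number and their set, so this step can be absorbed into the function whose
    -- expectation is taken.
    sumOrderings′-run : ∀ t S f → ∣ S ∣ ≡ t → sumOrderings′ t S (λ rs → run 0 ⊥ rs initial f) ≈ (t !) · condE t S f
    sumOrderings′-run ℕ.zero    S f ∣S∣≡0 = sym (×-homo-1 _)
    sumOrderings′-run (ℕ.suc t) S f ∣S∣≡t = begin
      sumOver S (λ r → sumOrderings′ t (S [ r ]≔ false) (λ rs → run 0 ⊥ (rs ∷ʳ r) initial f))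
        ≈⟨ sumOver-cong S summand ⟩
      sumOver S (λ r → (t !) · condE t (S [ r ]≔ false) (λ s → 𝔼 K (stepInto t S r s) f))
        ≈⟨ sumOver-· S (t !) _ ⟩
      (t !) · sumOver S (λ r → condE t (S [ r ]≔ false) (λ s → 𝔼 K (stepInto t S r s) f))
        ≈⟨ ×-congʳ (t !) (·-÷ (ℕ.suc t) _) ⟨
      (t !) · (ℕ.suc t · condE (ℕ.suc t) S f)
        ≈⟨ ×-assocˡ _ (t !) (ℕ.suc t) ⟩
      (t ! ℕ.* ℕ.suc t) · condE (ℕ.suc t) S f
        ≈⟨ ·-congˡ (ℕ.*-comm (t !) (ℕ.suc t)) ⟩
      (ℕ.suc t !) · condE (ℕ.suc t) S f ∎
      where
      summand : ∀ r → lookup S r ≡ true →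
        sumOrderings′ t (S [ r ]≔ false) (λ rs → run 0 ⊥ (rs ∷ʳ r) initial f) ≈
        (t !) · condE t (S [ r ]≔ false) (λ s → 𝔼 K (stepInto t S r s) f)
      summand r r∈S = trans (sumOrderings′-cong t (S [ r ]≔ false) size last) (sumOrderings′-run t (S [ r ]≔ false) _ size)
        where
        size : ∣ S [ r ]≔ false ∣ ≡ t
        size = ℕ.suc-injective (≡.trans (≡.sym (∣S∣-remove S r r∈S)) ∣S∣≡t)
        last : ∀ rs → length rs ≡ t → insertAll ⊥ rs ≡ S [ r ]≔ false →
          run 0 ⊥ (rs ∷ʳ r) initial f ≈ run 0 ⊥ rs initial (λ s → 𝔼 K (stepInto t S r s) f)
        last rs len ins = trans (run-∷ʳ 0 ⊥ rs r initial f)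
          (reflexive (≡.cong₂ (λ t S → run 0 ⊥ rs initial (λ s → 𝔼 K (stepInto t S r s) f)) len
            (≡.trans (≡.cong (_[ r ]≔ true) ins) (remove-insert S r r∈S))))

    module _ (σ : Permutation′ n) where

      runTimes : List (Fin n) → State′ → (State′ → Carrier) → Carrier
      runTimes []       s f = f s
      runTimes (t ∷ ts) s f = 𝔼 K (step K opt σ t s) λ s′ → runTimes ts s′ f

      𝔼-foldl : ∀ ts d f → 𝔼 K (List.foldl (λ d t → _>>=_ K d (step K opt σ t)) d ts) f ≈ 𝔼 K d (λ s → runTimes ts s f)
      𝔼-foldl []       d f = refl
      𝔼-foldl (t ∷ ts) d f = trans (𝔼-foldl ts _ f) (𝔼->>= d (step K opt σ t) _)

      runTimes≈run : ∀ {k} t₀ (τ : Fin k → Fin n) → (∀ i → toℕ (τ i) ≡ t₀ ℕ.+ toℕ i) → ∀ s f →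
        runTimes (List.tabulate τ) s f ≈ run t₀ (before σ t₀) (List.tabulate ((σ ⟨$⟩ʳ_) ∘ τ)) s f
      runTimes≈run {ℕ.zero}  t₀ τ eq s f = refl
      runTimes≈run {ℕ.suc k} t₀ τ eq s f
        with t₀≡ ← ≡.trans (≡.sym (ℕ.+-identityʳ t₀)) (≡.sym (eq zero))
        rewrite t₀≡ | ≡.sym (arrivedBy≡insert σ (τ zero)) =
        𝔼-cong (step K opt σ (τ zero) s) λ s′ →
          trans (runTimes≈run (ℕ.suc (toℕ (τ zero))) (τ ∘ suc)
                  (λ i → ≡.trans (eq (suc i)) (ℕ.+-suc _ (toℕ i))) s′ f)
            (reflexive (≡.cong (λ S → run (ℕ.suc (toℕ (τ zero))) S (List.tabulate ((σ ⟨$⟩ʳ_) ∘ τ ∘ suc)) s′ f) (≡.sym (arrivedBy≡before σ (τ zero)))))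

      𝔼-ALG2-on : ∀ g → 𝔼 K (ALG2-on K opt σ) g ≈ run 0 ⊥ (List.tabulate (σ ⟨$⟩ʳ_)) initial (g ∘ proj₁)
      𝔼-ALG2-on g = begin
        𝔼 K (ALG2-on K opt σ) g
          ≈⟨ 𝔼->>= (List.foldl (λ d t → _>>=_ K d (step K opt σ t)) (return K initial) (allFin n)) (λ s → return K (proj₁ s)) g ⟩
        _ ≈⟨ 𝔼-cong (List.foldl (λ d t → _>>=_ K d (step K opt σ t)) (return K initial) (allFin n)) (λ s → 𝔼-return (proj₁ s) g) ⟩
        _ ≈⟨ 𝔼-foldl (allFin n) (return K initial) (g ∘ proj₁) ⟩
        _ ≈⟨ 𝔼-return initial (λ s → runTimes (allFin n) s (g ∘ proj₁)) ⟩
        runTimes (allFin n) initial (g ∘ proj₁)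
          ≈⟨ runTimes≈run 0 id (λ i → ≡.refl) initial (g ∘ proj₁) ⟩
        run 0 (before σ 0) (List.tabulate (σ ⟨$⟩ʳ_)) initial (g ∘ proj₁)
          ≡⟨ ≡.cong (λ S → run 0 S (List.tabulate (σ ⟨$⟩ʳ_)) initial (g ∘ proj₁)) before-0 ⟩
        run 0 ⊥ (List.tabulate (σ ⟨$⟩ʳ_)) initial (g ∘ proj₁) ∎
        where
        before-0 : before σ 0 ≡ ⊥
        before-0 = lookup-extensionality λ r → ≡.trans (Vec.lookup∘tabulate _ r) (≡.sym (Vec.lookup-replicate r false))

    𝔼-ALG2 : ∀ g → 𝔼 K (ALG2 K opt) g ≈ condE n ⊤ (g ∘ proj₁)
    𝔼-ALG2 g = begin
      𝔼 K (ALG2 K opt) g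
        ≈⟨ 𝔼->>= (uniform K (arrivalOrders n)) (ALG2-on K opt) g ⟩
      𝔼 K (uniform K (arrivalOrders n)) (λ σ → 𝔼 K (ALG2-on K opt σ) g)
        ≈⟨ 𝔼-uniform (arrivalOrders n) _ ⟩
      sumList (arrivalOrders n) (λ σ → 𝔼 K (ALG2-on K opt σ) g) ÷ length (arrivalOrders n)
        ≡⟨ ≡.cong (sumList (arrivalOrders n) (λ σ → 𝔼 K (ALG2-on K opt σ) g) ÷_) (length-arrivalOrders n) ⟩
      sumList (arrivalOrders n) (λ σ → 𝔼 K (ALG2-on K opt σ) g) ÷ (n !)
        ≈⟨ ÷-cong (n !) sum≈ ⟩
      ((n !) · condE n ⊤ (g ∘ proj₁)) ÷ (n !)
        ≈⟨ ·-inverse ⟩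
      condE n ⊤ (g ∘ proj₁) ∎
      where
      instance _ = ℕ.>-nonZero (ℕ.1≤n! n)
      X = condE n ⊤ (g ∘ proj₁)
      ·-inverse : ((n !) · X) ÷ (n !) ≈ X
      ·-inverse = antisym (÷-≤ (n !) ≤-refl) (≤-÷ (n !) ≤-refl)
      sum≈ : sumList (arrivalOrders n) (λ σ → 𝔼 K (ALG2-on K opt σ) g) ≈ (n !) · X
      sum≈ = begin
        sumList (arrivalOrders n) (λ σ → 𝔼 K (ALG2-on K opt σ) g)
          ≈⟨ sumList-cong (arrivalOrders n) (λ σ → 𝔼-ALG2-on σ g) ⟩
        sumList (arrivalOrders n) (λ σ → H (List.tabulate (σ ⟨$⟩ʳ_)))
          ≈⟨ sum-arrivalOrders n Enumerates-⊤ H ⟩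
        sumOrderings n ⊤ H
          ≈⟨ sumOrderings≈sumOrderings′ n ⊤ H ⟩
        sumOrderings′ n ⊤ H
          ≈⟨ sumOrderings′-run n ⊤ (g ∘ proj₁) (Subset.∣⊤∣≡n n) ⟩
        (n !) · X ∎
        where
        H = λ rs → run 0 ⊥ rs initial (g ∘ proj₁)

-- One step of the algorithm

degree-match-same : ∀ {m n} (M : Edges m n) v l → lookup M v ≡ nothing →
  degree (M [ v ]≔ just l) l ≡ ℕ.suc (degree M l)
degree-match-same (nothing ∷ M) zero    l eq rewrite dec-true (l Fin.≟ l) ≡.refl = ≡.refl
degree-match-same (e ∷ M)       (suc v) l eq with does (≡-dec Fin._≟_ e (just l))
... | true  = ≡.cong ℕ.suc (degree-match-same M v l eq)
... | false = degree-match-same M v l eq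

degree-match-other : ∀ {m n} (M : Edges m n) v {l l′} → l ≢ l′ → lookup M v ≡ nothing →
  degree (M [ v ]≔ just l) l′ ≡ degree M l′
degree-match-other (nothing ∷ M) zero    {l} {l′} l≢l′ eq rewrite dec-false (l Fin.≟ l′) l≢l′ = ≡.refl
degree-match-other (e ∷ M)       (suc v) {l} {l′} l≢l′ eq with does (≡-dec Fin._≟_ e (just l′))
... | true  = ≡.cong ℕ.suc (degree-match-other M v l≢l′ eq)
... | false = degree-match-other M v l≢l′ eq

degree-empty : ∀ {m} n (l : Fin m) → degree (replicate n nothing) l ≡ 0
degree-empty ℕ.zero    l = ≡.refl
degree-empty (ℕ.suc n) l = degree-empty n l

p-x≡p[x]≔false : ∀ {n} (p : Subset n) x → p - x ≡ p [ x ]≔ false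
p-x≡p[x]≔false (s ∷ p) zero    = ≡.cong (false ∷_) (Subset.p─⊥≡p p)
p-x≡p[x]≔false (s ∷ p) (suc x) = ≡.cong (s ∷_) (p-x≡p[x]≔false p x)

∣p∣-remove-≤ : ∀ {n} (p : Subset n) x → ∣ p ∣ ℕ.≤ ℕ.suc ∣ p [ x ]≔ false ∣
∣p∣-remove-≤ p x with lookup p x in eq
... | true  = ℕ.≤-reflexive (∣S∣-remove p x eq)
... | false = ℕ.≤-trans (ℕ.≤-reflexive (≡.cong ∣_∣ (≡.sym (≡.trans (≡.cong (p [ x ]≔_) (≡.sym eq)) (Vec.[]≔-lookup p x))))) (ℕ.n≤1+n _)

low : ∀ {m n} → ℕ → Edges m n → Subset m
low i M = Vec.tabulate λ l → degree M l <ᵇ i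

lookup-low : ∀ {m n} i (M : Edges m n) l → lookup (low i M) l ≡ (degree M l <ᵇ i)
lookup-low i M l = Vec.lookup∘tabulate _ l

<ᵇ-true : ∀ {i j} → i ℕ.< j → (i <ᵇ j) ≡ true
<ᵇ-true {i} {j} i<j = dec-true (i ℕ.<? j) i<j

<ᵇ-false : ∀ {i j} → j ℕ.≤ i → (i <ᵇ j) ≡ false
<ᵇ-false {i} {j} j≤i = dec-false (i ℕ.<? j) (ℕ.≤⇒≯ j≤i)

true-<ᵇ : ∀ {i j} → (i <ᵇ j) ≡ true → i ℕ.< j
true-<ᵇ {i} {j} eq = ℕ.<ᵇ⇒< i j (≡.subst T (≡.sym eq) tt)

false-<ᵇ : ∀ {i j} → (i <ᵇ j) ≡ false → j ℕ.≤ i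
false-<ᵇ {i} {j} eq = ℕ.≮⇒≥ λ i<j → contradiction (≡.trans (≡.sym (<ᵇ-true i<j)) eq) λ ()

module _ {m n} (M : Edges m n) (v : Fin n) (l : Fin m) (Mv≡nothing : lookup M v ≡ nothing) where

  private M′ = M [ v ]≔ just l

  lookup-low-match-other : ∀ i {l′} → l′ ≢ l → lookup (low i M′) l′ ≡ lookup (low i M) l′
  lookup-low-match-other i {l′} l′≢l = ≡.trans (lookup-low i M′ l′) (≡.trans
    (≡.cong (_<ᵇ i) (degree-match-other M v (l′≢l ∘ ≡.sym) Mv≡nothing)) (≡.sym (lookup-low i M l′)))

  lookup-low-match-same : ∀ i → lookup (low i M′) l ≡ (ℕ.suc (degree M l) <ᵇ i)
  lookup-low-match-same i = ≡.trans (lookup-low i M′ l) (≡.cong (_<ᵇ i) (degree-match-same M v l Mv≡nothing))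

  low-match-remove : ∀ i → i ℕ.≤ ℕ.suc (degree M l) → low i M′ ≡ low i M [ l ]≔ false
  low-match-remove i i≤ = lookup-extensionality eq
    where
    eq : ∀ l′ → lookup (low i M′) l′ ≡ lookup (low i M [ l ]≔ false) l′
    eq l′ with l′ Fin.≟ l
    ... | yes ≡.refl = ≡.trans (lookup-low-match-same i) (≡.trans (<ᵇ-false i≤) (≡.sym (Vec.lookup∘update l (low i M) false)))
    ... | no  l′≢l   = ≡.trans (lookup-low-match-other i l′≢l) (≡.sym (Vec.lookup∘update′ l′≢l (low i M) false))

  low-match-keep : ∀ i → ℕ.suc (degree M l) ℕ.< i → low i M′ ≡ low i M
  low-match-keep i <i = lookup-extensionality eq
    where
    eq : ∀ l′ → lookup (low i M′) l′ ≡ lookup (low i M) l′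
    eq l′ with l′ Fin.≟ l
    ... | yes ≡.refl = ≡.trans (lookup-low-match-same i) (≡.trans (<ᵇ-true <i) (≡.sym (≡.trans (lookup-low i M l) (<ᵇ-true (ℕ.<-trans (ℕ.n<1+n _) <i)))))
    ... | no  l′≢l   = lookup-low-match-other i l′≢l

  low-match-absent : ∀ i → i ℕ.≤ degree M l → low i M′ ≡ low i M
  low-match-absent i i≤ = ≡.trans (low-match-remove i (ℕ.m≤n⇒m≤1+n i≤))
    (≡.trans (≡.cong (low i M [ l ]≔_) (≡.sym (≡.trans (lookup-low i M l) (<ᵇ-false i≤)))) (Vec.[]≔-lookup (low i M) l))

  -- `∣ low 1 M ∣ + ∣ low 2 M ∣` is the capacity left in `L`: a vertex of degree 0 is counted twice,
  -- one of degree 1 once. A match uses one unit, because it takes `l` out of one of the two sets.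
  spare-match : degree M l ℕ.< 2 → ∣ low 1 M ∣ ℕ.+ ∣ low 2 M ∣ ℕ.≤ ℕ.suc (∣ low 1 M′ ∣ ℕ.+ ∣ low 2 M′ ∣)
  spare-match d<2 with degree M l ℕ.≟ 0
  ... | yes d≡0
    rewrite low-match-remove 1 (ℕ.s≤s ℕ.z≤n) | low-match-keep 2 (ℕ.s≤s (ℕ.s≤s (ℕ.≤-reflexive d≡0)))
    = ℕ.+-monoˡ-≤ _ (∣p∣-remove-≤ (low 1 M) l)
  ... | no d≢0
    rewrite low-match-remove 2 (ℕ.s≤s (ℕ.n≢0⇒n>0 d≢0))
          | low-match-absent 1 (ℕ.n≢0⇒n>0 d≢0)
    = ℕ.≤-trans (ℕ.+-monoʳ-≤ _ (∣p∣-remove-≤ (low 2 M) l)) (ℕ.≤-reflexive (ℕ.+-suc _ _))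

  degree-match-≥ : ∀ l′ → degree M l′ ℕ.≤ degree M′ l′
  degree-match-≥ l′ with l Fin.≟ l′
  ... | yes ≡.refl = ℕ.≤-trans (ℕ.n≤1+n _) (ℕ.≤-reflexive (≡.sym (degree-match-same M v l Mv≡nothing)))
  ... | no l≢l′    = ℕ.≤-reflexive (≡.sym (degree-match-other M v l≢l′ Mv≡nothing))

  degree-match-≤2 : degree M l ℕ.< 2 → IsMatching M → IsMatching M′
  degree-match-≤2 d<2 M≤2 l′ with l Fin.≟ l′
  ... | yes ≡.refl = ℕ.≤-trans (ℕ.≤-reflexive (degree-match-same M v l Mv≡nothing)) d<2
  ... | no l≢l′    = ℕ.≤-trans (ℕ.≤-reflexive (degree-match-other M v l≢l′ Mv≡nothing)) (M≤2 l′)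

-- L_a consists of the vertices of degree 0 until there are none, and afterwards
-- of the vertices of degree less than 2.
data Phase {m n} (M : Edges m n) (Lₐ : Subset m) : Set where
  round₁ : Lₐ ≡ low 1 M → (∃ λ l → lookup Lₐ l ≡ true) → Phase M Lₐ
  round₂ : (∀ l → 1 ℕ.≤ degree M l) → Lₐ ≡ low 2 M → Phase M Lₐ

-- `spare` says that the arrivals in `S` have used at most one unit of capacity each. It is the
-- source of the lower bounds on the size of `L_a`, which depend on the time alone although the
-- matching is random.
record Invariant {m n} (S : Subset n) (s : Edges m n × Subset m) : Set where
  field
    fresh      : ∀ r → lookup S r ≡ false → lookup (proj₁ s) r ≡ nothing
    isMatching : IsMatching (proj₁ s)
    spare      : 2 ℕ.* m ℕ.≤ ∣ low 1 (proj₁ s) ∣ ℕ.+ ∣ low 2 (proj₁ s) ∣ ℕ.+ ∣ S ∣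
    phase      : Phase (proj₁ s) (proj₂ s)

  private
    M = proj₁ s
    Lₐ = proj₂ s

  -- At most `m` units of the remaining capacity are counted in `low 2 M`; the others are vertices
  -- of degree 0.
  ∣Lₐ∣-round₁ : Lₐ ≡ low 1 M → m ℕ.∸ ∣ S ∣ ℕ.≤ ∣ Lₐ ∣
  ∣Lₐ∣-round₁ ≡.refl = ℕ.m≤n+o⇒m∸n≤o m ∣ S ∣ (ℕ.+-cancelˡ-≤ m _ _ (begin
    m ℕ.+ m                                    ≡⟨ ≡.cong (m ℕ.+_) (≡.sym (ℕ.+-identityʳ m)) ⟩
    2 ℕ.* m                                    ≤⟨ spare ⟩
    ∣ low 1 M ∣ ℕ.+ ∣ low 2 M ∣ ℕ.+ ∣ S ∣      ≡⟨ ≡.cong (ℕ._+ ∣ S ∣) (ℕ.+-comm ∣ low 1 M ∣ _) ⟩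
    ∣ low 2 M ∣ ℕ.+ ∣ low 1 M ∣ ℕ.+ ∣ S ∣      ≡⟨ ℕ.+-assoc ∣ low 2 M ∣ _ _ ⟩
    ∣ low 2 M ∣ ℕ.+ (∣ low 1 M ∣ ℕ.+ ∣ S ∣)    ≤⟨ ℕ.+-monoˡ-≤ _ (Subset.∣p∣≤n (low 2 M)) ⟩
    m ℕ.+ (∣ low 1 M ∣ ℕ.+ ∣ S ∣)              ≡⟨ ≡.cong (m ℕ.+_) (ℕ.+-comm ∣ low 1 M ∣ _) ⟩
    m ℕ.+ (∣ S ∣ ℕ.+ ∣ low 1 M ∣)              ∎))
    where open ℕ.≤-Reasoning

  spare-round₂ : (∀ l → 1 ℕ.≤ degree M l) → 2 ℕ.* m ℕ.≤ ∣ low 2 M ∣ ℕ.+ ∣ S ∣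
  spare-round₂ deg≥1 = ℕ.≤-trans spare (ℕ.≤-reflexive (≡.cong (λ k → k ℕ.+ ∣ low 2 M ∣ ℕ.+ ∣ S ∣) ∣low∣≡0))
    where
    low≡⊥ : low 1 M ≡ ⊥
    low≡⊥ = lookup-extensionality λ l →
      ≡.trans (lookup-low 1 M l) (≡.trans (<ᵇ-false (deg≥1 l)) (≡.sym (Vec.lookup-replicate l false)))
    ∣low∣≡0 : ∣ low 1 M ∣ ≡ 0
    ∣low∣≡0 = ≡.trans (≡.cong ∣_∣ low≡⊥) (Subset.∣⊥∣≡0 m)

  ∣Lₐ∣-round₂ : (∀ l → 1 ℕ.≤ degree M l) → Lₐ ≡ low 2 M → 2 ℕ.* m ℕ.∸ ∣ S ∣ ℕ.≤ ∣ Lₐ ∣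
  ∣Lₐ∣-round₂ deg≥1 ≡.refl = ℕ.m≤n+o⇒m∸n≤o (2 ℕ.* m) ∣ S ∣
    (ℕ.≤-trans (spare-round₂ deg≥1) (ℕ.≤-reflexive (ℕ.+-comm ∣ low 2 M ∣ _)))

  -- Hence every state before time `m` is in the first round. There is no converse: proposals that
  -- go to vertices of degree 1 prolong the first round.
  m≤∣S∣-round₂ : (∀ l → 1 ℕ.≤ degree M l) → m ℕ.≤ ∣ S ∣
  m≤∣S∣-round₂ deg≥1 = ℕ.+-cancelˡ-≤ m _ _ (begin
    m ℕ.+ m                  ≡⟨ ≡.cong (m ℕ.+_) (≡.sym (ℕ.+-identityʳ m)) ⟩
    2 ℕ.* m                  ≤⟨ spare-round₂ deg≥1 ⟩
    ∣ low 2 M ∣ ℕ.+ ∣ S ∣    ≤⟨ ℕ.+-monoˡ-≤ _ (Subset.∣p∣≤n (low 2 M)) ⟩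
    m ℕ.+ ∣ S ∣              ∎)
    where open ℕ.≤-Reasoning

  Lₐ⇒<2 : ∀ l → lookup Lₐ l ≡ true → degree M l ℕ.< 2
  Lₐ⇒<2 l l∈Lₐ with phase
  ... | round₁ ≡.refl _ = ℕ.<-trans (true-<ᵇ (≡.trans (≡.sym (lookup-low 1 M l)) l∈Lₐ)) (ℕ.n<1+n 1)
  ... | round₂ _ ≡.refl = true-<ᵇ (≡.trans (≡.sym (lookup-low 2 M l)) l∈Lₐ)

∈⇒lookup : ∀ {n} {p : Subset n} {x} → x ∈ p → lookup p x ≡ true
∈⇒lookup = Vec.[]=⇒lookup

module _ {c ℓ₁ ℓ₂} (K : OrderedField c ℓ₁ ℓ₂) {m n} (opt : Subset n → Edges m n) where

  -- A proposal may pick an `l` outside `L_a`. In the first round such an `l` has degree 1, and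
  -- removing it from `low 1 M` changes nothing. After a reset `L_a` has the required form by
  -- computation, since `unsaturated` and `low 2` unfold to the same set.
  match-phase : ∀ {M : Edges m n} {Lₐ} v l → lookup M v ≡ nothing → degree M l ℕ.< 2 → Phase M Lₐ →
    Phase (M [ v ]≔ just l) (proj₂ (match K opt v l (M , Lₐ)))
  match-phase {M} {Lₐ} v l Mv d<2 ph with nonempty? (Lₐ - l) | ph
  ... | yes (x , x∈) | round₁ Lₐ≡ _ = round₁
        (≡.trans (p-x≡p[x]≔false Lₐ l) (≡.trans (≡.cong (_[ l ]≔ false) Lₐ≡) (≡.sym (low-match-remove M v l Mv 1 (ℕ.s≤s ℕ.z≤n)))))
        (x , ∈⇒lookup x∈)
  ... | yes _ | round₂ deg≥1 Lₐ≡ = round₂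
        (λ l′ → ℕ.≤-trans (deg≥1 l′) (degree-match-≥ M v l Mv l′))
        (≡.trans (p-x≡p[x]≔false Lₐ l) (≡.trans (≡.cong (_[ l ]≔ false) Lₐ≡) (≡.sym (low-match-remove M v l Mv 2 (ℕ.s≤s (deg≥1 l))))))
  ... | no _ | round₂ deg≥1 _ = round₂ (λ l′ → ℕ.≤-trans (deg≥1 l′) (degree-match-≥ M v l Mv l′)) ≡.refl
  ... | no empty | round₁ Lₐ≡ _ = round₂ deg≥1 ≡.refl
    where
    deg≥1 : ∀ l′ → 1 ℕ.≤ degree (M [ v ]≔ just l) l′
    deg≥1 l′ = false-<ᵇ (≡.trans (≡.sym (lookup-low 1 (M [ v ]≔ just l) l′))
      (Bool.¬-not λ l′∈ → empty (l′ , Vec.lookup⇒[]= l′ _ (≡.trans (≡.cong (λ p → lookup p l′)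
        (≡.trans (p-x≡p[x]≔false Lₐ l) (≡.trans (≡.cong (_[ l ]≔ false) Lₐ≡) (≡.sym (low-match-remove M v l Mv 1 (ℕ.s≤s ℕ.z≤n)))))) l′∈))))

  match-invariant : ∀ {S} {s : Edges m n × Subset m} v l → lookup S v ≡ true → Invariant (S [ v ]≔ false) s →
    degree (proj₁ s) l ℕ.< 2 → Invariant S (match K opt v l s)
  match-invariant {S} {M , Lₐ} v l v∈S inv d<2 = record
    { fresh      = λ r r∉S → let r≢v = λ r≡v → contradiction (≡.trans (≡.sym r∉S) (≡.trans (≡.cong (lookup S) r≡v) v∈S)) λ () in
        ≡.trans (Vec.lookup∘update′ r≢v M (just l)) (fresh r (≡.trans (Vec.lookup∘update′ r≢v S false) r∉S))
    ; isMatching = degree-match-≤2 M v l Mv d<2 isMatching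
    ; spare      = ℕ.≤-trans spare (ℕ.≤-trans (ℕ.+-monoˡ-≤ _ (spare-match M v l Mv d<2))
        (ℕ.≤-reflexive (≡.trans (≡.sym (ℕ.+-suc _ _)) (≡.cong (_ ℕ.+_) (≡.sym (∣S∣-remove S v v∈S))))))
    ; phase      = match-phase v l Mv d<2 phase
    }
    where
    open Invariant inv
    Mv : lookup M v ≡ nothing
    Mv = fresh v (Vec.lookup∘update v S false)

  initial-invariant : .{{ℕ.NonZero m}} → Invariant ⊥ (replicate n nothing , ⊤)
  initial-invariant = record
    { fresh      = λ r _ → Vec.lookup-replicate r nothing
    ; isMatching = λ l → ℕ.≤-trans (ℕ.≤-reflexive (degree-empty n l)) ℕ.z≤n
    ; spare      = ℕ.≤-reflexive (≡.trans (≡.cong (m ℕ.+_) (ℕ.+-identityʳ m)) (≡.trans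
        (≡.sym (≡.cong₂ ℕ._+_ (∣low∣≡m 1 (ℕ.s≤s ℕ.z≤n)) (∣low∣≡m 2 (ℕ.s≤s ℕ.z≤n))))
        (≡.sym (≡.trans (≡.cong (∣ low {m} 1 (replicate n nothing) ∣ ℕ.+ ∣ low {m} 2 (replicate n nothing) ∣ ℕ.+_) (Subset.∣⊥∣≡0 n)) (ℕ.+-identityʳ _)))))
    ; phase      = round₁ (≡.sym (low≡⊤ 1 (ℕ.s≤s ℕ.z≤n))) (Fin.fromℕ< (ℕ.>-nonZero⁻¹ m) , Vec.lookup-replicate (Fin.fromℕ< (ℕ.>-nonZero⁻¹ m)) true)
    }
    where
    low≡⊤ : ∀ i → 0 ℕ.< i → low i (replicate n nothing) ≡ ⊤ {m}
    low≡⊤ i 0<i = lookup-extensionality λ l → ≡.trans (lookup-low i (replicate n nothing) l)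
      (≡.trans (<ᵇ-true (≡.subst (ℕ._< i) (≡.sym (degree-empty n l)) 0<i)) (≡.sym (Vec.lookup-replicate l true)))
    ∣low∣≡m : ∀ i → 0 ℕ.< i → ∣ low {m} i (replicate n nothing) ∣ ≡ m
    ∣low∣≡m i 0<i = ≡.trans (≡.cong ∣_∣ (low≡⊤ i 0<i)) (Subset.∣⊤∣≡n m)

filter-∈?-suc : ∀ {m k} s (p : Subset m) (f : Fin k → Fin m) →
  List.filter (_∈? (s ∷ p)) (List.tabulate (suc ∘ f)) ≡ List.map suc (List.filter (_∈? p) (List.tabulate f))
filter-∈?-suc {k = ℕ.zero}  s p f = ≡.refl
filter-∈?-suc {k = ℕ.suc k} s p f with does (f zero ∈? p)
... | true  = ≡.cong (suc (f zero) ∷_) (filter-∈?-suc s p (f ∘ suc))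
... | false = filter-∈?-suc s p (f ∘ suc)

length-filter-∈? : ∀ {m} (p : Subset m) → length (List.filter (_∈? p) (allFin m)) ≡ ∣ p ∣
length-filter-∈? []          = ≡.refl
length-filter-∈? (true ∷ p)  = ≡.cong ℕ.suc (≡.trans (≡.cong length (filter-∈?-suc true p id))
  (≡.trans (List.length-map suc (List.filter (_∈? p) (allFin _))) (length-filter-∈? p)))
length-filter-∈? (false ∷ p) = ≡.trans (≡.cong length (filter-∈?-suc false p id))
  (≡.trans (List.length-map suc (List.filter (_∈? p) (allFin _))) (length-filter-∈? p))

∧-true : ∀ {x y} → x ≡ true → y ≡ true → x ∧ y ≡ true
∧-true ≡.refl ≡.refl = ≡.refl

∧-elim : ∀ {x y} → x ∧ y ≡ true → x ≡ true × y ≡ true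
∧-elim {true} {true} eq = ≡.refl , ≡.refl

module Steps {c ℓ₁ ℓ₂} (K : OrderedField c ℓ₁ ℓ₂) {m n} (opt : Subset n → Edges m n) where

  open OrderedField K hiding (zero)
  open OrderedFieldProperties K
  open SumOver K
  open Distributions K
  open Process opt

  sumOver-nonneg : ∀ {k} (S : Subset k) {g} → (∀ r → 0# ≤ g r) → 0# ≤ sumOver S g
  sumOver-nonneg []          0≤g = ≤-refl
  sumOver-nonneg (true  ∷ S) 0≤g = +-nonneg (0≤g zero) (sumOver-nonneg S (0≤g ∘ suc))
  sumOver-nonneg (false ∷ S) 0≤g = sumOver-nonneg S (0≤g ∘ suc)

  sumOver-remove-≤ : ∀ {k} (S : Subset k) r {g} → (∀ r → 0# ≤ g r) → sumOver (S [ r ]≔ false) g ≤ sumOver S g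
  sumOver-remove-≤ (true  ∷ S) zero    0≤g = y≤x+y (0≤g zero)
  sumOver-remove-≤ (false ∷ S) zero    0≤g = ≤-refl
  sumOver-remove-≤ (true  ∷ S) (suc r) 0≤g = +-monoʳ-≤ _ (sumOver-remove-≤ S r (0≤g ∘ suc))
  sumOver-remove-≤ (false ∷ S) (suc r) 0≤g = sumOver-remove-≤ S r (0≤g ∘ suc)

  sumOver-avoiding : ∀ {k} (bs : List (Fin k)) (S : Subset k) {g} → (∀ r → 0# ≤ g r) →
    (∀ r → lookup S r ≡ true → All (r ≢_) bs → 1# ≤ g r) → fromℕ (∣ S ∣ ℕ.∸ length bs) ≤ sumOver S g
  sumOver-avoiding []       S 0≤g 1≤g = ≤-trans (≤-reflexive (sym (sumOver-const S 1#))) (sumOver-mono S λ r r∈S → 1≤g r r∈S [])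
  sumOver-avoiding (b ∷ bs) S {g} 0≤g 1≤g = ≤-trans (·-monoˡ-≤ 0≤1 size) (≤-trans
      (sumOver-avoiding bs (S [ b ]≔ false) 0≤g λ r r∈ r∉bs → let r≢b = ∈-remove⇒≢ S b r∈ ∘ ≡.sym in
        1≤g r (≡.trans (≡.sym (Vec.lookup∘update′ r≢b S false)) r∈) (r≢b ∷ r∉bs))
      (sumOver-remove-≤ S b 0≤g))
    where
    size : ∣ S ∣ ℕ.∸ ℕ.suc (length bs) ℕ.≤ ∣ S [ b ]≔ false ∣ ℕ.∸ length bs
    size = ℕ.∸-monoˡ-≤ (ℕ.suc (length bs)) (∣p∣-remove-≤ S b)

  sumList-filter-∈? : ∀ {k} (p : Subset k) g → sumList (List.filter (_∈? p) (allFin k)) g ≈ sumOver p g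
  sumList-filter-∈? []          g = refl
  sumList-filter-∈? (true ∷ p)  g = +-congˡ (trans (reflexive (≡.cong (λ xs → sumList xs g) (filter-∈?-suc true p id)))
    (trans (sumList-map suc (List.filter (_∈? p) (allFin _)) g) (sumList-filter-∈? p (g ∘ suc))))
  sumList-filter-∈? (false ∷ p) g = trans (reflexive (≡.cong (λ xs → sumList xs g) (filter-∈?-suc false p id)))
    (trans (sumList-map suc (List.filter (_∈? p) (allFin _)) g) (sumList-filter-∈? p (g ∘ suc)))

  matched : Fin n → Fin m → State′ → State′
  matched = match K opt

  𝔼-explore : ∀ v M Lₐ f → 𝔼 K (explore K opt v (M , Lₐ)) f ≈ sumOver Lₐ (λ l → f (matched v l (M , Lₐ))) ÷ ∣ Lₐ ∣
  𝔼-explore v M Lₐ f = trans (𝔼->>= (uniform K candidates) (λ l → return K (matched v l (M , Lₐ))) f)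
    (trans (𝔼-cong (uniform K candidates) (λ l → 𝔼-return (matched v l (M , Lₐ)) f))
    (trans (𝔼-uniform candidates (λ l → f (matched v l (M , Lₐ))))
    (trans (reflexive (≡.cong (sumList candidates (λ l → f (matched v l (M , Lₐ))) ÷_) (length-filter-∈? Lₐ)))
      (÷-cong ∣ Lₐ ∣ (sumList-filter-∈? Lₐ _)))))
    where candidates = List.filter (_∈? Lₐ) (allFin m)

  𝟙 : Bool → Carrier
  𝟙 x = if x then 1# else 0#

  𝟙-nonneg : ∀ x → 0# ≤ 𝟙 x
  𝟙-nonneg true  = 0≤1
  𝟙-nonneg false = ≤-refl

  1≤𝟙 : ∀ {x} → x ≡ true → 1# ≤ 𝟙 x
  1≤𝟙 ≡.refl = ≤-refl

  -- The chance to avoid `bs` is at least `(∣ Lₐ ∣ - j) / ∣ Lₐ ∣`, where `j` is the length of `bs`.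
  -- This increases with the size of `L_a`, so a lower bound `z` for that random size may take its
  -- place.
  𝔼-explore-avoiding : ∀ bs v M Lₐ (f : State′ → Bool) z → 1 ℕ.≤ ∣ Lₐ ∣ → z ℕ.≤ ∣ Lₐ ∣ →
    (∀ x → lookup Lₐ x ≡ true → All (x ≢_) bs → f (matched v x (M , Lₐ)) ≡ true) →
    fromℕ (z ℕ.∸ length bs) ≤ z · 𝔼 K (explore K opt v (M , Lₐ)) (𝟙 ∘ f)
  𝔼-explore-avoiding bs v M Lₐ f z 1≤ z≤ ok = ·-cancel-≤ ∣ Lₐ ∣ (begin
    ∣ Lₐ ∣ · fromℕ (z ℕ.∸ j)              ≈⟨ ×-assocˡ 1# ∣ Lₐ ∣ (z ℕ.∸ j) ⟩
    fromℕ (∣ Lₐ ∣ ℕ.* (z ℕ.∸ j))          ≤⟨ ·-monoˡ-≤ 0≤1 arith ⟩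
    fromℕ (z ℕ.* (∣ Lₐ ∣ ℕ.∸ j))          ≈⟨ ×-assocˡ 1# z _ ⟨
    z · fromℕ (∣ Lₐ ∣ ℕ.∸ j)              ≤⟨ ·-monoʳ-≤ z (sumOver-avoiding bs Lₐ (λ x → 𝟙-nonneg (f _)) λ x x∈ x∉ → 1≤𝟙 (ok x x∈ x∉)) ⟩
    z · sumOver Lₐ g                      ≈⟨ ×-congʳ z (·-÷ ∣ Lₐ ∣ _) ⟨
    z · (∣ Lₐ ∣ · (sumOver Lₐ g ÷ ∣ Lₐ ∣)) ≈⟨ ·-comm-· z ∣ Lₐ ∣ _ ⟩
    ∣ Lₐ ∣ · (z · (sumOver Lₐ g ÷ ∣ Lₐ ∣)) ≈⟨ ×-congʳ ∣ Lₐ ∣ (×-congʳ z (𝔼-explore v M Lₐ (𝟙 ∘ f))) ⟨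
    ∣ Lₐ ∣ · (z · 𝔼 K (explore K opt v (M , Lₐ)) (𝟙 ∘ f)) ∎)
    where
    open ≤-Reasoning
    instance _ = ℕ.>-nonZero 1≤
    j = length bs
    g = λ l → 𝟙 (f (matched v l (M , Lₐ)))
    arith : ∣ Lₐ ∣ ℕ.* (z ℕ.∸ j) ℕ.≤ z ℕ.* (∣ Lₐ ∣ ℕ.∸ j)
    arith = ℕ.≤-trans (ℕ.≤-reflexive (ℕ.*-distribˡ-∸ ∣ Lₐ ∣ z j)) (ℕ.≤-trans
      (ℕ.∸-mono (ℕ.≤-reflexive (ℕ.*-comm ∣ Lₐ ∣ z)) (ℕ.*-monoˡ-≤ j z≤))
      (ℕ.≤-reflexive (≡.sym (ℕ.*-distribˡ-∸ z ∣ Lₐ ∣ j))))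

  module AtState {S v} (v∈S : lookup S v ≡ true) (∣S∣≤n : ∣ S ∣ ℕ.≤ n) (n≡2m : n ≡ 2 ℕ.* m)
                 {M : Edges m n} {Lₐ : Subset m} (inv : Invariant (S [ v ]≔ false) (M , Lₐ)) where

    open Invariant inv
    s = (M , Lₐ)

    ∣S-v∣<2m : ∣ S [ v ]≔ false ∣ ℕ.< 2 ℕ.* m
    ∣S-v∣<2m = ℕ.≤-trans (ℕ.≤-reflexive (≡.sym (∣S∣-remove S v v∈S))) (ℕ.≤-trans ∣S∣≤n (ℕ.≤-reflexive n≡2m))

    Mv≡nothing : lookup M v ≡ nothing
    Mv≡nothing = fresh v (Vec.lookup∘update v S false)

    1≤∣Lₐ∣ : 1 ℕ.≤ ∣ Lₐ ∣
    1≤∣Lₐ∣ = nonempty phase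
      where
      nonempty : Phase M Lₐ → 1 ℕ.≤ ∣ Lₐ ∣
      nonempty (round₁ _ (l , l∈))  = ℕ.≤-trans (ℕ.s≤s ℕ.z≤n) (ℕ.≤-reflexive (≡.sym (∣S∣-remove Lₐ l l∈)))
      nonempty (round₂ deg≥1 Lₐ≡) = ℕ.≤-trans (ℕ.m<n⇒0<n∸m ∣S-v∣<2m) (∣Lₐ∣-round₂ deg≥1 Lₐ≡)

    exploit-unsaturated : ∀ p f → degree M p ℕ.< 2 → 𝔼 K (exploit K opt v (just p) s) f ≈ f (matched v p s)
    exploit-unsaturated p f d<2
      rewrite dec-true (isMatching? (M [ v ]≔ just p)) (degree-match-≤2 M v p Mv≡nothing d<2 isMatching)
      = 𝔼-return (matched v p s) f

    exploit-saturated : ∀ p → 2 ℕ.≤ degree M p → exploit K opt v (just p) s ≡ explore K opt v s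
    exploit-saturated p 2≤d
      rewrite dec-false (isMatching? (M [ v ]≔ just p)) (λ M′≤2 → ℕ.<⇒≱ (ℕ.s≤s 2≤d)
        (ℕ.≤-trans (ℕ.≤-reflexive (≡.sym (degree-match-same M v p Mv≡nothing))) (M′≤2 p)))
      = ≡.refl

    explore-mono : ∀ {f g} → (∀ s′ → Invariant S s′ → f s′ ≤ g s′) →
      𝔼 K (explore K opt v s) f ≤ 𝔼 K (explore K opt v s) g
    explore-mono {f} {g} f≤g = begin
      𝔼 K (explore K opt v s) f ≈⟨ 𝔼-explore v M Lₐ f ⟩
      _ ≤⟨ ÷-≤ ∣ Lₐ ∣ (≤-trans (sumOver-mono Lₐ λ l l∈ → f≤g _ (match-invariant K opt v l v∈S inv (Lₐ⇒<2 l l∈)))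
                       (≤-reflexive (sym (·-÷ ∣ Lₐ ∣ _)))) ⟩
      _ ≈⟨ 𝔼-explore v M Lₐ g ⟨
      𝔼 K (explore K opt v s) g ∎
      where
      open ≤-Reasoning
      instance _ = ℕ.>-nonZero 1≤∣Lₐ∣

    exploit-mono : ∀ e {f g} → (∀ s′ → Invariant S s′ → f s′ ≤ g s′) →
      𝔼 K (exploit K opt v e s) f ≤ 𝔼 K (exploit K opt v e s) g
    exploit-mono nothing  f≤g = explore-mono f≤g
    exploit-mono (just p) {f} {g} f≤g with degree M p ℕ.<? 2
    ... | yes d<2 = ≤-trans (≤-reflexive (exploit-unsaturated p f d<2)) (≤-trans
          (f≤g _ (match-invariant K opt v p v∈S inv d<2)) (≤-reflexive (sym (exploit-unsaturated p g d<2))))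
    ... | no  d≮2 rewrite exploit-saturated p (ℕ.≮⇒≥ d≮2) = explore-mono f≤g

    stepInto-mono : ∀ t {f g} → (∀ s′ → Invariant S s′ → f s′ ≤ g s′) →
      𝔼 K (stepInto t S v s) f ≤ 𝔼 K (stepInto t S v s) g
    stepInto-mono t f≤g with ℕ.suc t <ᵇ n ℕ./ 4
    ... | true  = explore-mono f≤g
    ... | false = exploit-mono (lookup (opt S) v) f≤g

    degree<-other : ∀ i {x l} → x ≢ l → (degree M l <ᵇ i) ≡ true → (degree (M [ v ]≔ just x) l <ᵇ i) ≡ true
    degree<-other i x≢l = ≡.trans (≡.cong (_<ᵇ i) (degree-match-other M v x≢l Mv≡nothing))

    degree<-same : ∀ i l → (degree M l <ᵇ i) ≡ true → (degree (M [ v ]≔ just l) l <ᵇ ℕ.suc i) ≡ true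
    degree<-same i l d<i = ≡.trans (≡.cong (_<ᵇ ℕ.suc i) (degree-match-same M v l Mv≡nothing)) d<i

    -- A random choice of the first round has degree 0, so even `l` itself, if chosen, only reaches
    -- degree 1.
    degree<2-round₁ : Lₐ ≡ low 1 M → ∀ {x l} → lookup Lₐ x ≡ true → (degree M l <ᵇ 2) ≡ true →
      (degree (M [ v ]≔ just x) l <ᵇ 2) ≡ true
    degree<2-round₁ Lₐ≡ {x} {l} x∈ d<2 with x Fin.≟ l
    ... | yes ≡.refl = degree<-same 1 x (≡.trans (≡.sym (≡.trans (≡.cong (λ p → lookup p x) Lₐ≡) (lookup-low 1 M x))) x∈)
    ... | no  x≢l    = degree<-other 2 x≢l d<2

    explore-nonneg : ∀ (f : State′ → Bool) → 0# ≤ 𝔼 K (explore K opt v s) (𝟙 ∘ f)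
    explore-nonneg f = ≤-trans (÷-nonneg ∣ Lₐ ∣ (sumOver-nonneg Lₐ λ l → 𝟙-nonneg (f _)))
      (≤-reflexive (sym (𝔼-explore v M Lₐ (𝟙 ∘ f))))
      where instance _ = ℕ.>-nonZero 1≤∣Lₐ∣

    explore-avoiding : ∀ bs (f : State′ → Bool) {z} → z ℕ.≤ ∣ Lₐ ∣ →
      (f s ≡ true → ∀ x → lookup Lₐ x ≡ true → All (x ≢_) bs → f (matched v x s) ≡ true) →
      (z ℕ.∸ length bs) · 𝟙 (f s) ≤ z · 𝔼 K (explore K opt v s) (𝟙 ∘ f)
    explore-avoiding bs f {z} z≤ ok with f s
    ... | true  = 𝔼-explore-avoiding bs v M Lₐ f z 1≤∣Lₐ∣ z≤ (ok ≡.refl)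
    ... | false = ≤-trans (≤-reflexive (·-zeroʳ (z ℕ.∸ length bs))) (·-nonneg z (explore-nonneg f))

    exploit-nonneg : ∀ p (f : State′ → Bool) → 0# ≤ 𝔼 K (exploit K opt v (just p) s) (𝟙 ∘ f)
    exploit-nonneg p f with degree M p ℕ.<? 2
    ... | yes d<2 = ≤-trans (𝟙-nonneg _) (≤-reflexive (sym (exploit-unsaturated p (𝟙 ∘ f) d<2)))
    ... | no  d≮2 rewrite exploit-saturated p (ℕ.≮⇒≥ d≮2) = explore-nonneg f

    exploit-hit : ∀ p (g f : State′ → Bool) → (g s ≡ true → degree M p ℕ.< 2 × f (matched v p s) ≡ true) →
      𝟙 (g s) ≤ 𝔼 K (exploit K opt v (just p) s) (𝟙 ∘ f)
    exploit-hit p g f ok with g s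
    ... | false = exploit-nonneg p f
    ... | true  = let (d<2 , f≡) = ok ≡.refl in
      ≤-trans (1≤𝟙 f≡) (≤-reflexive (sym (exploit-unsaturated p (𝟙 ∘ f) d<2)))

    -- If `p` is unsaturated, the event survives for certain, which beats the fraction `k / z`;
    -- otherwise the step is a random choice.
    exploit-miss : ∀ p (f : State′ → Bool) {k z} → k ℕ.≤ z →
      k · 𝟙 (f s) ≤ z · 𝔼 K (explore K opt v s) (𝟙 ∘ f) →
      (f s ≡ true → f (matched v p s) ≡ true) →
      k · 𝟙 (f s) ≤ z · 𝔼 K (exploit K opt v (just p) s) (𝟙 ∘ f)
    exploit-miss p f {k} {z} k≤z le ok with degree M p ℕ.<? 2
    ... | yes d<2 = ·-mono-≤ (𝟙-nonneg (f s)) k≤z (exploit-hit p f f λ eq → d<2 , ok eq)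
    ... | no  d≮2 rewrite exploit-saturated p (ℕ.≮⇒≥ d≮2) = le

    -- When p is unsaturated, the proposed edge is added and no random choice is made.
    exploit-miss-unsaturated : ∀ p (f : State′ → Bool) {z} → 1 ℕ.≤ z →
      (z ℕ.∸ 1) · 𝟙 (f s) ≤ z · 𝔼 K (explore K opt v s) (𝟙 ∘ f) →
      (f s ≡ true → f (matched v p s) ≡ true) →
      (z ℕ.∸ 1) · 𝟙 (f s) + 𝟙 (f s ∧ (degree M p <ᵇ 2)) ≤ z · 𝔼 K (exploit K opt v (just p) s) (𝟙 ∘ f)
    exploit-miss-unsaturated p f {ℕ.suc z} 1≤z le ok with degree M p ℕ.<? 2
    ... | yes d<2 rewrite <ᵇ-true d<2 | Bool.∧-identityʳ (f s) = ≤-trans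
          (≤-reflexive (+-comm _ _)) (·-monoʳ-≤ (ℕ.suc z) (exploit-hit p f f λ eq → d<2 , ok eq))
    ... | no  d≮2 rewrite <ᵇ-false (ℕ.≮⇒≥ d≮2) | Bool.∧-zeroʳ (f s) | exploit-saturated p (ℕ.≮⇒≥ d≮2) =
      ≤-trans (≤-reflexive (+-identityʳ _)) le

-- The recursion for the lower bounds

module Sequences {ℓ ℓ₁ ℓ₂} (K : OrderedField ℓ ℓ₁ ℓ₂) where

  open OrderedField K hiding (zero)
  open OrderedFieldProperties K

  -- The least favourable distribution of `u` arrivals: two propose `l`, two propose `l′`, the rest
  -- go elsewhere. The truncations keep the three counts adding up to `u` when `u < 4`.
  α β γ : ℕ → ℕ
  α u = 2 ℕ.⊓ u
  β u = (u ℕ.∸ 2) ℕ.⊓ 2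
  γ u = u ℕ.∸ 4

  -- The average of at most two values x₁, at most two values x₂ and otherwise values x₃,
  -- over suc t arrivals; each xᵢ comes multiplied by z.
  mix : ℕ → ℕ → Carrier → Carrier → Carrier → Carrier
  mix t z x₁ x₂ x₃ = (α (ℕ.suc t) · x₁ + β (ℕ.suc t) · x₂ + γ (ℕ.suc t) · x₃) ÷ (ℕ.suc t ℕ.* z)

  -- Lower bounds, for l ≠ l′, on the probabilities of
  -- a: deg l = 0;  b: deg l < 2;  c: deg l = 0 and deg l′ < 2;
  -- d: deg l = deg l′ = 0;  e: deg l < 2 and deg l′ < 2.
  record Values : Set ℓ where
    constructor values
    field
      a b c d e : Carrier

  -- At least `z` vertices of degree 0 are available. One given vertex is avoided with probability
  -- `(z - 1) / z`, two with `(z - 2) / z`; saturation cannot occur, so `b` and `e` persist and `c`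
  -- is at risk through `l` only.
  exploreNext : ℕ → Values → Values
  exploreNext z (values a b c d e) =
    values (((z ℕ.∸ 1) · a) ÷ z) b (((z ℕ.∸ 1) · c) ÷ z) (((z ℕ.∸ 2) · d) ÷ z) e

  -- The arguments of `mix` stand for a proposal of `l`, of `l′`, and of another vertex `p`. A
  -- proposed `l` still has degree below 2 if it had degree 0, which leads from `b` to `a` and from
  -- `e` to `c`. In `(z ∸ 1) · a + c` the term `c` is for the pair of `l` and `p`: if `p` is
  -- unsaturated, the whole `z` counts instead of `z ∸ 1`. In the component `c`, a proposal of `l′`
  -- would allow `z · d`; with `z ∸ 1` the arguments stay increasing, as `mix-sum` demands.
  round₁Next : ℕ → ℕ → Values → Values
  round₁Next t z (values a b c d e) = values
    (mix t z 0# ((z ℕ.∸ 1) · a + c) ((z ℕ.∸ 1) · a + c))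
    (mix t 1 a b b)
    (mix t z 0# ((z ℕ.∸ 1) · d) ((z ℕ.∸ 1) · c))
    (mix t z 0# 0# ((z ℕ.∸ 2) · d))
    (mix t 1 c c e)

  -- From time `m` on there may be no vertex of degree 0 left, so `a`, `c` and `d` are given up, and
  -- with them every case in which `l` itself is proposed.
  round₂Next : ℕ → ℕ → Values → Values
  round₂Next t z (values a b c d e) = values
    0# (mix t z 0# ((z ℕ.∸ 1) · b + e) ((z ℕ.∸ 1) · b + e)) 0# 0# (mix t z 0# 0# ((z ℕ.∸ 2) · e))

  -- In the application k is n / 4.
  next : ℕ → ℕ → ℕ → Values → Values
  next m k t v =
    if ℕ.suc t <ᵇ k then exploreNext (m ℕ.∸ t) v
    else if t <ᵇ m then round₁Next t (m ℕ.∸ t) v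
    else round₂Next t (2 ℕ.* m ℕ.∸ t) v

  valuesAt : ℕ → ℕ → ℕ → Values
  valuesAt m k ℕ.zero    = values 1# 1# 1# 1# 1#
  valuesAt m k (ℕ.suc t) = next m k t (valuesAt m k t)

  -- The step at time t adds its proposed edge with probability at least gain m k t.
  gain : ℕ → ℕ → ℕ → Carrier
  gain m k t = if ℕ.suc t <ᵇ k then 0# else Values.b (valuesAt m k t)

  totalGain : ℕ → ℕ → ℕ → Carrier
  totalGain m k ℕ.zero    = 0#
  totalGain m k (ℕ.suc t) = totalGain m k t + gain m k t

  -- The five events are ordered by inclusion, but their lower bounds inherit this only through the
  -- recursion. The order is what makes the counts `α`, `β`, `γ` the least favourable ones.
  record Ordered (v : Values) : Set ℓ₂ where
    open Values v
    field
      0≤d : 0# ≤ d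
      d≤c : d ≤ c
      c≤a : c ≤ a
      c≤e : c ≤ e
      a≤b : a ≤ b
      e≤b : e ≤ b
    0≤c = ≤-trans 0≤d d≤c
    0≤a = ≤-trans 0≤c c≤a
    0≤e = ≤-trans 0≤c c≤e
    0≤b = ≤-trans 0≤a a≤b

  mix-mono : ∀ t z .{{_ : ℕ.NonZero z}} {x₁ x₂ x₃ y₁ y₂ y₃} → x₁ ≤ y₁ → x₂ ≤ y₂ → x₃ ≤ y₃ →
    mix t z x₁ x₂ x₃ ≤ mix t z y₁ y₂ y₃
  mix-mono t z p₁ p₂ p₃ = ÷-≤ k (≤-trans
    (+-mono-≤ (+-mono-≤ (·-monoʳ-≤ (α (ℕ.suc t)) p₁) (·-monoʳ-≤ (β (ℕ.suc t)) p₂)) (·-monoʳ-≤ (γ (ℕ.suc t)) p₃))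
    (≤-reflexive (sym (·-÷ k _))))
    where
    k = ℕ.suc t ℕ.* z
    instance _ = ℕ.m*n≢0 (ℕ.suc t) z

  mix-nonneg : ∀ t z .{{_ : ℕ.NonZero z}} {x₁ x₂ x₃} → 0# ≤ x₁ → 0# ≤ x₂ → 0# ≤ x₃ → 0# ≤ mix t z x₁ x₂ x₃
  mix-nonneg t z p₁ p₂ p₃ = ÷-nonneg (ℕ.suc t ℕ.* z)
    (+-nonneg (+-nonneg (·-nonneg (α (ℕ.suc t)) p₁) (·-nonneg (β (ℕ.suc t)) p₂)) (·-nonneg (γ (ℕ.suc t)) p₃))
    where instance _ = ℕ.m*n≢0 (ℕ.suc t) z

  mix-scale : ∀ t z .{{_ : ℕ.NonZero z}} x₁ x₂ x₃ → mix t z (z · x₁) (z · x₂) (z · x₃) ≤ mix t 1 x₁ x₂ x₃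
  mix-scale t z x₁ x₂ x₃ = ÷-≤ (ℕ.suc t ℕ.* z) (≤-reflexive (sym (begin
    (ℕ.suc t ℕ.* z) · X                  ≈⟨ ·-congˡ (≡.cong (ℕ._* z) (≡.sym (ℕ.*-identityʳ (ℕ.suc t)))) ⟩
    (ℕ.suc t ℕ.* 1 ℕ.* z) · X            ≈⟨ ·-congˡ (ℕ.*-comm (ℕ.suc t ℕ.* 1) z) ⟩
    (z ℕ.* (ℕ.suc t ℕ.* 1)) · X          ≈⟨ ×-assocˡ X z (ℕ.suc t ℕ.* 1) ⟨
    z · ((ℕ.suc t ℕ.* 1) · X)            ≈⟨ ×-congʳ z (·-÷ (ℕ.suc t ℕ.* 1) _) ⟩
    z · (A · x₁ + B · x₂ + C · x₃)       ≈⟨ ·-distrib-+ z _ _ ⟩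
    z · (A · x₁ + B · x₂) + z · (C · x₃) ≈⟨ +-congʳ (·-distrib-+ z _ _) ⟩
    z · (A · x₁) + z · (B · x₂) + z · (C · x₃) ≈⟨ +-cong (+-cong (·-comm-· z A x₁) (·-comm-· z B x₂)) (·-comm-· z C x₃) ⟩
    A · (z · x₁) + B · (z · x₂) + C · (z · x₃) ∎)))
    where
    open import Relation.Binary.Reasoning.Setoid setoid
    A = α (ℕ.suc t)
    B = β (ℕ.suc t)
    C = γ (ℕ.suc t)
    X = mix t 1 x₁ x₂ x₃
    instance _ = ℕ.m*n≢0 (ℕ.suc t) z

  z∸1+1 : ∀ z .{{_ : ℕ.NonZero z}} {x y} → x ≤ y → (z ℕ.∸ 1) · y + x ≤ z · y
  z∸1+1 (ℕ.suc z) x≤y = ≤-trans (+-monoʳ-≤ _ x≤y) (≤-reflexive (+-comm _ _))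

  exploreNext-ordered : ∀ z .{{_ : ℕ.NonZero z}} v → Ordered v → Ordered (exploreNext z v)
  exploreNext-ordered z v o = record
    { 0≤d = ÷-nonneg z (·-nonneg (z ℕ.∸ 2) 0≤d)
    ; d≤c = mono (·-mono-≤ 0≤d (ℕ.∸-monoʳ-≤ z (ℕ.s≤s ℕ.z≤n)) d≤c)
    ; c≤a = mono (·-monoʳ-≤ (z ℕ.∸ 1) c≤a)
    ; c≤e = ÷-≤ z (·-mono-≤ 0≤c (ℕ.m∸n≤m z 1) c≤e)
    ; a≤b = ÷-≤ z (·-mono-≤ 0≤a (ℕ.m∸n≤m z 1) a≤b)
    ; e≤b = e≤b
    }
    where
    open Ordered o
    mono : ∀ {x y} → x ≤ y → x ÷ z ≤ y ÷ z
    mono p = ÷-≤ z (≤-trans p (≤-reflexive (sym (·-÷ z _))))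

  round₁Next-ordered : ∀ t z .{{_ : ℕ.NonZero z}} v → Ordered v → Ordered (round₁Next t z v)
  round₁Next-ordered t z v o = record
    { 0≤d = mix-nonneg t z ≤-refl ≤-refl (·-nonneg (z ℕ.∸ 2) 0≤d)
    ; d≤c = mix-mono t z ≤-refl (·-nonneg (z ℕ.∸ 1) 0≤d) (·-mono-≤ 0≤d (ℕ.∸-monoʳ-≤ z (ℕ.s≤s ℕ.z≤n)) d≤c)
    ; c≤a = mix-mono t z ≤-refl (≤-trans (·-monoʳ-≤ (z ℕ.∸ 1) (≤-trans d≤c c≤a)) (x≤x+y 0≤c))
                                (≤-trans (·-monoʳ-≤ (z ℕ.∸ 1) c≤a) (x≤x+y 0≤c))
    ; c≤e = ≤-trans (mix-mono t z (·-nonneg z 0≤c) (·-mono-≤ 0≤d (ℕ.m∸n≤m z 1) d≤c) (·-mono-≤ 0≤c (ℕ.m∸n≤m z 1) c≤e))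
                    (mix-scale t z _ _ _)
    ; a≤b = ≤-trans (mix-mono t z (·-nonneg z 0≤a) X≤z·b X≤z·b) (mix-scale t z _ _ _)
    ; e≤b = mix-mono t 1 c≤a (≤-trans c≤e e≤b) e≤b
    }
    where
    open Ordered o
    X≤z·b = ≤-trans (z∸1+1 z c≤a) (·-monoʳ-≤ z a≤b)

  round₂Next-ordered : ∀ t z .{{_ : ℕ.NonZero z}} v → Ordered v → Ordered (round₂Next t z v)
  round₂Next-ordered t z v o = record
    { 0≤d = ≤-refl
    ; d≤c = ≤-refl
    ; c≤a = ≤-refl
    ; c≤e = mix-nonneg t z ≤-refl ≤-refl (·-nonneg (z ℕ.∸ 2) 0≤e)
    ; a≤b = mix-nonneg t z ≤-refl 0≤Y 0≤Y
    ; e≤b = mix-mono t z ≤-refl 0≤Y (≤-trans (·-mono-≤ 0≤e (ℕ.∸-monoʳ-≤ z (ℕ.s≤s ℕ.z≤n)) e≤b) (x≤x+y 0≤e))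
    }
    where
    open Ordered o
    0≤Y = +-nonneg (·-nonneg (z ℕ.∸ 1) 0≤b) 0≤e

  ∸-nonZero : ∀ {m t} → t ℕ.< m → ℕ.NonZero (m ℕ.∸ t)
  ∸-nonZero t<m = ℕ.>-nonZero (ℕ.m<n⇒0<n∸m t<m)

  valuesAt-ordered : ∀ m k t → k ℕ.≤ m → t ℕ.≤ 2 ℕ.* m → Ordered (valuesAt m k t)
  valuesAt-ordered m k ℕ.zero    k≤m t≤2m = record
    { 0≤d = 0≤1 ; d≤c = ≤-refl ; c≤a = ≤-refl ; c≤e = ≤-refl ; a≤b = ≤-refl ; e≤b = ≤-refl }
  valuesAt-ordered m k (ℕ.suc t) k≤m t<2m with ℕ.suc t <ᵇ k in eq₁ | t <ᵇ m in eq₂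
  ... | true  | _     = exploreNext-ordered (m ℕ.∸ t) {{∸-nonZero (ℕ.<-trans (ℕ.n<1+n t) (ℕ.<-≤-trans (true-<ᵇ eq₁) k≤m))}} _
                          (valuesAt-ordered m k t k≤m (ℕ.<⇒≤ t<2m))
  ... | false | true  = round₁Next-ordered t (m ℕ.∸ t) {{∸-nonZero {m} {t} (true-<ᵇ eq₂)}} _ (valuesAt-ordered m k t k≤m (ℕ.<⇒≤ t<2m))
  ... | false | false = round₂Next-ordered t (2 ℕ.* m ℕ.∸ t) {{∸-nonZero t<2m}} _ (valuesAt-ordered m k t k≤m (ℕ.<⇒≤ t<2m))

-- Counting the arrivals that propose a given vertex

degree-∷ : ∀ {m n} e (M : Edges m n) l → degree M l ℕ.≤ degree (e ∷ M) l
degree-∷ e M l with does (≡-dec Fin._≟_ e (just l))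
... | true  = ℕ.n≤1+n _
... | false = ℕ.≤-refl

degree-∷-just : ∀ {m n e} (M : Edges m n) {l} → e ≡ just l → degree (e ∷ M) l ≡ ℕ.suc (degree M l)
degree-∷-just M {l} ≡.refl rewrite dec-true (≡-dec Fin._≟_ (just l) (just l)) ≡.refl = ≡.refl

-- Partial sums are compared, not single counts: for `u = 3`, two arrivals may propose `l′` although
-- only one is left for it after the two of `l`.
abel-nat : ∀ {N₁ N₂ N₃ u d₁ d₂} → N₁ ℕ.+ N₂ ℕ.+ N₃ ≡ u → N₁ ℕ.≤ d₁ → N₂ ℕ.≤ d₂ → d₁ ℕ.≤ 2 → d₂ ℕ.≤ 2 →
  N₁ ℕ.≤ 2 ℕ.⊓ u × N₁ ℕ.+ N₂ ℕ.≤ 2 ℕ.⊓ u ℕ.+ (u ℕ.∸ 2) ℕ.⊓ 2 ×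
  2 ℕ.⊓ u ℕ.+ (u ℕ.∸ 2) ℕ.⊓ 2 ℕ.+ (u ℕ.∸ 4) ≡ u
abel-nat {N₁} {N₂} {N₃} {u} ≡.refl N₁≤ N₂≤ d₁≤2 d₂≤2 =
  ℕ.⊓-glb (ℕ.≤-trans N₁≤ d₁≤2) (ℕ.≤-trans (ℕ.m≤m+n N₁ N₂) (ℕ.m≤m+n _ N₃)) ,
  ℕ.≤-trans (ℕ.⊓-glb (ℕ.+-mono-≤ (ℕ.≤-trans N₁≤ d₁≤2) (ℕ.≤-trans N₂≤ d₂≤2)) (ℕ.m≤m+n (N₁ ℕ.+ N₂) N₃)) (ℕ.≤-reflexive (≡.sym (four _))) ,
  total _
  where
  four : ∀ u → 2 ℕ.⊓ u ℕ.+ (u ℕ.∸ 2) ℕ.⊓ 2 ≡ 4 ℕ.⊓ u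
  four 0 = ≡.refl
  four 1 = ≡.refl
  four 2 = ≡.refl
  four 3 = ≡.refl
  four (ℕ.suc (ℕ.suc (ℕ.suc (ℕ.suc u)))) = ≡.cong (4 ℕ.+_) (ℕ.⊓-zeroʳ u)
  total : ∀ u → 2 ℕ.⊓ u ℕ.+ (u ℕ.∸ 2) ℕ.⊓ 2 ℕ.+ (u ℕ.∸ 4) ≡ u
  total 0 = ≡.refl
  total 1 = ≡.refl
  total 2 = ≡.refl
  total 3 = ≡.refl
  total (ℕ.suc (ℕ.suc (ℕ.suc (ℕ.suc u)))) = ≡.cong (λ k → 4 ℕ.+ k ℕ.+ u) (ℕ.⊓-zeroʳ u)

module Counting {ℓ ℓ₁ ℓ₂} (K : OrderedField ℓ ℓ₁ ℓ₂) where

  open OrderedField K hiding (zero)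
  open OrderedFieldProperties K
  open SumOver K
  open Sequences K
  open import Algebra.Properties.CommutativeSemigroup +-commutativeSemigroup using (x∙yz≈y∙xz)

  -- Summation by parts: weight moved to smaller values lowers the sum. Here `i` units carry `x₁`
  -- instead of `x₂`, and `j` units carry `x₂` instead of `x₃`.
  abel : ∀ {A B C A′ B′ C′ x₁ x₂ x₃} → x₁ ≤ x₂ → x₂ ≤ x₃ → A ℕ.≤ A′ → A ℕ.+ B ℕ.≤ A′ ℕ.+ B′ →
    A ℕ.+ B ℕ.+ C ≡ A′ ℕ.+ B′ ℕ.+ C′ → A′ · x₁ + B′ · x₂ + C′ · x₃ ≤ A · x₁ + B · x₂ + C · x₃
  abel {A} {B} {C} {A′} {B′} {C′} {x₁} {x₂} {x₃} x₁≤x₂ x₂≤x₃ A≤ A+B≤ eq = begin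
    A′ · x₁ + B′ · x₂ + C′ · x₃              ≈⟨ +-congʳ (+-congʳ (trans (·-congˡ A′≡) (×-homo-+ x₁ A i))) ⟩
    A · x₁ + i · x₁ + B′ · x₂ + C′ · x₃      ≤⟨ +-monoˡ-≤ _ (+-monoˡ-≤ _ (+-monoʳ-≤ _ (·-monoʳ-≤ i x₁≤x₂))) ⟩
    A · x₁ + i · x₂ + B′ · x₂ + C′ · x₃      ≈⟨ +-congʳ (trans (+-assoc _ _ _) (+-congˡ (trans (sym (×-homo-+ x₂ i B′)) (trans (·-congˡ i+B′≡) (×-homo-+ x₂ B j))))) ⟩
    A · x₁ + (B · x₂ + j · x₂) + C′ · x₃     ≤⟨ +-monoˡ-≤ _ (+-monoʳ-≤ _ (+-monoʳ-≤ _ (·-monoʳ-≤ j x₂≤x₃))) ⟩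
    A · x₁ + (B · x₂ + j · x₃) + C′ · x₃     ≈⟨ trans (+-congʳ (sym (+-assoc _ _ _))) (trans (+-assoc _ _ _) (+-congˡ (trans (sym (×-homo-+ x₃ j C′)) (·-congˡ (≡.sym C≡))))) ⟩
    A · x₁ + B · x₂ + C · x₃                 ∎
    where
    open ≤-Reasoning
    i = A′ ℕ.∸ A
    j = A′ ℕ.+ B′ ℕ.∸ (A ℕ.+ B)
    A′≡ : A′ ≡ A ℕ.+ i
    A′≡ = ≡.sym (ℕ.m+[n∸m]≡n A≤)
    A′+B′≡ : A ℕ.+ B ℕ.+ j ≡ A′ ℕ.+ B′
    A′+B′≡ = ℕ.m+[n∸m]≡n A+B≤
    i+B′≡ : i ℕ.+ B′ ≡ B ℕ.+ j
    i+B′≡ = ℕ.+-cancelˡ-≡ A _ _ (≡.trans (≡.sym (ℕ.+-assoc A i B′)) (≡.trans (≡.cong (ℕ._+ B′) (≡.sym A′≡))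
      (≡.trans (≡.sym A′+B′≡) (ℕ.+-assoc A B j))))
    C≡ : C ≡ j ℕ.+ C′
    C≡ = ℕ.+-cancelˡ-≡ (A ℕ.+ B) _ _ (≡.trans eq (≡.trans (≡.cong (ℕ._+ C′) (≡.sym A′+B′≡)) (ℕ.+-assoc (A ℕ.+ B) j C′)))

  record Split {m n} (S : Subset n) (M : Edges m n) (l l′ : Fin m) (x₁ x₂ x₃ : Carrier) (y : Fin n → Carrier) : Set ℓ₂ where
    constructor split
    field
      N₁ N₂ N₃ : ℕ
      total≡   : N₁ ℕ.+ N₂ ℕ.+ N₃ ≡ ∣ S ∣
      N₁≤      : N₁ ℕ.≤ degree M l
      N₂≤      : N₂ ℕ.≤ degree M l′
      sum≤     : N₁ · x₁ + N₂ · x₂ + N₃ · x₃ ≤ sumOver S y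

  -- The choice `l′ = l` is allowed; the second class is then empty. The bounds for a single vertex
  -- use it with `x₂` and `x₃` equal.
  split-sum : ∀ {m n} (S : Subset n) (M : Edges m n) l l′ {x₁ x₂ x₃ y} →
    (∀ r → lookup S r ≡ true → lookup M r ≡ just l → x₁ ≤ y r) →
    (∀ r → lookup S r ≡ true → lookup M r ≢ just l → lookup M r ≡ just l′ → x₂ ≤ y r) →
    (∀ r → lookup S r ≡ true → lookup M r ≢ just l → lookup M r ≢ just l′ → x₃ ≤ y r) →
    Split S M l l′ x₁ x₂ x₃ y
  split-sum [] [] l l′ h₁ h₂ h₃ = split 0 0 0 ≡.refl ℕ.z≤n ℕ.z≤n
    (≤-reflexive (trans (+-identityʳ _) (+-identityʳ _)))
  split-sum (false ∷ S) (e ∷ M) l l′ h₁ h₂ h₃ with split-sum S M l l′ (h₁ ∘ suc) (h₂ ∘ suc) (h₃ ∘ suc)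
  ... | split N₁ N₂ N₃ t N₁≤ N₂≤ s≤ = split N₁ N₂ N₃ t (ℕ.≤-trans N₁≤ (degree-∷ e M l)) (ℕ.≤-trans N₂≤ (degree-∷ e M l′)) s≤
  split-sum (true ∷ S) (e ∷ M) l l′ {x₁} {x₂} {x₃} {y} h₁ h₂ h₃
    with split-sum S M l l′ (h₁ ∘ suc) (h₂ ∘ suc) (h₃ ∘ suc) | ≡-dec Fin._≟_ e (just l) | ≡-dec Fin._≟_ e (just l′)
  ... | split N₁ N₂ N₃ t N₁≤ N₂≤ s≤ | yes e≡l | _ = split (ℕ.suc N₁) N₂ N₃ (≡.cong ℕ.suc t)
        (ℕ.≤-trans (ℕ.s≤s N₁≤) (ℕ.≤-reflexive (≡.sym (degree-∷-just M e≡l)))) (ℕ.≤-trans N₂≤ (degree-∷ e M l′))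
        (≤-trans (≤-reflexive (trans (+-congʳ (+-assoc _ _ _)) (+-assoc _ _ _))) (+-mono-≤ (h₁ zero ≡.refl e≡l) s≤))
  ... | split N₁ N₂ N₃ t N₁≤ N₂≤ s≤ | no e≢l | yes e≡l′ = split N₁ (ℕ.suc N₂) N₃
        (≡.trans (≡.cong (ℕ._+ N₃) (ℕ.+-suc N₁ N₂)) (≡.cong ℕ.suc t))
        (ℕ.≤-trans N₁≤ (degree-∷ e M l)) (ℕ.≤-trans (ℕ.s≤s N₂≤) (ℕ.≤-reflexive (≡.sym (degree-∷-just M e≡l′))))
        (≤-trans (≤-reflexive (trans (+-congʳ (x∙yz≈y∙xz _ _ _)) (+-assoc _ _ _))) (+-mono-≤ (h₂ zero ≡.refl e≢l e≡l′) s≤))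
  ... | split N₁ N₂ N₃ t N₁≤ N₂≤ s≤ | no e≢l | no e≢l′ = split N₁ N₂ (ℕ.suc N₃)
        (≡.trans (ℕ.+-suc (N₁ ℕ.+ N₂) N₃) (≡.cong ℕ.suc t))
        (ℕ.≤-trans N₁≤ (degree-∷ e M l)) (ℕ.≤-trans N₂≤ (degree-∷ e M l′))
        (≤-trans (≤-reflexive (x∙yz≈y∙xz _ _ _)) (+-mono-≤ (h₃ zero ≡.refl e≢l e≢l′) s≤))

  mix-sum : ∀ {m n} (S : Subset n) (M : Edges m n) l l′ {x₁ x₂ x₃ y} → IsMatching M → x₁ ≤ x₂ → x₂ ≤ x₃ →
    Split S M l l′ x₁ x₂ x₃ y → α ∣ S ∣ · x₁ + β ∣ S ∣ · x₂ + γ ∣ S ∣ · x₃ ≤ sumOver S y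
  mix-sum S M l l′ M≤2 x₁≤x₂ x₂≤x₃ (split N₁ N₂ N₃ t N₁≤ N₂≤ s≤) =
    let (N₁≤α , N₁+N₂≤ , total) = abel-nat t N₁≤ N₂≤ (M≤2 l) (M≤2 l′)
    in ≤-trans (abel x₁≤x₂ x₂≤x₃ N₁≤α N₁+N₂≤ (≡.trans t (≡.sym total))) s≤

-- Conditional expectations and validity of the lower bounds

module CondE {ℓ ℓ₁ ℓ₂} (K : OrderedField ℓ ℓ₁ ℓ₂) {m n} (opt : Subset n → Edges m n)
             (n≡2m : n ≡ 2 ℕ.* m) .{{_ : ℕ.NonZero m}} where

  open OrderedField K hiding (zero)
  open OrderedFieldProperties K
  open SumOver K
  open Distributions K
  open Process opt
  open Steps K opt

  condE-cong : ∀ t S {f g} → (∀ s → f s ≈ g s) → condE t S f ≈ condE t S g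
  condE-cong ℕ.zero    S f≈g = f≈g initial
  condE-cong (ℕ.suc t) S f≈g = ÷-cong (ℕ.suc t) (sumOver-cong S λ r _ →
    condE-cong t (S [ r ]≔ false) λ s → 𝔼-cong (stepInto t S r s) f≈g)

  condE-+ : ∀ t S f g → condE t S (λ s → f s + g s) ≈ condE t S f + condE t S g
  condE-+ ℕ.zero    S f g = refl
  condE-+ (ℕ.suc t) S f g = trans (÷-cong (ℕ.suc t) (trans
    (sumOver-cong S λ r _ → trans
      (condE-cong t (S [ r ]≔ false) λ s → 𝔼-+ (stepInto t S r s) f g) (condE-+ t (S [ r ]≔ false) _ _))
    (sumOver-+ S _ _))) (distribˡ _ _ _)

  condE-* : ∀ t S x f → condE t S (λ s → x * f s) ≈ x * condE t S f
  condE-* ℕ.zero    S x f = refl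
  condE-* (ℕ.suc t) S x f = trans (÷-cong (ℕ.suc t) (trans
    (sumOver-cong S λ r _ → trans
      (condE-cong t (S [ r ]≔ false) λ s → 𝔼-* (stepInto t S r s) x f) (condE-* t (S [ r ]≔ false) x _))
    (sumOver-* S x _))) (x*yz≈y*xz _ x _)
    where open import Algebra.Properties.CommutativeSemigroup *-commutativeSemigroup using () renaming (x∙yz≈y∙xz to x*yz≈y*xz)

  condE-· : ∀ t S k f → condE t S (λ s → k · f s) ≈ k · condE t S f
  condE-· t S k f = trans (condE-cong t S λ s → sym (fromℕ-* k (f s)))
    (trans (condE-* t S (fromℕ k) f) (fromℕ-* k _))

  size-remove : ∀ {t} (S : Subset n) r → lookup S r ≡ true → ∣ S ∣ ≡ ℕ.suc t → ∣ S [ r ]≔ false ∣ ≡ t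
  size-remove S r r∈S ∣S∣≡ = ℕ.suc-injective (≡.trans (≡.sym (∣S∣-remove S r r∈S)) ∣S∣≡)

  -- This is where reachability enters: `stepInto-mono` pulls the comparison on invariant states
  -- back by one step, down to `initial`, which satisfies the invariant.
  condE-mono : ∀ t S {f g} → ∣ S ∣ ≡ t → (∀ s → Invariant S s → f s ≤ g s) → condE t S f ≤ condE t S g
  condE-mono ℕ.zero    S ∣S∣≡ f≤g rewrite ∣S∣≡0⇒S≡⊥ S ∣S∣≡ = f≤g initial initial-invariant′
    where
    initial-invariant′ : Invariant ⊥ initial
    initial-invariant′ = initial-invariant K opt
  condE-mono (ℕ.suc t) S ∣S∣≡ f≤g = ÷-≤ (ℕ.suc t) (≤-trans
    (sumOver-mono S λ r r∈S → condE-mono t (S [ r ]≔ false) (size-remove S r r∈S ∣S∣≡) λ s inv →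
      AtState.stepInto-mono r∈S (Subset.∣p∣≤n S) n≡2m inv t f≤g)
    (≤-reflexive (sym (·-÷ (ℕ.suc t) _))))

  condE-lift : ∀ t S {f g x} k z → ∣ S ∣ ≡ t → x ≤ condE t S g →
    (∀ s → Invariant S s → k · g s ≤ z · f s) → k · x ≤ z · condE t S f
  condE-lift t S {f} {g} {x} k z ∣S∣≡ x≤ le = begin
    k · x                     ≤⟨ ·-monoʳ-≤ k x≤ ⟩
    k · condE t S g           ≈⟨ condE-· t S k g ⟨
    condE t S (λ s → k · g s) ≤⟨ condE-mono t S ∣S∣≡ le ⟩
    condE t S (λ s → z · f s) ≈⟨ condE-· t S z f ⟩
    z · condE t S f           ∎
    where open ≤-Reasoning

  condE-lift₂ : ∀ t S {f g h x y} k z → ∣ S ∣ ≡ t → x ≤ condE t S g → y ≤ condE t S h →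
    (∀ s → Invariant S s → k · g s + h s ≤ z · f s) → k · x + y ≤ z · condE t S f
  condE-lift₂ t S {f} {g} {h} {x} {y} k z ∣S∣≡ x≤ y≤ le = begin
    k · x + y                                ≤⟨ +-mono-≤ (·-monoʳ-≤ k x≤) y≤ ⟩
    k · condE t S g + condE t S h            ≈⟨ +-congʳ (condE-· t S k g) ⟨
    condE t S (λ s → k · g s) + condE t S h  ≈⟨ condE-+ t S _ h ⟨
    condE t S (λ s → k · g s + h s)          ≤⟨ condE-mono t S ∣S∣≡ le ⟩
    condE t S (λ s → z · f s)                ≈⟨ condE-· t S z f ⟩
    z · condE t S f                          ∎
    where open ≤-Reasoning

  condE-suc : ∀ t S f z {y} → (∀ r → lookup S r ≡ true →
      y r ≤ z · condE t (S [ r ]≔ false) (λ s → 𝔼 K (stepInto t S r s) f)) →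
    sumOver S y ≤ (ℕ.suc t ℕ.* z) · condE (ℕ.suc t) S f
  condE-suc t S f z {y} le = begin
    sumOver S y                             ≤⟨ sumOver-mono S le ⟩
    sumOver S (λ r → z · X r)               ≈⟨ sumOver-· S z X ⟩
    z · sumOver S X                         ≈⟨ ×-congʳ z (·-÷ (ℕ.suc t) _) ⟨
    z · (ℕ.suc t · condE (ℕ.suc t) S f)     ≈⟨ ×-assocˡ _ z (ℕ.suc t) ⟩
    (z ℕ.* ℕ.suc t) · condE (ℕ.suc t) S f   ≈⟨ ·-congˡ (ℕ.*-comm z (ℕ.suc t)) ⟩
    (ℕ.suc t ℕ.* z) · condE (ℕ.suc t) S f   ∎
    where
    open ≤-Reasoning
    X = λ r → condE t (S [ r ]≔ false) (λ s → 𝔼 K (stepInto t S r s) f)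

  condE-suc-const : ∀ t S f z .{{_ : ℕ.NonZero z}} {x} → ∣ S ∣ ≡ ℕ.suc t → (∀ r → lookup S r ≡ true →
      x ≤ z · condE t (S [ r ]≔ false) (λ s → 𝔼 K (stepInto t S r s) f)) →
    x ÷ z ≤ condE (ℕ.suc t) S f
  condE-suc-const t S f z {x} ∣S∣≡ le = ÷-≤ z (·-cancel-≤ (ℕ.suc t) (begin
    ℕ.suc t · x                                ≈⟨ ·-congˡ ∣S∣≡ ⟨
    ∣ S ∣ · x                                  ≈⟨ sumOver-const S x ⟨
    sumOver S (λ _ → x)                        ≤⟨ condE-suc t S f z le ⟩
    (ℕ.suc t ℕ.* z) · condE (ℕ.suc t) S f      ≈⟨ ×-assocˡ _ (ℕ.suc t) z ⟨
    ℕ.suc t · (z · condE (ℕ.suc t) S f)        ∎))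
    where open ≤-Reasoning

  condE-nonneg : ∀ t S {f} → ∣ S ∣ ≡ t → (∀ s → 0# ≤ f s) → 0# ≤ condE t S f
  condE-nonneg t S {f} ∣S∣≡ 0≤f = begin
    0#                          ≈⟨ zeroˡ _ ⟨
    0# * condE t S f            ≈⟨ condE-* t S 0# f ⟨
    condE t S (λ s → 0# * f s)  ≤⟨ condE-mono t S ∣S∣≡ (λ s _ → ≤-trans (≤-reflexive (zeroˡ _)) (0≤f s)) ⟩
    condE t S f                 ∎
    where open ≤-Reasoning

  has : ℕ → Fin m → State′ → Bool
  has i l s = degree (proj₁ s) l <ᵇ i

  has₂ : ℕ → Fin m → ℕ → Fin m → State′ → Bool
  has₂ i l j l′ s = has i l s ∧ has j l′ s

  module Survival {S v} (v∈S : lookup S v ≡ true) {M : Edges m n} {Lₐ : Subset m}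
                  (inv : Invariant (S [ v ]≔ false) (M , Lₐ)) where

    open Invariant inv
    open AtState v∈S (Subset.∣p∣≤n S) n≡2m inv

    round₁-first : ∣ S [ v ]≔ false ∣ ℕ.< m → Lₐ ≡ low 1 M
    round₁-first <m with phase
    ... | round₁ Lₐ≡ _    = Lₐ≡
    ... | round₂ deg≥1 _  = contradiction (m≤∣S∣-round₂ deg≥1) (ℕ.<⇒≱ <m)

    z₁ z₂ : ℕ
    z₁ = m ℕ.∸ ∣ S [ v ]≔ false ∣
    z₂ = 2 ℕ.* m ℕ.∸ ∣ S [ v ]≔ false ∣

    Explored : (State′ → Bool) → Carrier
    Explored f = 𝔼 K (explore K opt v s) (𝟙 ∘ f)

    Exploited : Fin m → (State′ → Bool) → Carrier
    Exploited p f = 𝔼 K (exploit K opt v (just p) s) (𝟙 ∘ f)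

    other₂ : ∀ i j {l l′ p} → p ≢ l → p ≢ l′ → has₂ i l j l′ s ≡ true → has₂ i l j l′ (matched v p s) ≡ true
    other₂ i j p≢l p≢l′ h = ∧-true (degree<-other i p≢l (proj₁ (∧-elim h))) (degree<-other j p≢l′ (proj₂ (∧-elim h)))

    exploit-hit-b : ∀ l → 1 · 𝟙 (has 1 l s) ≤ 1 · Exploited l (has 2 l)
    exploit-hit-b l = ·-monoʳ-≤ 1 (exploit-hit l (has 1 l) (has 2 l) λ h →
      ℕ.<-trans (true-<ᵇ h) (ℕ.n<1+n 1) , degree<-same 1 l h)

    exploit-hit-c : ∀ {l l′} → l ≢ l′ → 𝟙 (has₂ 1 l 1 l′ s) ≤ Exploited l′ (has₂ 1 l 2 l′)
    exploit-hit-c {l} {l′} l≢l′ = exploit-hit l′ (has₂ 1 l 1 l′) (has₂ 1 l 2 l′) λ h →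
      ℕ.<-trans (true-<ᵇ (proj₂ (∧-elim h))) (ℕ.n<1+n 1) ,
      ∧-true (degree<-other 1 (l≢l′ ∘ ≡.sym) (proj₁ (∧-elim h))) (degree<-same 1 l′ (proj₂ (∧-elim h)))

    exploit-hit-e : ∀ {l l′} → l ≢ l′ → 1 · 𝟙 (has₂ 1 l 2 l′ s) ≤ 1 · Exploited l (has₂ 2 l 2 l′)
    exploit-hit-e {l} {l′} l≢l′ = ·-monoʳ-≤ 1 (exploit-hit l (has₂ 1 l 2 l′) (has₂ 2 l 2 l′) λ h →
      ℕ.<-trans (true-<ᵇ (proj₁ (∧-elim h))) (ℕ.n<1+n 1) ,
      ∧-true (degree<-same 1 l (proj₁ (∧-elim h))) (degree<-other 2 l≢l′ (proj₂ (∧-elim h))))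

    exploit-hit-e′ : ∀ {l l′} → l ≢ l′ → 1 · 𝟙 (has₂ 1 l′ 2 l s) ≤ 1 · Exploited l′ (has₂ 2 l 2 l′)
    exploit-hit-e′ {l} {l′} l≢l′ = ·-monoʳ-≤ 1 (exploit-hit l′ (has₂ 1 l′ 2 l) (has₂ 2 l 2 l′) λ h →
      ℕ.<-trans (true-<ᵇ (proj₁ (∧-elim h))) (ℕ.n<1+n 1) ,
      ∧-true (degree<-other 2 (l≢l′ ∘ ≡.sym) (proj₂ (∧-elim h))) (degree<-same 1 l′ (proj₁ (∧-elim h))))

    module Round₁ (<m : ∣ S [ v ]≔ false ∣ ℕ.< m) where

      private
        Lₐ≡ = round₁-first <m
        z≤ = ∣Lₐ∣-round₁ Lₐ≡

      explore-b : ∀ l → 1 · 𝟙 (has 2 l s) ≤ 1 · Explored (has 2 l)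
      explore-b l = explore-avoiding [] (has 2 l) 1≤∣Lₐ∣ λ h x x∈ _ → degree<2-round₁ Lₐ≡ x∈ h

      explore-e : ∀ l l′ → 1 · 𝟙 (has₂ 2 l 2 l′ s) ≤ 1 · Explored (has₂ 2 l 2 l′)
      explore-e l l′ = explore-avoiding [] (has₂ 2 l 2 l′) 1≤∣Lₐ∣ λ h x x∈ _ →
        ∧-true (degree<2-round₁ Lₐ≡ x∈ (proj₁ (∧-elim h))) (degree<2-round₁ Lₐ≡ x∈ (proj₂ (∧-elim h)))

      explore-a : ∀ l → (z₁ ℕ.∸ 1) · 𝟙 (has 1 l s) ≤ z₁ · Explored (has 1 l)
      explore-a l = explore-avoiding (l ∷ []) (has 1 l) z≤ λ { h x x∈ (x≢l ∷ _) → degree<-other 1 x≢l h }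

      explore-c : ∀ l l′ → (z₁ ℕ.∸ 1) · 𝟙 (has₂ 1 l 2 l′ s) ≤ z₁ · Explored (has₂ 1 l 2 l′)
      explore-c l l′ = explore-avoiding (l ∷ []) (has₂ 1 l 2 l′) z≤ λ { h x x∈ (x≢l ∷ _) →
        ∧-true (degree<-other 1 x≢l (proj₁ (∧-elim h))) (degree<2-round₁ Lₐ≡ x∈ (proj₂ (∧-elim h))) }

      explore-d : ∀ l l′ → (z₁ ℕ.∸ 2) · 𝟙 (has₂ 1 l 1 l′ s) ≤ z₁ · Explored (has₂ 1 l 1 l′)
      explore-d l l′ = explore-avoiding (l ∷ l′ ∷ []) (has₂ 1 l 1 l′) z≤ λ { h x x∈ (x≢l ∷ x≢l′ ∷ _) →
        ∧-true (degree<-other 1 x≢l (proj₁ (∧-elim h))) (degree<-other 1 x≢l′ (proj₂ (∧-elim h))) }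

    -- The first round may still be running at this time. In that case no random choice saturates a
    -- vertex, which is more than the bound asks for.
    explore-b₂ : ∀ l → (z₂ ℕ.∸ 1) · 𝟙 (has 2 l s) ≤ z₂ · Explored (has 2 l)
    explore-b₂ l with phase
    ... | round₂ deg≥1 Lₐ≡ = explore-avoiding (l ∷ []) (has 2 l) (∣Lₐ∣-round₂ deg≥1 Lₐ≡)
            λ { h x x∈ (x≢l ∷ _) → degree<-other 2 x≢l h }
    ... | round₁ Lₐ≡ _ = ≤-trans (·-monoˡ-≤ (𝟙-nonneg (has 2 l s)) (ℕ.m∸n≤m z₂ 1)) (·-monoʳ-≤ z₂ (begin
            𝟙 (has 2 l s)           ≈⟨ ×-homo-1 _ ⟨
            1 · 𝟙 (has 2 l s)       ≤⟨ explore-avoiding [] (has 2 l) 1≤∣Lₐ∣ (λ h x x∈ _ → degree<2-round₁ Lₐ≡ x∈ h) ⟩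
            1 · Explored (has 2 l)  ≈⟨ ×-homo-1 _ ⟩
            Explored (has 2 l)      ∎))
      where open ≤-Reasoning

    explore-e₂ : ∀ l l′ → (z₂ ℕ.∸ 2) · 𝟙 (has₂ 2 l 2 l′ s) ≤ z₂ · Explored (has₂ 2 l 2 l′)
    explore-e₂ l l′ with phase
    ... | round₂ deg≥1 Lₐ≡ = explore-avoiding (l ∷ l′ ∷ []) (has₂ 2 l 2 l′) (∣Lₐ∣-round₂ deg≥1 Lₐ≡)
            λ { h x x∈ (x≢l ∷ x≢l′ ∷ _) →
              ∧-true (degree<-other 2 x≢l (proj₁ (∧-elim h))) (degree<-other 2 x≢l′ (proj₂ (∧-elim h))) }
    ... | round₁ Lₐ≡ _ = ≤-trans (·-monoˡ-≤ (𝟙-nonneg (has₂ 2 l 2 l′ s)) (ℕ.m∸n≤m z₂ 2)) (·-monoʳ-≤ z₂ (begin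
            𝟙 (has₂ 2 l 2 l′ s)           ≈⟨ ×-homo-1 _ ⟨
            1 · 𝟙 (has₂ 2 l 2 l′ s)       ≤⟨ explore-avoiding [] (has₂ 2 l 2 l′) 1≤∣Lₐ∣ (λ h x x∈ _ →
                ∧-true (degree<2-round₁ Lₐ≡ x∈ (proj₁ (∧-elim h))) (degree<2-round₁ Lₐ≡ x∈ (proj₂ (∧-elim h)))) ⟩
            1 · Explored (has₂ 2 l 2 l′)  ≈⟨ ×-homo-1 _ ⟩
            Explored (has₂ 2 l 2 l′)      ∎))
      where open ≤-Reasoning

  open Sequences K
  open Counting K

  record LowerBounds (t : ℕ) (v : Values) : Set (ℓ Level.⊔ ℓ₂) where
    open Values v
    field
      a≤ : ∀ S → ∣ S ∣ ≡ t → ∀ l → a ≤ condE t S (𝟙 ∘ has 1 l)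
      b≤ : ∀ S → ∣ S ∣ ≡ t → ∀ l → b ≤ condE t S (𝟙 ∘ has 2 l)
      c≤ : ∀ S → ∣ S ∣ ≡ t → ∀ {l l′} → l ≢ l′ → c ≤ condE t S (𝟙 ∘ has₂ 1 l 2 l′)
      d≤ : ∀ S → ∣ S ∣ ≡ t → ∀ {l l′} → l ≢ l′ → d ≤ condE t S (𝟙 ∘ has₂ 1 l 1 l′)
      e≤ : ∀ S → ∣ S ∣ ≡ t → ∀ {l l′} → l ≢ l′ → e ≤ condE t S (𝟙 ∘ has₂ 2 l 2 l′)

  initial-bounds : LowerBounds 0 (values 1# 1# 1# 1# 1#)
  initial-bounds = record
    { a≤ = λ _ _ l → 1≤𝟙 (has-initial 1 l (ℕ.s≤s ℕ.z≤n))
    ; b≤ = λ _ _ l → 1≤𝟙 (has-initial 2 l (ℕ.s≤s ℕ.z≤n))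
    ; c≤ = λ _ _ {l} {l′} _ → 1≤𝟙 (∧-true (has-initial 1 l (ℕ.s≤s ℕ.z≤n)) (has-initial 2 l′ (ℕ.s≤s ℕ.z≤n)))
    ; d≤ = λ _ _ {l} {l′} _ → 1≤𝟙 (∧-true (has-initial 1 l (ℕ.s≤s ℕ.z≤n)) (has-initial 1 l′ (ℕ.s≤s ℕ.z≤n)))
    ; e≤ = λ _ _ {l} {l′} _ → 1≤𝟙 (∧-true (has-initial 2 l (ℕ.s≤s ℕ.z≤n)) (has-initial 2 l′ (ℕ.s≤s ℕ.z≤n)))
    }
    where
    has-initial : ∀ i l → 0 ℕ.< i → has i l initial ≡ true
    has-initial i l 0<i = <ᵇ-true (≡.subst (ℕ._< i) (≡.sym (degree-empty n l)) 0<i)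

  x≤1·x÷1 : ∀ x → x ≤ (1 · x) ÷ 1
  x≤1·x÷1 x = ≤-÷ 1 ≤-refl

  module _ (t : ℕ) (v : Values) (lb : LowerBounds t v) where

    open Values v
    open LowerBounds lb

    module Explore (exploring : (ℕ.suc t <ᵇ n ℕ./ 4) ≡ true) (t<m : t ℕ.< m) where

      private instance _ = ∸-nonZero t<m

      explore-step : ∀ (S : Subset n) {f g : State′ → Bool} {x} k z .{{_ : ℕ.NonZero z}} → ∣ S ∣ ≡ ℕ.suc t →
        (∀ r → lookup S r ≡ true → x ≤ condE t (S [ r ]≔ false) (𝟙 ∘ g)) →
        (∀ r → lookup S r ≡ true → ∣ S [ r ]≔ false ∣ ≡ t → ∀ s → Invariant (S [ r ]≔ false) s →
          k · 𝟙 (g s) ≤ z · 𝔼 K (explore K opt r s) (𝟙 ∘ f)) →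
        (k · x) ÷ z ≤ condE (ℕ.suc t) S (𝟙 ∘ f)
      explore-step S {f} {g} k z ∣S∣≡ x≤ le = condE-suc-const t S (𝟙 ∘ f) z ∣S∣≡ λ r r∈S →
        let size = size-remove S r r∈S ∣S∣≡ in
        condE-lift t (S [ r ]≔ false) k z size (x≤ r r∈S) λ s inv →
          ≡.subst (λ b → k · 𝟙 (g s) ≤ z · 𝔼 K (if b then explore K opt r s else exploit K opt r (lookup (opt S) r) s) (𝟙 ∘ f))
            (≡.sym exploring) (le r r∈S size s inv)

      exploreNext-bounds : LowerBounds (ℕ.suc t) (exploreNext (m ℕ.∸ t) v)
      exploreNext-bounds = record
        { a≤ = λ S ∣S∣≡ l → explore-step S (m ℕ.∸ t ℕ.∸ 1) (m ℕ.∸ t) ∣S∣≡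
            (λ r r∈S → a≤ (S [ r ]≔ false) (size-remove S r r∈S ∣S∣≡) l)
            λ { r r∈S ≡.refl s inv → Survival.Round₁.explore-a r∈S inv t<m l }
        ; b≤ = λ S ∣S∣≡ l → ≤-trans (x≤1·x÷1 b) (explore-step S 1 1 ∣S∣≡
            (λ r r∈S → b≤ (S [ r ]≔ false) (size-remove S r r∈S ∣S∣≡) l)
            λ { r r∈S ≡.refl s inv → Survival.Round₁.explore-b r∈S inv t<m l })
        ; c≤ = λ S ∣S∣≡ {l} {l′} l≢l′ → explore-step S (m ℕ.∸ t ℕ.∸ 1) (m ℕ.∸ t) ∣S∣≡
            (λ r r∈S → c≤ (S [ r ]≔ false) (size-remove S r r∈S ∣S∣≡) l≢l′)
            λ { r r∈S ≡.refl s inv → Survival.Round₁.explore-c r∈S inv t<m l l′ }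
        ; d≤ = λ S ∣S∣≡ {l} {l′} l≢l′ → explore-step S (m ℕ.∸ t ℕ.∸ 2) (m ℕ.∸ t) ∣S∣≡
            (λ r r∈S → d≤ (S [ r ]≔ false) (size-remove S r r∈S ∣S∣≡) l≢l′)
            λ { r r∈S ≡.refl s inv → Survival.Round₁.explore-d r∈S inv t<m l l′ }
        ; e≤ = λ S ∣S∣≡ {l} {l′} l≢l′ → ≤-trans (x≤1·x÷1 e) (explore-step S 1 1 ∣S∣≡
            (λ r r∈S → e≤ (S [ r ]≔ false) (size-remove S r r∈S ∣S∣≡) l≢l′)
            λ { r r∈S ≡.refl s inv → Survival.Round₁.explore-e r∈S inv t<m l l′ })
        }

    module Exploit (exploiting : (ℕ.suc t <ᵇ n ℕ./ 4) ≡ false) (ordered : Ordered v)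
                   (optimal : ∀ S → IsMatchingOf S (opt S)) where

      open Ordered ordered

      proposal : ∀ S r → lookup S r ≡ true → ∃ λ p → lookup (opt S) r ≡ just p
      proposal S r r∈S with lookup (opt S) r | IsMatchingOf.matchesAll (optimal S) (Vec.lookup⇒[]= r S r∈S)
      ... | just p | _ = p , ≡.refl

      -- Whichever `r` in `S` comes last, its proposal is read off the same matching `opt S`. Hence
      -- the capacity 2 limits how many `r` propose `l` or `l′`, and the average over `r` splits as
      -- in `mix`.
      exploit-step : ∀ (S : Subset n) (f : State′ → Bool) l l′ {x₁ x₂ x₃} z .{{_ : ℕ.NonZero z}} →
        ∣ S ∣ ≡ ℕ.suc t → x₁ ≤ x₂ → x₂ ≤ x₃ →
        (let Bound = λ x r p → x ≤ z · condE t (S [ r ]≔ false) (λ s → 𝔼 K (exploit K opt r (just p) s) (𝟙 ∘ f))) →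
        (∀ r → lookup S r ≡ true → ∣ S [ r ]≔ false ∣ ≡ t → Bound x₁ r l) →
        (∀ r → lookup S r ≡ true → ∣ S [ r ]≔ false ∣ ≡ t → l′ ≢ l → Bound x₂ r l′) →
        (∀ r p → lookup S r ≡ true → ∣ S [ r ]≔ false ∣ ≡ t → p ≢ l → p ≢ l′ → Bound x₃ r p) →
        mix t z x₁ x₂ x₃ ≤ condE (ℕ.suc t) S (𝟙 ∘ f)
      exploit-step S f l l′ {x₁} {x₂} {x₃} z ∣S∣≡ x₁≤x₂ x₂≤x₃ h₁ h₂ h₃ = ÷-≤ (ℕ.suc t ℕ.* z) (≤-trans
          (≤-trans (≤-reflexive (reflexive (≡.cong (λ u → α u · x₁ + β u · x₂ + γ u · x₃) (≡.sym ∣S∣≡))))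
            (mix-sum S (opt S) l l′ (IsMatchingOf.isMatching (optimal S)) x₁≤x₂ x₂≤x₃
              (split-sum S (opt S) l l′
                (λ r r∈S eq → at r∈S eq (h₁ r r∈S (size r r∈S)))
                (λ r r∈S ≢l eq → at r∈S eq (h₂ r r∈S (size r r∈S) λ l′≡l → ≢l (≡.trans eq (≡.cong just l′≡l))))
                λ r r∈S ≢l ≢l′ → let (p , eq) = proposal S r r∈S in
                  at r∈S eq (h₃ r p r∈S (size r r∈S) (λ p≡l → ≢l (≡.trans eq (≡.cong just p≡l)))
                                                 (λ p≡l′ → ≢l′ (≡.trans eq (≡.cong just p≡l′)))))))
          (condE-suc t S (𝟙 ∘ f) z λ r _ → ≤-refl))
        where
        instance _ = ℕ.m*n≢0 (ℕ.suc t) z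
        size = λ r r∈S → size-remove S r r∈S ∣S∣≡
        at : ∀ {r p x} → lookup S r ≡ true → lookup (opt S) r ≡ just p →
          x ≤ z · condE t (S [ r ]≔ false) (λ s → 𝔼 K (exploit K opt r (just p) s) (𝟙 ∘ f)) →
          x ≤ z · condE t (S [ r ]≔ false) (λ s → 𝔼 K (stepInto t S r s) (𝟙 ∘ f))
        at {r} {p} r∈S eq le = ≤-trans le (≤-reflexive (×-congʳ z (condE-cong t (S [ r ]≔ false) λ s →
          reflexive (≡.sym (≡.cong₂ (λ b e → 𝔼 K (if b then explore K opt r s else exploit K opt r e s) (𝟙 ∘ f)) exploiting eq)))))

      exploit-nonneg-bound : ∀ (S : Subset n) (f : State′ → Bool) z r p → lookup S r ≡ true → ∣ S [ r ]≔ false ∣ ≡ t →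
        0# ≤ z · condE t (S [ r ]≔ false) (λ s → 𝔼 K (exploit K opt r (just p) s) (𝟙 ∘ f))
      exploit-nonneg-bound S f z r p r∈S size = ·-nonneg z (≤-trans
        (condE-nonneg t (S [ r ]≔ false) {λ _ → 0#} size (λ _ → ≤-refl))
        (condE-mono t (S [ r ]≔ false) size λ s inv → AtState.exploit-nonneg r∈S (Subset.∣p∣≤n S) n≡2m inv p f))

      module _ (t<m : t ℕ.< m) where

        private
          instance _ = ∸-nonZero t<m
          z = m ℕ.∸ t

        round₁Next-bounds : LowerBounds (ℕ.suc t) (round₁Next t z v)
        round₁Next-bounds = record
          { a≤ = λ S ∣S∣≡ l → exploit-step S (has 1 l) l l z ∣S∣≡ (+-nonneg (·-nonneg (z ℕ.∸ 1) 0≤a) 0≤c) ≤-refl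
              (λ r r∈S size → exploit-nonneg-bound S (has 1 l) z r l r∈S size)
              (λ r r∈S size l≢l → contradiction ≡.refl l≢l)
              -- `c` is used for the pair of `l` and the proposed vertex `p`; its event is that `l`
              -- has degree 0 and that no random choice is made.
              λ { r p r∈S ≡.refl p≢l _ → condE-lift₂ t (S [ r ]≔ false) (z ℕ.∸ 1) z ≡.refl
                    (a≤ (S [ r ]≔ false) ≡.refl l) (c≤ (S [ r ]≔ false) ≡.refl (p≢l ∘ ≡.sym)) λ s inv →
                    AtState.exploit-miss-unsaturated r∈S (Subset.∣p∣≤n S) n≡2m inv p (has 1 l) (ℕ.>-nonZero⁻¹ z)
                      (Survival.Round₁.explore-a r∈S inv t<m l)
                      (AtState.degree<-other r∈S (Subset.∣p∣≤n S) n≡2m inv 1 p≢l) }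
          ; b≤ = λ S ∣S∣≡ l → exploit-step S (has 2 l) l l 1 ∣S∣≡ a≤b ≤-refl
              (λ r r∈S size → ≤-trans (≤-reflexive (sym (×-homo-1 a)))
                (condE-lift t (S [ r ]≔ false) 1 1 size (a≤ (S [ r ]≔ false) size l) λ s inv →
                  Survival.exploit-hit-b r∈S inv l))
              (λ r r∈S size l≢l → contradiction ≡.refl l≢l)
              λ { r p r∈S ≡.refl p≢l _ → ≤-trans (≤-reflexive (sym (×-homo-1 b)))
                    (condE-lift t (S [ r ]≔ false) 1 1 ≡.refl (b≤ (S [ r ]≔ false) ≡.refl l) λ s inv →
                      AtState.exploit-miss r∈S (Subset.∣p∣≤n S) n≡2m inv p (has 2 l) {1} {1} ℕ.≤-refl
                        (Survival.Round₁.explore-b r∈S inv t<m l)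
                        (AtState.degree<-other r∈S (Subset.∣p∣≤n S) n≡2m inv 2 p≢l)) }
          ; c≤ = λ S ∣S∣≡ {l} {l′} l≢l′ → exploit-step S (has₂ 1 l 2 l′) l l′ z ∣S∣≡
              (·-nonneg (z ℕ.∸ 1) 0≤d) (·-monoʳ-≤ (z ℕ.∸ 1) d≤c)
              (λ r r∈S size → exploit-nonneg-bound S (has₂ 1 l 2 l′) z r l r∈S size)
              (λ r r∈S size _ → condE-lift t (S [ r ]≔ false) (z ℕ.∸ 1) z size (d≤ (S [ r ]≔ false) size l≢l′) λ s inv →
                ·-mono-≤ (𝟙-nonneg _) (ℕ.m∸n≤m z 1) (Survival.exploit-hit-c r∈S inv l≢l′))
              λ { r p r∈S ≡.refl p≢l p≢l′ → condE-lift t (S [ r ]≔ false) (z ℕ.∸ 1) z ≡.refl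
                    (c≤ (S [ r ]≔ false) ≡.refl l≢l′) λ s inv →
                    AtState.exploit-miss r∈S (Subset.∣p∣≤n S) n≡2m inv p (has₂ 1 l 2 l′) (ℕ.m∸n≤m z 1)
                      (Survival.Round₁.explore-c r∈S inv t<m l l′) (Survival.other₂ r∈S inv 1 2 p≢l p≢l′) }
          ; d≤ = λ S ∣S∣≡ {l} {l′} l≢l′ → exploit-step S (has₂ 1 l 1 l′) l l′ z ∣S∣≡
              ≤-refl (·-nonneg (z ℕ.∸ 2) 0≤d)
              (λ r r∈S size → exploit-nonneg-bound S (has₂ 1 l 1 l′) z r l r∈S size)
              (λ r r∈S size _ → exploit-nonneg-bound S (has₂ 1 l 1 l′) z r l′ r∈S size)
              λ { r p r∈S ≡.refl p≢l p≢l′ → condE-lift t (S [ r ]≔ false) (z ℕ.∸ 2) z ≡.refl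
                    (d≤ (S [ r ]≔ false) ≡.refl l≢l′) λ s inv →
                    AtState.exploit-miss r∈S (Subset.∣p∣≤n S) n≡2m inv p (has₂ 1 l 1 l′) (ℕ.m∸n≤m z 2)
                      (Survival.Round₁.explore-d r∈S inv t<m l l′) (Survival.other₂ r∈S inv 1 1 p≢l p≢l′) }
          ; e≤ = λ S ∣S∣≡ {l} {l′} l≢l′ → exploit-step S (has₂ 2 l 2 l′) l l′ 1 ∣S∣≡ ≤-refl c≤e
              (λ r r∈S size → ≤-trans (≤-reflexive (sym (×-homo-1 c)))
                (condE-lift t (S [ r ]≔ false) 1 1 size (c≤ (S [ r ]≔ false) size l≢l′) λ s inv →
                  Survival.exploit-hit-e r∈S inv l≢l′))
              (λ r r∈S size _ → ≤-trans (≤-reflexive (sym (×-homo-1 c)))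
                (condE-lift t (S [ r ]≔ false) 1 1 size (c≤ (S [ r ]≔ false) size (l≢l′ ∘ ≡.sym)) λ s inv →
                  Survival.exploit-hit-e′ r∈S inv l≢l′))
              λ { r p r∈S ≡.refl p≢l p≢l′ → ≤-trans (≤-reflexive (sym (×-homo-1 e)))
                    (condE-lift t (S [ r ]≔ false) 1 1 ≡.refl (e≤ (S [ r ]≔ false) ≡.refl l≢l′) λ s inv →
                      AtState.exploit-miss r∈S (Subset.∣p∣≤n S) n≡2m inv p (has₂ 2 l 2 l′) {1} {1} ℕ.≤-refl
                        (Survival.Round₁.explore-e r∈S inv t<m l l′) (Survival.other₂ r∈S inv 2 2 p≢l p≢l′)) }
          }

      module _ (t<2m : t ℕ.< 2 ℕ.* m) where

        private
          instance _ = ∸-nonZero t<2m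
          z = 2 ℕ.* m ℕ.∸ t

        round₂Next-bounds : LowerBounds (ℕ.suc t) (round₂Next t z v)
        round₂Next-bounds = record
          { a≤ = λ S ∣S∣≡ l → condE-nonneg (ℕ.suc t) S ∣S∣≡ λ s → 𝟙-nonneg _
          ; b≤ = λ S ∣S∣≡ l → exploit-step S (has 2 l) l l z ∣S∣≡ (+-nonneg (·-nonneg (z ℕ.∸ 1) 0≤b) 0≤e) ≤-refl
              (λ r r∈S size → exploit-nonneg-bound S (has 2 l) z r l r∈S size)
              (λ r r∈S size l≢l → contradiction ≡.refl l≢l)
              λ { r p r∈S ≡.refl p≢l _ → condE-lift₂ t (S [ r ]≔ false) (z ℕ.∸ 1) z ≡.refl
                    (b≤ (S [ r ]≔ false) ≡.refl l) (e≤ (S [ r ]≔ false) ≡.refl (p≢l ∘ ≡.sym)) λ s inv →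
                    AtState.exploit-miss-unsaturated r∈S (Subset.∣p∣≤n S) n≡2m inv p (has 2 l) (ℕ.>-nonZero⁻¹ z)
                      (Survival.explore-b₂ r∈S inv l)
                      (AtState.degree<-other r∈S (Subset.∣p∣≤n S) n≡2m inv 2 p≢l) }
          ; c≤ = λ S ∣S∣≡ l≢l′ → condE-nonneg (ℕ.suc t) S ∣S∣≡ λ s → 𝟙-nonneg _
          ; d≤ = λ S ∣S∣≡ l≢l′ → condE-nonneg (ℕ.suc t) S ∣S∣≡ λ s → 𝟙-nonneg _
          ; e≤ = λ S ∣S∣≡ {l} {l′} l≢l′ → exploit-step S (has₂ 2 l 2 l′) l l′ z ∣S∣≡
              ≤-refl (·-nonneg (z ℕ.∸ 2) 0≤e)
              (λ r r∈S size → exploit-nonneg-bound S (has₂ 2 l 2 l′) z r l r∈S size)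
              (λ r r∈S size _ → exploit-nonneg-bound S (has₂ 2 l 2 l′) z r l′ r∈S size)
              λ { r p r∈S ≡.refl p≢l p≢l′ → condE-lift t (S [ r ]≔ false) (z ℕ.∸ 2) z ≡.refl
                    (e≤ (S [ r ]≔ false) ≡.refl l≢l′) λ s inv →
                    AtState.exploit-miss r∈S (Subset.∣p∣≤n S) n≡2m inv p (has₂ 2 l 2 l′) (ℕ.m∸n≤m z 2)
                      (Survival.explore-e₂ r∈S inv l l′) (Survival.other₂ r∈S inv 2 2 p≢l p≢l′) }
          }

  n/4≤m : n ℕ./ 4 ℕ.≤ m
  n/4≤m = ℕ.≤-trans (ℕ./-monoʳ-≤ n {4} {2} (ℕ.s≤s (ℕ.s≤s ℕ.z≤n)))
    (ℕ.≤-reflexive (≡.trans (≡.cong (ℕ._/ 2) (≡.trans n≡2m (ℕ.*-comm 2 m))) (ℕ.m*n/n≡m m 2)))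

  lowerBounds : (∀ S → IsMatchingOf S (opt S)) → ∀ t → t ℕ.≤ 2 ℕ.* m → LowerBounds t (valuesAt m (n ℕ./ 4) t)
  lowerBounds optimal ℕ.zero    t≤2m = initial-bounds
  lowerBounds optimal (ℕ.suc t) t<2m with ℕ.suc t <ᵇ n ℕ./ 4 in eq₁ | t <ᵇ m in eq₂
  ... | true  | _     = Explore.exploreNext-bounds t _ (lowerBounds optimal t (ℕ.<⇒≤ t<2m)) eq₁
                          (ℕ.<-trans (ℕ.n<1+n t) (ℕ.<-≤-trans (true-<ᵇ eq₁) n/4≤m))
  ... | false | true  = Exploit.round₁Next-bounds t _ (lowerBounds optimal t (ℕ.<⇒≤ t<2m)) eq₁
                          (valuesAt-ordered m (n ℕ./ 4) t n/4≤m (ℕ.<⇒≤ t<2m)) optimal (true-<ᵇ {t} {m} eq₂)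
  ... | false | false = Exploit.round₂Next-bounds t _ (lowerBounds optimal t (ℕ.<⇒≤ t<2m)) eq₁
                          (valuesAt-ordered m (n ℕ./ 4) t n/4≤m (ℕ.<⇒≤ t<2m)) optimal t<2m

-- Expected weight in terms of the lower bounds

lookup⇒∈ : ∀ {n} {p : Subset n} {x} → lookup p x ≡ true → x ∈ p
lookup⇒∈ {p = p} {x} = Vec.lookup⇒[]= x p

lookup⇒∉ : ∀ {n} {p : Subset n} {x} → lookup p x ≡ false → ¬ (x ∈ p)
lookup⇒∉ eq x∈p = contradiction (≡.trans (≡.sym (∈⇒lookup x∈p)) eq) λ ()

degree-unmatch : ∀ {m n} (M : Edges m n) r l → degree (M [ r ]≔ nothing) l ℕ.≤ degree M l
degree-unmatch (e ∷ M) zero    l = degree-∷ e M l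
degree-unmatch (e ∷ M) (suc r) l with does (≡-dec Fin._≟_ e (just l))
... | true  = ℕ.s≤s (degree-unmatch M r l)
... | false = degree-unmatch M r l

unmatch : ∀ {m n} {S : Subset n} {M : Edges m n} r → lookup S r ≡ true → IsMatchingOf S M →
  IsMatchingOf (S [ r ]≔ false) (M [ r ]≔ nothing)
unmatch {S = S} {M} r r∈S isM = record
  { isMatching = λ l → ℕ.≤-trans (degree-unmatch M r l) (isMatching l)
  ; matchesAll = λ {r′} r′∈ → let r′≢r = ∈-remove⇒≢ S r (∈⇒lookup r′∈) ∘ ≡.sym in
      ≡.subst Is-just (≡.sym (Vec.lookup∘update′ r′≢r M nothing))
        (matchesAll (lookup⇒∈ (≡.trans (≡.sym (Vec.lookup∘update′ r′≢r S false)) (∈⇒lookup r′∈))))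
  ; onlyWithin = outside
  }
  where
  open IsMatchingOf isM
  outside : ∀ {r′} → ¬ (r′ ∈ S [ r ]≔ false) → lookup (M [ r ]≔ nothing) r′ ≡ nothing
  outside {r′} r′∉ with r′ Fin.≟ r
  ... | yes ≡.refl = Vec.lookup∘update r M nothing
  ... | no  r′≢r   = ≡.trans (Vec.lookup∘update′ r′≢r M nothing)
        (onlyWithin λ r′∈S → r′∉ (lookup⇒∈ (≡.trans (Vec.lookup∘update′ r′≢r S false) (∈⇒lookup r′∈S))))

module WeightBound {ℓ ℓ₁ ℓ₂} (K : OrderedField ℓ ℓ₁ ℓ₂) {m n}
                   (n≡2m : n ≡ 2 ℕ.* m) .{{_ : ℕ.NonZero m}}
                   (w : Weights K m n) (0≤w : ∀ l r → OrderedField._≤_ K (OrderedField.0# K) (w l r)) (opt : Subset n → Edges m n)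
                   (optimal : ∀ S → IsMaxWeightMatchingOf K w S (opt S)) where

  open OrderedField K hiding (zero)
  open OrderedFieldProperties K
  open SumOver K
  open Distributions K
  open Process opt
  open Steps K opt
  open CondE K opt n≡2m
  open Sequences K
  open import Algebra.Properties.CommutativeSemigroup +-commutativeSemigroup using (xy∙z≈xz∙y)

  private
    k = n ℕ./ 4
    isMatchingOf = λ S → IsMaxWeightMatchingOf.isMatchingOf (optimal S)

  value : Edges m n → Fin n → Carrier
  value M r = maybe′ (λ l → w l r) 0# (lookup M r)

  value-nonneg : ∀ M r → 0# ≤ value M r
  value-nonneg M r with lookup M r
  ... | just l  = 0≤w l r
  ... | nothing = ≤-refl

  sum-nonneg : ∀ {j} {g : Fin j → Carrier} → (∀ i → 0# ≤ g i) → 0# ≤ sum g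
  sum-nonneg {ℕ.zero}  0≤g = ≤-refl
  sum-nonneg {ℕ.suc j} 0≤g = +-nonneg (0≤g zero) (sum-nonneg (0≤g ∘ suc))

  weight-nonneg : ∀ M → 0# ≤ weight K w M
  weight-nonneg M = sum-nonneg (value-nonneg M)

  -- With the old and the new entry on opposite sides, no subtraction occurs and the same identity
  -- covers adding an edge and deleting one.
  sum-update : ∀ {a} {A : Set a} {j} (h : Fin j → A → Carrier) (xs : Vec A j) i x →
    sum (λ r → h r (lookup (xs [ i ]≔ x) r)) + h i (lookup xs i) ≈ sum (λ r → h r (lookup xs r)) + h i x
  sum-update h (y ∷ xs) zero    x = trans (+-congʳ (+-comm _ _)) (trans (xy∙z≈xz∙y _ _ _) (+-congʳ (+-comm _ _)))
  sum-update h (y ∷ xs) (suc i) x = trans (+-assoc _ _ _)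
    (trans (+-congˡ (sum-update (h ∘ suc) xs i x)) (sym (+-assoc _ _ _)))

  weight-match : ∀ M v l → lookup M v ≡ nothing → weight K w (M [ v ]≔ just l) ≈ weight K w M + w l v
  weight-match M v l Mv = trans (sym (+-identityʳ _)) (trans
    (+-congˡ (reflexive (≡.sym (≡.cong (maybe′ (λ l → w l v) 0#) Mv))))
    (sum-update (λ r → maybe′ (λ l → w l r) 0#) M v (just l)))

  weight-unmatch : ∀ M r → weight K w (M [ r ]≔ nothing) + value M r ≈ weight K w M
  weight-unmatch M r = trans (sum-update (λ r → maybe′ (λ l → w l r) 0#) M r nothing) (+-identityʳ _)

  sumOver≈sum : ∀ {j} (S : Subset j) {g} → (∀ r → lookup S r ≡ false → g r ≈ 0#) → sumOver S g ≈ sum g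
  sumOver≈sum []          g≈0 = refl
  sumOver≈sum (true  ∷ S) g≈0 = +-congˡ (sumOver≈sum S (g≈0 ∘ suc))
  sumOver≈sum (false ∷ S) g≈0 = trans (sumOver≈sum S (g≈0 ∘ suc))
    (trans (sym (+-identityˡ _)) (+-congʳ (sym (g≈0 zero ≡.refl))))

  sumOver-value : ∀ S → sumOver S (value (opt S)) ≈ weight K w (opt S)
  sumOver-value S = sumOver≈sum S λ r r∉S →
    reflexive (≡.cong (maybe′ (λ l → w l r) 0#) (IsMatchingOf.onlyWithin (isMatchingOf S) (lookup⇒∉ r∉S)))

  -- Each vertex of S is removed once, so each edge survives in all but one of the restrictions.
  sumOver-restrictions : ∀ {t} S → ∣ S ∣ ≡ ℕ.suc t →
    t · weight K w (opt S) ≤ sumOver S (λ r → weight K w (opt (S [ r ]≔ false)))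
  sumOver-restrictions {t} S ∣S∣≡ = ≤-trans
    (+-cancelʳ-≤ (weight K w (opt S)) (≤-reflexive (begin-equality
      t · weight K w (opt S) + weight K w (opt S) ≈⟨ +-comm _ _ ⟩
      ℕ.suc t · weight K w (opt S)                ≈⟨ ·-congˡ ∣S∣≡ ⟨
      ∣ S ∣ · weight K w (opt S)                  ≈⟨ sumOver-const S _ ⟨
      sumOver S (λ r → weight K w (opt S))        ≈⟨ sumOver-cong S (λ r _ → weight-unmatch (opt S) r) ⟨
      sumOver S (λ r → weight K w (opt S [ r ]≔ nothing) + value (opt S) r) ≈⟨ sumOver-+ S _ _ ⟩
      sumOver S (λ r → weight K w (opt S [ r ]≔ nothing)) + sumOver S (value (opt S)) ≈⟨ +-congˡ (sumOver-value S) ⟩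
      sumOver S (λ r → weight K w (opt S [ r ]≔ nothing)) + weight K w (opt S) ∎)))
    (sumOver-mono S λ r r∈S → IsMaxWeightMatchingOf.isMaximum (optimal (S [ r ]≔ false)) _ (unmatch r r∈S (isMatchingOf S)))
    where open ≤-Reasoning

  weightOf : State′ → Carrier
  weightOf s = weight K w (proj₁ s)

  module _ {S v} (v∈S : lookup S v ≡ true) {M : Edges m n} {Lₐ : Subset m}
           (inv : Invariant (S [ v ]≔ false) (M , Lₐ)) where

    open AtState v∈S (Subset.∣p∣≤n S) n≡2m inv

    explore-weight : weightOf s ≤ 𝔼 K (explore K opt v s) weightOf
    explore-weight = ≤-trans (≤-÷ ∣ Lₐ ∣ (≤-trans (≤-reflexive (sym (sumOver-const Lₐ _)))
        (sumOver-mono Lₐ λ l _ → ≤-trans (x≤x+y (0≤w l v)) (≤-reflexive (sym (weight-match M v l Mv≡nothing))))))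
      (≤-reflexive (sym (𝔼-explore v M Lₐ weightOf)))
      where instance _ = ℕ.>-nonZero 1≤∣Lₐ∣

    exploit-weight : ∀ p → weightOf s + w p v * 𝟙 (has 2 p s) ≤ 𝔼 K (exploit K opt v (just p) s) weightOf
    exploit-weight p with degree M p ℕ.<? 2
    ... | yes d<2 rewrite <ᵇ-true d<2 = ≤-reflexive (trans (+-congˡ (*-identityʳ _))
          (trans (sym (weight-match M v p Mv≡nothing)) (sym (exploit-unsaturated p weightOf d<2))))
    ... | no  d≮2 rewrite <ᵇ-false (ℕ.≮⇒≥ d≮2) | exploit-saturated p (ℕ.≮⇒≥ d≮2) =
      ≤-trans (≤-reflexive (trans (+-congˡ (zeroʳ _)) (+-identityʳ _))) explore-weight

  gain-nonneg : ∀ t → t ℕ.≤ 2 ℕ.* m → 0# ≤ gain m k t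
  gain-nonneg t t≤ with ℕ.suc t <ᵇ k
  ... | true  = ≤-refl
  ... | false = Ordered.0≤b (valuesAt-ordered m k t n/4≤m t≤)

  totalGain-nonneg : ∀ t → t ℕ.≤ 2 ℕ.* m → 0# ≤ totalGain m k t
  totalGain-nonneg ℕ.zero    t≤ = ≤-refl
  totalGain-nonneg (ℕ.suc t) t< = +-nonneg (totalGain-nonneg t (ℕ.<⇒≤ t<)) (gain-nonneg t (ℕ.<⇒≤ t<))

  -- The proposed edge depends on `S` and `r` but not on the state, so its weight leaves the
  -- conditional expectation; what remains is the probability that its end is unsaturated, bounded
  -- by `b`.
  step-weight : ∀ t S r → lookup S r ≡ true → ∣ S ∣ ≡ ℕ.suc t → t ℕ.≤ 2 ℕ.* m →
    condE t (S [ r ]≔ false) weightOf + gain m k t * value (opt S) r ≤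
    condE t (S [ r ]≔ false) (λ s → 𝔼 K (stepInto t S r s) weightOf)
  step-weight t S r r∈S ∣S∣≡ t≤ with size-remove S r r∈S ∣S∣≡ | lowerBounds isMatchingOf t t≤
  ... | size | lb with ℕ.suc t <ᵇ k
  ...   | true  = ≤-trans (≤-reflexive (trans (+-congˡ (zeroˡ _)) (+-identityʳ _)))
            (condE-mono t (S [ r ]≔ false) size λ s inv → explore-weight r∈S inv)
  ...   | false with lookup (opt S) r | IsMatchingOf.matchesAll (isMatchingOf S) (lookup⇒∈ r∈S)
  ...     | just p | _ = begin
    condE t S′ weightOf + Values.b (valuesAt m k t) * w p r  ≈⟨ +-congˡ (*-comm _ _) ⟩
    condE t S′ weightOf + w p r * Values.b (valuesAt m k t)  ≤⟨ +-monoʳ-≤ _ (*-monoˡ-≤ (0≤w p r) (LowerBounds.b≤ lb S′ size p)) ⟩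
    condE t S′ weightOf + w p r * condE t S′ (𝟙 ∘ has 2 p)   ≈⟨ +-congˡ (condE-* t S′ (w p r) _) ⟨
    condE t S′ weightOf + condE t S′ (λ s → w p r * 𝟙 (has 2 p s)) ≈⟨ condE-+ t S′ _ _ ⟨
    condE t S′ (λ s → weightOf s + w p r * 𝟙 (has 2 p s))    ≤⟨ condE-mono t S′ size (λ s inv → exploit-weight r∈S inv p) ⟩
    condE t S′ (λ s → 𝔼 K (exploit K opt r (just p) s) weightOf) ∎
    where
    open ≤-Reasoning
    S′ = S [ r ]≔ false

  -- The factor `t` makes the gains add up. Over the choices of the last arrival, the optimum of the
  -- remaining set averages at least `t / (t + 1)` of the weight of `opt S`, and the proposed edge
  -- averages `1 / (t + 1)` of it.
  condE-weight : ∀ t S → ∣ S ∣ ≡ t → t ℕ.≤ 2 ℕ.* m → totalGain m k t * weight K w (opt S) ≤ t · condE t S weightOf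
  condE-weight ℕ.zero    S ∣S∣≡ t≤ = ≤-reflexive (zeroˡ _)
  condE-weight (ℕ.suc t) S ∣S∣≡ t< = begin
    (totalGain m k t + gain m k t) * W
      ≈⟨ distribʳ _ _ _ ⟩
    totalGain m k t * W + gain m k t * W
      ≤⟨ +-mono-≤ (previous t ≡.refl) (≤-reflexive (*-congˡ (sym (sumOver-value S)))) ⟩
    sumOver S (λ r → condE t (S [ r ]≔ false) weightOf) + gain m k t * sumOver S (value (opt S))
      ≈⟨ +-congˡ (sumOver-* S (gain m k t) _) ⟨
    sumOver S (λ r → condE t (S [ r ]≔ false) weightOf) + sumOver S (λ r → gain m k t * value (opt S) r)
      ≈⟨ sumOver-+ S _ _ ⟨
    sumOver S (λ r → condE t (S [ r ]≔ false) weightOf + gain m k t * value (opt S) r)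
      ≤⟨ sumOver-mono S (λ r r∈S → step-weight t S r r∈S ∣S∣≡ (ℕ.<⇒≤ t<)) ⟩
    sumOver S (λ r → condE t (S [ r ]≔ false) (λ s → 𝔼 K (stepInto t S r s) weightOf))
      ≈⟨ ·-÷ (ℕ.suc t) _ ⟨
    ℕ.suc t · condE (ℕ.suc t) S weightOf ∎
    where
    open ≤-Reasoning
    W = weight K w (opt S)
    previous : ∀ u → u ≡ t → totalGain m k t * W ≤ sumOver S (λ r → condE t (S [ r ]≔ false) weightOf)
    -- Time 0 is separate because the other case cancels the factor `u`; here the total gain is 0.
    previous ℕ.zero      ≡.refl = ≤-trans (≤-reflexive (zeroˡ _)) (sumOver-nonneg S λ r → weight-nonneg (replicate n nothing))
    previous u@(ℕ.suc _) ≡.refl = ·-cancel-≤ u (begin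
      u · (totalGain m k u * W)
        ≈⟨ ×-comm-* u (totalGain m k u) W ⟨
      totalGain m k u * (u · W)
        ≤⟨ *-monoˡ-≤ (totalGain-nonneg u (ℕ.<⇒≤ t<)) (sumOver-restrictions S ∣S∣≡) ⟩
      totalGain m k u * sumOver S (λ r → weight K w (opt (S [ r ]≔ false)))
        ≈⟨ sumOver-* S (totalGain m k u) _ ⟨
      sumOver S (λ r → totalGain m k u * weight K w (opt (S [ r ]≔ false)))
        ≤⟨ sumOver-mono S (λ r r∈S → condE-weight u (S [ r ]≔ false) (size-remove S r r∈S ∣S∣≡) (ℕ.<⇒≤ t<)) ⟩
      sumOver S (λ r → u · condE u (S [ r ]≔ false) weightOf)
        ≈⟨ sumOver-· S u _ ⟩
      u · sumOver S (λ r → condE u (S [ r ]≔ false) weightOf) ∎)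

  ALG2-weight : ∀ OPT → IsMaxWeightMatchingOf K w ⊤ OPT →
    totalGain m k n * weight K w OPT ≤ n · 𝔼 K (ALG2 K opt) (weight K w)
  ALG2-weight OPT OPT-max = begin
    totalGain m k n * weight K w OPT
      ≤⟨ *-monoˡ-≤ (totalGain-nonneg n (ℕ.≤-reflexive n≡2m))
           (IsMaxWeightMatchingOf.isMaximum (optimal ⊤) OPT (IsMaxWeightMatchingOf.isMatchingOf OPT-max)) ⟩
    totalGain m k n * weight K w (opt ⊤)
      ≤⟨ condE-weight n ⊤ (Subset.∣⊤∣≡n n) (ℕ.≤-reflexive n≡2m) ⟩
    n · condE n ⊤ weightOf
      ≈⟨ ×-congʳ n (𝔼-ALG2 (weight K w)) ⟨
    n · 𝔼 K (ALG2 K opt) (weight K w) ∎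
    where open ≤-Reasoning

-- Numerical evaluation

infixl 7 _÷ℕ_
_÷ℕ_ : ℕ → ℕ → ℕ
x ÷ℕ ℕ.zero = 0
x ÷ℕ ℕ.suc y  = x ℕ./ ℕ.suc y

÷ℕ-≤ : ∀ x z → z ℕ.* (x ÷ℕ z) ℕ.≤ x
÷ℕ-≤ x ℕ.zero  = ℕ.z≤n
÷ℕ-≤ x (ℕ.suc z) = ℕ.≤-trans (ℕ.≤-reflexive (ℕ.*-comm (ℕ.suc z) (x ℕ./ ℕ.suc z))) (ℕ.m/n*n≤m x (ℕ.suc z))

-- Each division rounds down by less than one unit. With a million units, the loss over fewer than
-- 1800 steps is small enough for the checks to succeed.
scale : ℕ
scale = 1000000

-- Values multiplied by scale and rounded down, with g for the total gain so far.
record Estimates : Set where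
  constructor estimates
  field
    a b c d e g : ℕ

-- Evaluating every component before the next step keeps the checks from piling up unevaluated
-- expressions.
strictly : ∀ {ℓ} {A : Set ℓ} → Estimates → (Estimates → A) → A
strictly (estimates a b c d e g) f =
  force a λ a → force b λ b → force c λ c → force d λ d → force e λ e → force g λ g → f (estimates a b c d e g)

strictly-≡ : ∀ {ℓ} {A : Set ℓ} s (f : Estimates → A) → strictly s f ≡ f s
strictly-≡ (estimates a b c d e g) f =
  ≡.trans (force-≡ a _) (≡.trans (force-≡ b _) (≡.trans (force-≡ c _) (≡.trans (force-≡ d _) (≡.trans (force-≡ e _) (force-≡ g _)))))

iterate : ∀ {A : Set} → (ℕ → Estimates → Estimates) → (Estimates → A) → ℕ → ℕ → Estimates → A
iterate step final ℕ.zero    t s = final s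
iterate step final (ℕ.suc fuel) t s = strictly (step t s) (iterate step final fuel (ℕ.suc t))

mixℕ : ℕ → ℕ → ℕ → ℕ → ℕ → ℕ
mixℕ t z x₁ x₂ x₃ = (2 ℕ.⊓ ℕ.suc t ℕ.* x₁ ℕ.+ (ℕ.suc t ℕ.∸ 2) ℕ.⊓ 2 ℕ.* x₂ ℕ.+ (ℕ.suc t ℕ.∸ 4) ℕ.* x₃) ÷ℕ (ℕ.suc t ℕ.* z)

exploreℕ : ℕ → Estimates → Estimates
exploreℕ z (estimates a b c d e g) =
  estimates (((z ℕ.∸ 1) ℕ.* a) ÷ℕ z) b (((z ℕ.∸ 1) ℕ.* c) ÷ℕ z) (((z ℕ.∸ 2) ℕ.* d) ÷ℕ z) e g

round₁ℕ : ℕ → ℕ → Estimates → Estimates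
round₁ℕ t z (estimates a b c d e g) = estimates
  (mixℕ t z 0 ((z ℕ.∸ 1) ℕ.* a ℕ.+ c) ((z ℕ.∸ 1) ℕ.* a ℕ.+ c))
  (mixℕ t 1 a b b)
  (mixℕ t z 0 ((z ℕ.∸ 1) ℕ.* d) ((z ℕ.∸ 1) ℕ.* c))
  (mixℕ t z 0 0 ((z ℕ.∸ 2) ℕ.* d))
  (mixℕ t 1 c c e)
  (g ℕ.+ b)

round₂ℕ : ℕ → ℕ → Estimates → Estimates
round₂ℕ t z (estimates a b c d e g) = estimates
  0 (mixℕ t z 0 ((z ℕ.∸ 1) ℕ.* b ℕ.+ e) ((z ℕ.∸ 1) ℕ.* b ℕ.+ e)) 0 0 (mixℕ t z 0 0 ((z ℕ.∸ 2) ℕ.* e))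
  (g ℕ.+ b)

nextℕ : ℕ → ℕ → ℕ → Estimates → Estimates
nextℕ m k t s =
  if ℕ.suc t <ᵇ k then exploreℕ (m ℕ.∸ t) s
  else if t <ᵇ m then round₁ℕ t (m ℕ.∸ t) s
  else round₂ℕ t (2 ℕ.* m ℕ.∸ t) s

checkSmall : ℕ → Bool
checkSmall m = iterate (nextℕ m ((2 ℕ.* m) ℕ./ 4))
  (λ s → 100 ℕ.* (2 ℕ.* m) ℕ.* scale ≤ᵇ 462 ℕ.* Estimates.g s)
  (2 ℕ.* m) 0 (estimates scale scale scale scale scale 0)

-- A lower bound after q more arrivals, for any q, if time is measured in blocks of q arrivals
-- and z blocks are left in the round.
block₁ℕ : ℕ → ℕ → Estimates → Estimates
block₁ℕ i z (estimates a b c d e g) = estimates a′ b′ c′ d′ e′ (g ℕ.+ b′)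
  where
  j = ℕ.suc i
  d′ = ((j ℕ.∸ 4) ℕ.* (z ℕ.∸ 2) ℕ.* d) ÷ℕ (j ℕ.* z)
  c′ = ((j ℕ.∸ 4) ℕ.* (z ℕ.∸ 1) ℕ.* j ℕ.* c ℕ.+ 2 ℕ.* (j ℕ.∸ 4) ℕ.* (z ℕ.∸ 1) ℕ.* d′) ÷ℕ (j ℕ.* z ℕ.* j)
  a′ = ((j ℕ.∸ 2) ℕ.* (z ℕ.∸ 1) ℕ.* a ℕ.+ (j ℕ.∸ 2) ℕ.* c′) ÷ℕ (j ℕ.* z)
  e′ = ((j ℕ.∸ 4) ℕ.* j ℕ.* e ℕ.+ 4 ℕ.* (j ℕ.∸ 4) ℕ.* c′) ÷ℕ (j ℕ.* j)
  b′ = ((j ℕ.∸ 2) ℕ.* j ℕ.* b ℕ.+ 2 ℕ.* (j ℕ.∸ 2) ℕ.* a′) ÷ℕ (j ℕ.* j)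

block₂ℕ : ℕ → ℕ → Estimates → Estimates
block₂ℕ i z (estimates a b c d e g) = estimates 0 b′ 0 0 e′ (g ℕ.+ b′)
  where
  j = ℕ.suc i
  e′ = ((j ℕ.∸ 4) ℕ.* (z ℕ.∸ 2) ℕ.* e) ÷ℕ (j ℕ.* z)
  b′ = ((j ℕ.∸ 2) ℕ.* (z ℕ.∸ 1) ℕ.* b ℕ.+ (j ℕ.∸ 2) ℕ.* e′) ÷ℕ (j ℕ.* z)

blockℕ : ℕ → ℕ → Estimates → Estimates
blockℕ p i s = if i <ᵇ 2 ℕ.* p then block₁ℕ i (2 ℕ.* p ℕ.∸ i) s else block₂ℕ i (4 ℕ.* p ℕ.∸ i) s

-- Bounds just after the first exploitation step, whose own gain is given up. Exploration leaves one
-- vertex at degree 0 with probability about 1/2, two with about 1/4, and saturates none. The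
-- subtracted 2 and 4 are the arrivals that may propose `l`, respectively `l` or `l′`, in that step;
-- for the 5 see `start-d`.
blockStart : ℕ → ℕ → Estimates
blockStart σ p = estimates
  ((σ ℕ.* (p ℕ.∸ 2)) ÷ℕ (2 ℕ.* p)) ((σ ℕ.* (p ℕ.∸ 2)) ÷ℕ (1 ℕ.* p)) ((σ ℕ.* (p ℕ.∸ 4)) ÷ℕ (2 ℕ.* p))
  ((σ ℕ.* (p ℕ.∸ 5)) ÷ℕ (4 ℕ.* p)) ((σ ℕ.* (p ℕ.∸ 4)) ÷ℕ (1 ℕ.* p)) 0

-- Gains are counted per block, starting with block `p`. All arrivals fit into `4 * p + 4` blocks:
-- with `k = p * q + ρ` and `ρ < q` their number is at most `4 * k + 2`, which is at most
-- `4 * p * q + 4 * q`.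
checkLarge : ℕ → Bool
checkLarge p = iterate (blockℕ p)
  (λ s → 100 ℕ.* (4 ℕ.* p ℕ.+ 4) ℕ.* scale ≤ᵇ 462 ℕ.* Estimates.g s)
  (3 ℕ.* p) p (blockStart scale p)

allFrom : (ℕ → Bool) → ℕ → ℕ → Bool
allFrom check ℕ.zero    i = true
allFrom check (ℕ.suc len) i = check i ∧ allFrom check len (ℕ.suc i)

allFrom-sound : ∀ check len i → allFrom check len i ≡ true → ∀ j → i ℕ.≤ j → j ℕ.< i ℕ.+ len → check j ≡ true
allFrom-sound check ℕ.zero    i eq j i≤j j< = contradiction i≤j (ℕ.<⇒≱ (ℕ.<-≤-trans j< (ℕ.≤-reflexive (ℕ.+-identityʳ i))))
allFrom-sound check (ℕ.suc len) i eq j i≤j j< with check i in checked | i ℕ.≟ j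
... | true | yes ≡.refl = checked
... | true | no i≢j     = allFrom-sound check len (ℕ.suc i) eq j (ℕ.≤∧≢⇒< i≤j i≢j) (ℕ.<-≤-trans j< (ℕ.≤-reflexive (ℕ.+-suc i len)))

-- In the limit the recursion yields about 1.019 n / 4.62. With at least 300 blocks in each quarter
-- of the arrivals, rounding to whole blocks costs less than this surplus.
abstract
  smallChecks : ∀ m → m ℕ.< 600 → checkSmall m ≡ true
  smallChecks m m< = allFrom-sound checkSmall 600 0 ≡.refl m ℕ.z≤n m<

  largeChecks : ∀ p → 300 ℕ.≤ p → p ℕ.< 600 → checkLarge p ≡ true
  largeChecks p 300≤ p< = allFrom-sound checkLarge 300 300 ≡.refl p 300≤ p<

-- Soundness of the rounded evaluation

module Estimation {ℓ ℓ₁ ℓ₂} (K : OrderedField ℓ ℓ₁ ℓ₂) (σ : ℕ) .{{_ : ℕ.NonZero σ}} where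

  open OrderedField K hiding (zero)
  open OrderedFieldProperties K
  open Sequences K

  infix 4 _≲_
  -- An estimate `k` stands for `k / σ`. Keeping `σ` a variable prevents `σ · x` from unfolding into
  -- a million summands.
  record _≲_ (k : ℕ) (x : Carrier) : Set ℓ₂ where
    constructor bounded
    field bound : fromℕ k ≤ σ · x
  open _≲_ public

  ≲-+ : ∀ {j k x y} → j ≲ x → k ≲ y → j ℕ.+ k ≲ x + y
  ≲-+ {j} {k} {x} {y} (bounded p) (bounded q) = bounded (begin
    fromℕ (j ℕ.+ k)   ≈⟨ ×-homo-+ 1# j k ⟩
    fromℕ j + fromℕ k ≤⟨ +-mono-≤ p q ⟩
    σ · x + σ · y     ≈⟨ ·-distrib-+ σ x y ⟨
    σ · (x + y)       ∎)
    where open ≤-Reasoning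

  ≲-· : ∀ i {k x} → k ≲ x → i ℕ.* k ≲ i · x
  ≲-· i {k} {x} (bounded p) = bounded (begin
    fromℕ (i ℕ.* k) ≈⟨ ×-assocˡ 1# i k ⟨
    i · fromℕ k     ≤⟨ ·-monoʳ-≤ i p ⟩
    i · (σ · x)     ≈⟨ ·-comm-· i σ x ⟩
    σ · (i · x)     ∎)
    where open ≤-Reasoning

  ≲-÷ : ∀ z .{{_ : ℕ.NonZero z}} {k x} → k ≲ z · x → k ÷ℕ z ≲ x
  ≲-÷ z {k} {x} (bounded p) = bounded (·-cancel-≤ z (begin
    z · fromℕ (k ÷ℕ z)     ≈⟨ ×-assocˡ 1# z (k ÷ℕ z) ⟩
    fromℕ (z ℕ.* (k ÷ℕ z)) ≤⟨ ·-monoˡ-≤ 0≤1 (÷ℕ-≤ k z) ⟩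
    fromℕ k                ≤⟨ p ⟩
    σ · (z · x)            ≈⟨ ·-comm-· σ z x ⟩
    z · (σ · x)            ∎))
    where open ≤-Reasoning

  ≲-≈ : ∀ {k x y} → x ≈ y → k ≲ x → k ≲ y
  ≲-≈ x≈y (bounded p) = bounded (≤-trans p (≤-reflexive (×-congʳ σ x≈y)))

  ≲-≤ : ∀ {k x y} → x ≤ y → k ≲ x → k ≲ y
  ≲-≤ x≤y (bounded p) = bounded (≤-trans p (·-monoʳ-≤ σ x≤y))

  ≲-÷÷ : ∀ z .{{_ : ℕ.NonZero z}} {k x} → k ≲ x → k ÷ℕ z ≲ x ÷ z
  ≲-÷÷ z p = ≲-÷ z (≲-≈ (sym (·-÷ z _)) p)

  0≲0 : 0 ≲ 0#
  0≲0 = bounded (≤-reflexive (sym (·-zeroʳ σ)))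

  ≲-mix : ∀ t z .{{_ : ℕ.NonZero z}} {k₁ k₂ k₃ x₁ x₂ x₃} → k₁ ≲ x₁ → k₂ ≲ x₂ → k₃ ≲ x₃ →
    mixℕ t z k₁ k₂ k₃ ≲ mix t z x₁ x₂ x₃
  ≲-mix t z p₁ p₂ p₃ = ≲-÷÷ (ℕ.suc t ℕ.* z) {{ℕ.m*n≢0 (ℕ.suc t) z}}
    (≲-+ (≲-+ (≲-· (α (ℕ.suc t)) p₁) (≲-· (β (ℕ.suc t)) p₂)) (≲-· (γ (ℕ.suc t)) p₃))

  record Estimate (s : Estimates) (v : Values) (total : Carrier) : Set ℓ₂ where
    private
      module E = Estimates s
      module V = Values v
    field
      a≲ : E.a ≲ V.a
      b≲ : E.b ≲ V.b
      c≲ : E.c ≲ V.c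
      d≲ : E.d ≲ V.d
      e≲ : E.e ≲ V.e
      g≲ : E.g ≲ total

  nextℕ-estimate : ∀ m k t s → k ℕ.≤ m → t ℕ.< 2 ℕ.* m → Estimate s (valuesAt m k t) (totalGain m k t) →
    Estimate (nextℕ m k t s) (valuesAt m k (ℕ.suc t)) (totalGain m k (ℕ.suc t))
  nextℕ-estimate m k t s k≤m t<2m est with ℕ.suc t <ᵇ k in eq₁ | t <ᵇ m in eq₂
  ... | true | _ = record
    { a≲ = ≲-÷÷ z (≲-· (z ℕ.∸ 1) a≲) ; b≲ = b≲ ; c≲ = ≲-÷÷ z (≲-· (z ℕ.∸ 1) c≲)
    ; d≲ = ≲-÷÷ z (≲-· (z ℕ.∸ 2) d≲) ; e≲ = e≲ ; g≲ = ≲-≈ (sym (+-identityʳ _)) g≲ }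
    where
    open Estimate est
    z = m ℕ.∸ t
    instance _ = ∸-nonZero (ℕ.<-trans (ℕ.n<1+n t) (ℕ.<-≤-trans (true-<ᵇ eq₁) k≤m))
  ... | false | true = record
    { a≲ = ≲-mix t z 0≲0 (≲-+ (≲-· (z ℕ.∸ 1) a≲) c≲) (≲-+ (≲-· (z ℕ.∸ 1) a≲) c≲)
    ; b≲ = ≲-mix t 1 a≲ b≲ b≲
    ; c≲ = ≲-mix t z 0≲0 (≲-· (z ℕ.∸ 1) d≲) (≲-· (z ℕ.∸ 1) c≲)
    ; d≲ = ≲-mix t z 0≲0 0≲0 (≲-· (z ℕ.∸ 2) d≲)
    ; e≲ = ≲-mix t 1 c≲ c≲ e≲
    ; g≲ = ≲-+ g≲ b≲ }
    where
    open Estimate est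
    z = m ℕ.∸ t
    instance _ = ∸-nonZero {m} {t} (true-<ᵇ eq₂)
  ... | false | false = record
    { a≲ = 0≲0
    ; b≲ = ≲-mix t z 0≲0 (≲-+ (≲-· (z ℕ.∸ 1) b≲) e≲) (≲-+ (≲-· (z ℕ.∸ 1) b≲) e≲)
    ; c≲ = 0≲0
    ; d≲ = 0≲0
    ; e≲ = ≲-mix t z 0≲0 0≲0 (≲-· (z ℕ.∸ 2) e≲)
    ; g≲ = ≲-+ g≲ b≲ }
    where
    open Estimate est
    z = 2 ℕ.* m ℕ.∸ t
    instance _ = ∸-nonZero t<2m

  iterate-estimate : ∀ {step : ℕ → Estimates → Estimates} {final : Estimates → Bool}
    (P : ℕ → Estimates → Set ℓ₂) fuel t s → (∀ i s → t ℕ.≤ i → i ℕ.< t ℕ.+ fuel → P i s → P (ℕ.suc i) (step i s)) →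
    P t s → iterate step final fuel t s ≡ true → Σ[ s′ ∈ Estimates ] P (t ℕ.+ fuel) s′ × final s′ ≡ true
  iterate-estimate P ℕ.zero t s next p eq rewrite ℕ.+-identityʳ t = s , p , eq
  iterate-estimate {step} {final} P (ℕ.suc fuel) t s next p eq rewrite ℕ.+-suc t fuel =
    iterate-estimate P fuel (ℕ.suc t) (step t s)
      (λ i s′ t< i< → next i s′ (ℕ.<⇒≤ t<) i<)
      (next t s ℕ.≤-refl (ℕ.s≤s (ℕ.m≤m+n t fuel)) p)
      (≡.trans (≡.sym (strictly-≡ (step t s) (iterate step final fuel (ℕ.suc t)))) eq)

  start-estimate : Estimate (estimates σ σ σ σ σ 0) (values 1# 1# 1# 1# 1#) 0#
  start-estimate = record { a≲ = σ≲1 ; b≲ = σ≲1 ; c≲ = σ≲1 ; d≲ = σ≲1 ; e≲ = σ≲1 ; g≲ = 0≲0 }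
    where
    σ≲1 : σ ≲ 1#
    σ≲1 = bounded ≤-refl

  conclude : ∀ A B {g N x} → (A ℕ.* N ℕ.* σ ≤ᵇ B ℕ.* g) ≡ true → g ≲ x → (A ℕ.* N) · 1# ≤ B · x
  conclude A B {g} {N} {x} eq g≲ = ·-cancel-≤ σ (begin
    σ · ((A ℕ.* N) · 1#)       ≈⟨ ×-assocˡ 1# σ (A ℕ.* N) ⟩
    (σ ℕ.* (A ℕ.* N)) · 1#     ≤⟨ ·-monoˡ-≤ 0≤1 (ℕ.≤-trans (ℕ.≤-reflexive (ℕ.*-comm σ (A ℕ.* N))) (ℕ.≤ᵇ⇒≤ _ _ (≡.subst T (≡.sym eq) tt))) ⟩
    fromℕ (B ℕ.* g)            ≤⟨ bound (≲-· B g≲) ⟩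
    σ · (B · x)                ∎)
    where open ≤-Reasoning

module SmallInstances {ℓ ℓ₁ ℓ₂} (K : OrderedField ℓ ℓ₁ ℓ₂) where

  open OrderedField K hiding (zero)
  open OrderedFieldProperties K
  open Sequences K

  totalGain-small : ∀ m → m ℕ.< 600 → (2 ℕ.* m) ℕ./ 4 ℕ.≤ m →
    (100 ℕ.* (2 ℕ.* m)) · 1# ≤ 462 · totalGain m ((2 ℕ.* m) ℕ./ 4) (2 ℕ.* m)
  totalGain-small m m<600 k≤m =
    let (s , est , eq) = iterate-estimate {nextℕ m k} P (2 ℕ.* m) 0 _
          (λ t s _ t<2m → nextℕ-estimate m k t s k≤m t<2m) start-estimate (smallChecks m m<600)
    in conclude 100 462 {N = 2 ℕ.* m} eq (Estimate.g≲ est)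
    where
    open Estimation K scale
    k = (2 ℕ.* m) ℕ./ 4
    P : ℕ → Estimates → Set ℓ₂
    P t s = Estimate s (valuesAt m k t) (totalGain m k t)

-- The recursion as linear inequalities without denominators

module LinearForms {ℓ ℓ₁ ℓ₂} (K : OrderedField ℓ ℓ₁ ℓ₂) where

  open OrderedField K hiding (zero)
  open OrderedFieldProperties K
  open Sequences K

  ·-linear : ∀ h A B x y → h · (A · x + B · y) ≈ (h ℕ.* A) · x + (h ℕ.* B) · y
  ·-linear h A B x y = trans (·-distrib-+ h _ _) (+-cong (×-assocˡ x h A) (×-assocˡ y h B))

  linear-mono : ∀ {A A′ B B′ x y} → 0# ≤ x → 0# ≤ y → A ℕ.≤ A′ → B ℕ.≤ B′ → A · x + B · y ≤ A′ · x + B′ · y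
  linear-mono 0≤x 0≤y A≤ B≤ = +-mono-≤ (·-monoˡ-≤ 0≤x A≤) (·-monoˡ-≤ 0≤y B≤)

  -- One step of a weighted telescoping: the recursion for x is multiplied by κ and the
  -- previous inequality by μ.
  advance : ∀ {N N′ G G′ D D′ p r g} h κ μ .{{_ : ℕ.NonZero h}} {x₀ x x′ y} → 0# ≤ x₀ → 0# ≤ y →
    r · x + g · y ≤ p · x′ → h ℕ.* D′ ≡ κ ℕ.* p → κ ℕ.* r ≡ μ ℕ.* D →
    h ℕ.* N′ ℕ.≤ μ ℕ.* N → h ℕ.* G′ ℕ.≤ μ ℕ.* G ℕ.+ κ ℕ.* g →
    N · x₀ + G · y ≤ D · x → N′ · x₀ + G′ · y ≤ D′ · x′
  advance {N} {N′} {G} {G′} {D} {D′} {p} {r} {g} h κ μ {x₀} {x} {x′} {y} 0≤x₀ 0≤y rec hD κr hN hG prev =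
    ·-cancel-≤ h (begin
      h · (N′ · x₀ + G′ · y)                            ≈⟨ ·-linear h N′ G′ x₀ y ⟩
      (h ℕ.* N′) · x₀ + (h ℕ.* G′) · y                  ≤⟨ linear-mono 0≤x₀ 0≤y hN hG ⟩
      (μ ℕ.* N) · x₀ + (μ ℕ.* G ℕ.+ κ ℕ.* g) · y        ≈⟨ +-congˡ (×-homo-+ y (μ ℕ.* G) (κ ℕ.* g)) ⟩
      (μ ℕ.* N) · x₀ + ((μ ℕ.* G) · y + (κ ℕ.* g) · y)  ≈⟨ +-assoc _ _ _ ⟨
      (μ ℕ.* N) · x₀ + (μ ℕ.* G) · y + (κ ℕ.* g) · y    ≈⟨ +-congʳ (·-linear μ N G x₀ y) ⟨
      μ · (N · x₀ + G · y) + (κ ℕ.* g) · y              ≤⟨ +-monoˡ-≤ _ (·-monoʳ-≤ μ prev) ⟩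
      μ · (D · x) + (κ ℕ.* g) · y                       ≈⟨ +-congʳ (trans (×-assocˡ x μ D) (·-congˡ (≡.sym κr))) ⟩
      (κ ℕ.* r) · x + (κ ℕ.* g) · y                     ≈⟨ ·-linear κ r g x y ⟨
      κ · (r · x + g · y)                               ≤⟨ ·-monoʳ-≤ κ rec ⟩
      κ · (p · x′)                                      ≈⟨ trans (×-assocˡ x′ κ p) (·-congˡ (≡.sym hD)) ⟩
      (h ℕ.* D′) · x′                                   ≈⟨ ×-assocˡ x′ h D′ ⟨
      h · (D′ · x′)                                     ∎)
    where open ≤-Reasoning

  -- A denominator z may be replaced by a smaller one, as x is averaged with a smaller y.
  shrink : ∀ r z z′ {x y} → 1 ℕ.≤ z′ → z′ ℕ.≤ z → 0# ≤ y → y ≤ x →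
    z · (r · ((z′ ℕ.∸ 1) · x + y)) ≤ z′ · (r · ((z ℕ.∸ 1) · x + y))
  shrink r z (ℕ.suc w) {x} {y} _ z′≤z 0≤y y≤x with z ℕ.∸ ℕ.suc w | ℕ.m+[n∸m]≡n z′≤z
  ... | δ | ≡.refl = begin
    z · (r · (w · x + y))                    ≈⟨ ·-comm-· z r _ ⟩
    r · (z · (w · x + y))                    ≤⟨ ·-monoʳ-≤ r key ⟩
    r · (ℕ.suc w · ((w ℕ.+ δ) · x + y))        ≈⟨ ·-comm-· r (ℕ.suc w) _ ⟩
    ℕ.suc w · (r · ((w ℕ.+ δ) · x + y))        ∎
    where
    open ≤-Reasoning
    key : z · (w · x + y) ≤ ℕ.suc w · ((w ℕ.+ δ) · x + y)
    key = begin
      z · (w · x + y)                                   ≈⟨ ×-homo-+ _ (ℕ.suc w) δ ⟩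
      ℕ.suc w · (w · x + y) + δ · (w · x + y)             ≤⟨ +-monoʳ-≤ _ (·-monoʳ-≤ δ (+-monoʳ-≤ _ y≤x)) ⟩
      ℕ.suc w · (w · x + y) + δ · (w · x + x)             ≈⟨ +-congˡ (×-congʳ δ (+-comm _ _)) ⟩
      ℕ.suc w · (w · x + y) + δ · (ℕ.suc w · x)             ≈⟨ +-congˡ (·-comm-· δ (ℕ.suc w) x) ⟩
      ℕ.suc w · (w · x + y) + ℕ.suc w · (δ · x)             ≈⟨ ·-distrib-+ (ℕ.suc w) _ _ ⟨
      ℕ.suc w · (w · x + y + δ · x)                       ≈⟨ ×-congʳ (ℕ.suc w) (trans (+-assoc _ _ _) (trans (+-congˡ (+-comm _ _)) (sym (+-assoc _ _ _)))) ⟩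
      ℕ.suc w · (w · x + δ · x + y)                       ≈⟨ ×-congʳ (ℕ.suc w) (+-congʳ (×-homo-+ x w δ)) ⟨
      ℕ.suc w · ((w ℕ.+ δ) · x + y)                       ∎

  shrink-∸ : ∀ r i z z′ {x} → z′ ℕ.≤ z → 0# ≤ x →
    z · (r · ((z′ ℕ.∸ i) · x)) ≤ z′ · (r · ((z ℕ.∸ i) · x))
  shrink-∸ r i z z′ {x} z′≤z 0≤x = begin
    z · (r · ((z′ ℕ.∸ i) · x))   ≈⟨ ·-comm-· z r _ ⟩
    r · (z · ((z′ ℕ.∸ i) · x))   ≈⟨ ×-congʳ r (×-assocˡ x z _) ⟩
    r · ((z ℕ.* (z′ ℕ.∸ i)) · x) ≤⟨ ·-monoʳ-≤ r (·-monoˡ-≤ 0≤x arith) ⟩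
    r · ((z′ ℕ.* (z ℕ.∸ i)) · x) ≈⟨ ×-congʳ r (×-assocˡ x z′ _) ⟨
    r · (z′ · ((z ℕ.∸ i) · x))   ≈⟨ ·-comm-· r z′ _ ⟩
    z′ · (r · ((z ℕ.∸ i) · x))   ∎
    where
    open ≤-Reasoning
    arith : z ℕ.* (z′ ℕ.∸ i) ℕ.≤ z′ ℕ.* (z ℕ.∸ i)
    arith = ℕ.≤-trans (ℕ.≤-reflexive (ℕ.*-distribˡ-∸ z z′ i)) (ℕ.≤-trans
      (ℕ.∸-mono (ℕ.≤-reflexive (ℕ.*-comm z z′)) (ℕ.*-monoˡ-≤ i z′≤z))
      (ℕ.≤-reflexive (≡.sym (ℕ.*-distribˡ-∸ z′ z i))))

  mix-upper : ∀ t z .{{_ : ℕ.NonZero z}} {x₁ x₂ x₃ x} → x₁ ≤ z · x → x₂ ≤ z · x → x₃ ≤ z · x → mix t z x₁ x₂ x₃ ≤ x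
  mix-upper t z {x = x} p₁ p₂ p₃ = ≤-trans (mix-mono t z p₁ p₂ p₃) (≤-trans (mix-scale t z x x x)
    (÷-≤ (ℕ.suc t ℕ.* 1) (≤-reflexive (begin-equality
      α (ℕ.suc t) · x + β (ℕ.suc t) · x + γ (ℕ.suc t) · x ≈⟨ +-congʳ (×-homo-+ x (α (ℕ.suc t)) (β (ℕ.suc t))) ⟨
      (α (ℕ.suc t) ℕ.+ β (ℕ.suc t)) · x + γ (ℕ.suc t) · x ≈⟨ ×-homo-+ x (α (ℕ.suc t) ℕ.+ β (ℕ.suc t)) (γ (ℕ.suc t)) ⟨
      (α (ℕ.suc t) ℕ.+ β (ℕ.suc t) ℕ.+ γ (ℕ.suc t)) · x   ≈⟨ ·-congˡ (≡.trans weights (≡.sym (ℕ.*-identityʳ (ℕ.suc t)))) ⟩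
      (ℕ.suc t ℕ.* 1) · x                             ∎))))
    where
    open ≤-Reasoning
    weights : α (ℕ.suc t) ℕ.+ β (ℕ.suc t) ℕ.+ γ (ℕ.suc t) ≡ ℕ.suc t
    weights = proj₂ (proj₂ (abel-nat {0} {0} {ℕ.suc t} ≡.refl (ℕ.z≤n {2}) (ℕ.z≤n {2}) ℕ.≤-refl ℕ.≤-refl))

  -- From time 3 on the truncations are inactive and the counts are `2`, `2` and `s`. All
  -- recurrences below are therefore written with `t = 3 + s`.
  mix-≈ : ∀ s {t} → t ≡ 3 ℕ.+ s → ∀ z .{{_ : ℕ.NonZero z}} x₁ x₂ x₃ →
    ((4 ℕ.+ s) ℕ.* z) · mix t z x₁ x₂ x₃ ≈ 2 · x₁ + 2 · x₂ + s · x₃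
  mix-≈ s ≡.refl z x₁ x₂ x₃ = trans (·-÷ ((4 ℕ.+ s) ℕ.* z) {{ℕ.m*n≢0 (4 ℕ.+ s) z}} _)
    (+-congʳ (+-congˡ (·-congˡ (≡.cong (2 ℕ.+_) (ℕ.⊓-zeroʳ s)))))

  mix-≈₀ : ∀ s {t} → t ≡ 3 ℕ.+ s → ∀ z .{{_ : ℕ.NonZero z}} x → ((4 ℕ.+ s) ℕ.* z) · mix t z 0# x x ≈ (2 ℕ.+ s) · x
  mix-≈₀ s t≡ z x = trans (mix-≈ s t≡ z 0# x x) (trans (+-congʳ (trans (+-congʳ (·-zeroʳ 2)) (+-identityˡ _))) (sym (×-homo-+ x 2 s)))

  mix-≈₀₀ : ∀ s {t} → t ≡ 3 ℕ.+ s → ∀ z .{{_ : ℕ.NonZero z}} x → ((4 ℕ.+ s) ℕ.* z) · mix t z 0# 0# x ≈ s · x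
  mix-≈₀₀ s t≡ z x = trans (mix-≈ s t≡ z 0# 0# x)
    (trans (+-congʳ (trans (+-cong (·-zeroʳ 2) (·-zeroʳ 2)) (+-identityˡ _))) (+-identityˡ _))

  *-rotate : ∀ z p y → z ℕ.* (p ℕ.* y) ≡ y ℕ.* (p ℕ.* z)
  *-rotate = solve-∀

  recur-shrink : ∀ p r y z .{{_ : ℕ.NonZero y}} {x x₁ x′} → 1 ℕ.≤ z → z ℕ.≤ y → 0# ≤ x₁ → x₁ ≤ x →
    (p ℕ.* y) · x′ ≈ r · ((y ℕ.∸ 1) · x + x₁) → (r ℕ.* (z ℕ.∸ 1)) · x + r · x₁ ≤ (p ℕ.* z) · x′
  recur-shrink p r y z {x} {x₁} {x′} 1≤z z≤y 0≤x₁ x₁≤x eq = ·-cancel-≤ y (begin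
    y · ((r ℕ.* (z ℕ.∸ 1)) · x + r · x₁)   ≈⟨ ×-congʳ y (trans (·-distrib-+ r _ _) (+-congʳ (×-assocˡ x r _))) ⟨
    y · (r · ((z ℕ.∸ 1) · x + x₁))         ≤⟨ shrink r y z 1≤z z≤y 0≤x₁ x₁≤x ⟩
    z · (r · ((y ℕ.∸ 1) · x + x₁))         ≈⟨ ×-congʳ z eq ⟨
    z · ((p ℕ.* y) · x′)                   ≈⟨ trans (×-assocˡ x′ z _) (·-congˡ (*-rotate z p y)) ⟩
    (y ℕ.* (p ℕ.* z)) · x′                 ≈⟨ ×-assocˡ x′ y _ ⟨
    y · ((p ℕ.* z) · x′)                   ∎)
    where open ≤-Reasoning

  recur-shrink-∸ : ∀ p r i y z .{{_ : ℕ.NonZero y}} {x x′} → z ℕ.≤ y → 0# ≤ x →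
    r · ((y ℕ.∸ i) · x) ≤ (p ℕ.* y) · x′ → (r ℕ.* (z ℕ.∸ i)) · x ≤ (p ℕ.* z) · x′
  recur-shrink-∸ p r i y z {x} {x′} z≤y 0≤x le = ·-cancel-≤ y (begin
    y · ((r ℕ.* (z ℕ.∸ i)) · x)   ≈⟨ ×-congʳ y (×-assocˡ x r _) ⟨
    y · (r · ((z ℕ.∸ i) · x))     ≤⟨ shrink-∸ r i y z z≤y 0≤x ⟩
    z · (r · ((y ℕ.∸ i) · x))     ≤⟨ ·-monoʳ-≤ z le ⟩
    z · ((p ℕ.* y) · x′)          ≈⟨ trans (×-assocˡ x′ z _) (·-congˡ (*-rotate z p y)) ⟩
    (y ℕ.* (p ℕ.* z)) · x′        ≈⟨ ×-assocˡ x′ y _ ⟨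
    y · ((p ℕ.* z) · x′)          ∎)
    where open ≤-Reasoning

  module Recursion (m k : ℕ) (k≤m : k ℕ.≤ m) where

   private
    m≤2m : m ℕ.≤ 2 ℕ.* m
    m≤2m = ℕ.m≤m+n m _

   -- Outside this block the sequences are known only by their equations and their order, so that
   -- `valuesAt` does not unfold in the algebra that follows.
   abstract

    sequence : ℕ → Values
    sequence = valuesAt m k

    a b c d e G : ℕ → Carrier
    a t = Values.a (sequence t)
    b t = Values.b (sequence t)
    c t = Values.c (sequence t)
    d t = Values.d (sequence t)
    e t = Values.e (sequence t)
    G t = totalGain m k t

    G≡totalGain : ∀ t → G t ≡ totalGain m k t
    G≡totalGain t = ≡.refl

    sequence-round₁ : ∀ {t} → k ℕ.≤ ℕ.suc t → t ℕ.< m → sequence (ℕ.suc t) ≡ round₁Next t (m ℕ.∸ t) (sequence t)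
    sequence-round₁ k≤ t<m rewrite <ᵇ-false k≤ | <ᵇ-true t<m = ≡.refl

    sequence-round₂ : ∀ {t} → k ℕ.≤ ℕ.suc t → m ℕ.≤ t → sequence (ℕ.suc t) ≡ round₂Next t (2 ℕ.* m ℕ.∸ t) (sequence t)
    sequence-round₂ k≤ m≤t rewrite <ᵇ-false k≤ | <ᵇ-false m≤t = ≡.refl

    sequence-explore : ∀ {t} → ℕ.suc t ℕ.< k → sequence (ℕ.suc t) ≡ exploreNext (m ℕ.∸ t) (sequence t)
    sequence-explore t<k rewrite <ᵇ-true t<k = ≡.refl

    G-step : ∀ {t} → k ℕ.≤ ℕ.suc t → G (ℕ.suc t) ≡ G t + b t
    G-step k≤ rewrite <ᵇ-false k≤ = ≡.refl

    G-nonneg : ∀ t → t ℕ.≤ 2 ℕ.* m → 0# ≤ G t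
    G-nonneg ℕ.zero    t≤ = ≤-refl
    G-nonneg (ℕ.suc t) t< with ℕ.suc t <ᵇ k
    ... | true  = ≤-trans (G-nonneg t (ℕ.<⇒≤ t<)) (≤-reflexive (sym (+-identityʳ _)))
    ... | false = +-nonneg (G-nonneg t (ℕ.<⇒≤ t<)) (Ordered.0≤b (valuesAt-ordered m k t k≤m (ℕ.<⇒≤ t<)))

    ordered : ∀ t → t ℕ.≤ 2 ℕ.* m → Ordered (values (a t) (b t) (c t) (d t) (e t))
    ordered t = valuesAt-ordered m k t k≤m

    start : (values (a 0) (b 0) (c 0) (d 0) (e 0)) ≡ values 1# 1# 1# 1# 1#
    start = ≡.refl

    explore-equations : ∀ {t} → ℕ.suc t ℕ.< k →
      let z = m ℕ.∸ t in
      values (a (ℕ.suc t)) (b (ℕ.suc t)) (c (ℕ.suc t)) (d (ℕ.suc t)) (e (ℕ.suc t)) ≡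
      exploreNext z (values (a t) (b t) (c t) (d t) (e t))
    explore-equations t<k = sequence-explore t<k

    a-round₁ : ∀ {t} → k ℕ.≤ ℕ.suc t → t ℕ.< m →
      a (ℕ.suc t) ≡ mix t (m ℕ.∸ t) 0# ((m ℕ.∸ t ℕ.∸ 1) · a t + c t) ((m ℕ.∸ t ℕ.∸ 1) · a t + c t)
    a-round₁ k≤ t<m = ≡.cong Values.a (sequence-round₁ k≤ t<m)

    b-round₁ : ∀ {t} → k ℕ.≤ ℕ.suc t → t ℕ.< m →
      b (ℕ.suc t) ≡ mix t 1 (a t) (b t) (b t)
    b-round₁ k≤ t<m = ≡.cong Values.b (sequence-round₁ k≤ t<m)

    c-round₁ : ∀ {t} → k ℕ.≤ ℕ.suc t → t ℕ.< m →
      c (ℕ.suc t) ≡ mix t (m ℕ.∸ t) 0# ((m ℕ.∸ t ℕ.∸ 1) · d t) ((m ℕ.∸ t ℕ.∸ 1) · c t)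
    c-round₁ k≤ t<m = ≡.cong Values.c (sequence-round₁ k≤ t<m)

    d-round₁ : ∀ {t} → k ℕ.≤ ℕ.suc t → t ℕ.< m →
      d (ℕ.suc t) ≡ mix t (m ℕ.∸ t) 0# 0# ((m ℕ.∸ t ℕ.∸ 2) · d t)
    d-round₁ k≤ t<m = ≡.cong Values.d (sequence-round₁ k≤ t<m)

    e-round₁ : ∀ {t} → k ℕ.≤ ℕ.suc t → t ℕ.< m →
      e (ℕ.suc t) ≡ mix t 1 (c t) (c t) (e t)
    e-round₁ k≤ t<m = ≡.cong Values.e (sequence-round₁ k≤ t<m)

    b-round₂ : ∀ {t} → k ℕ.≤ ℕ.suc t → m ℕ.≤ t →
      b (ℕ.suc t) ≡ mix t (2 ℕ.* m ℕ.∸ t) 0# ((2 ℕ.* m ℕ.∸ t ℕ.∸ 1) · b t + e t) ((2 ℕ.* m ℕ.∸ t ℕ.∸ 1) · b t + e t)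
    b-round₂ k≤ m≤t = ≡.cong Values.b (sequence-round₂ k≤ m≤t)

    e-round₂ : ∀ {t} → k ℕ.≤ ℕ.suc t → m ℕ.≤ t →
      e (ℕ.suc t) ≡ mix t (2 ℕ.* m ℕ.∸ t) 0# 0# ((2 ℕ.* m ℕ.∸ t ℕ.∸ 2) · e t)
    e-round₂ k≤ m≤t = ≡.cong Values.e (sequence-round₂ k≤ m≤t)

   -- The new value is an average of terms that `Ordered` bounds by the old value. Monotonicity lets
   -- the value at the end of a block replace all those inside it.
   decreasing-b : ∀ t → t ℕ.< 2 ℕ.* m → k ℕ.≤ ℕ.suc t → b (ℕ.suc t) ≤ b t
   decreasing-b t t<2m k≤ with t ℕ.<? m
   ... | yes t<m rewrite b-round₁ k≤ t<m =
     mix-upper t 1 (≤-trans (Ordered.a≤b o) 1·) 1· 1·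
     where
     o : Ordered (values (a t) (b t) (c t) (d t) (e t))
     o = ordered t (ℕ.<⇒≤ t<2m)
     1· : ∀ {x} → x ≤ 1 · x
     1· = ≤-reflexive (sym (×-homo-1 _))
   ... | no t≮m rewrite b-round₂ k≤ (ℕ.≮⇒≥ t≮m) = mix-upper t z
       (·-nonneg z (Ordered.0≤b o)) (z∸1+1 z (Ordered.e≤b o)) (z∸1+1 z (Ordered.e≤b o))
     where
     o : Ordered (values (a t) (b t) (c t) (d t) (e t))
     o = ordered t (ℕ.<⇒≤ t<2m)
     z : ℕ
     z = 2 ℕ.* m ℕ.∸ t
     instance
       z≢0 : ℕ.NonZero (2 ℕ.* m ℕ.∸ t)
       z≢0 = ∸-nonZero t<2m

   decreasing-e : ∀ t → t ℕ.< 2 ℕ.* m → k ℕ.≤ ℕ.suc t → e (ℕ.suc t) ≤ e t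
   decreasing-e t t<2m k≤ with t ℕ.<? m
   ... | yes t<m rewrite e-round₁ k≤ t<m =
     mix-upper t 1 (≤-trans (Ordered.c≤e o) 1·) (≤-trans (Ordered.c≤e o) 1·) 1·
     where
     o : Ordered (values (a t) (b t) (c t) (d t) (e t))
     o = ordered t (ℕ.<⇒≤ t<2m)
     1· : ∀ {x} → x ≤ 1 · x
     1· = ≤-reflexive (sym (×-homo-1 _))
   ... | no t≮m rewrite e-round₂ k≤ (ℕ.≮⇒≥ t≮m) = mix-upper t z
       (·-nonneg z (Ordered.0≤e o)) (·-nonneg z (Ordered.0≤e o)) (·-monoˡ-≤ (Ordered.0≤e o) (ℕ.m∸n≤m z 2))
     where
     o : Ordered (values (a t) (b t) (c t) (d t) (e t))
     o = ordered t (ℕ.<⇒≤ t<2m)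
     z : ℕ
     z = 2 ℕ.* m ℕ.∸ t
     instance
       z≢0 : ℕ.NonZero (2 ℕ.* m ℕ.∸ t)
       z≢0 = ∸-nonZero t<2m

   module _ {t} (k≤ : k ℕ.≤ ℕ.suc t) (t<m : t ℕ.< m) where

     private
       open Ordered (ordered t (ℕ.≤-trans (ℕ.<⇒≤ t<m) m≤2m))
       instance
         y≢0 : ℕ.NonZero (m ℕ.∸ t)
         y≢0 = ∸-nonZero t<m

     decreasing-a : a (ℕ.suc t) ≤ a t
     decreasing-a rewrite a-round₁ k≤ t<m =
       mix-upper t (m ℕ.∸ t) (·-nonneg (m ℕ.∸ t) 0≤a) (z∸1+1 (m ℕ.∸ t) c≤a) (z∸1+1 (m ℕ.∸ t) c≤a)

     decreasing-c : c (ℕ.suc t) ≤ c t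
     decreasing-c rewrite c-round₁ k≤ t<m = mix-upper t (m ℕ.∸ t)
       (·-nonneg (m ℕ.∸ t) 0≤c) (·-mono-≤ 0≤d (ℕ.m∸n≤m (m ℕ.∸ t) 1) d≤c) (·-monoˡ-≤ 0≤c (ℕ.m∸n≤m (m ℕ.∸ t) 1))

     decreasing-d : d (ℕ.suc t) ≤ d t
     decreasing-d rewrite d-round₁ k≤ t<m = mix-upper t (m ℕ.∸ t)
       (·-nonneg (m ℕ.∸ t) 0≤d) (·-nonneg (m ℕ.∸ t) 0≤d) (·-monoˡ-≤ 0≤d (ℕ.m∸n≤m (m ℕ.∸ t) 2))

     module _ {s} (t≡ : t ≡ 3 ℕ.+ s) where

       -- In the recurrences z may be any positive number up to the size of L_a.
       recur-d : ∀ z → z ℕ.≤ (m ℕ.∸ t) → (s ℕ.* (z ℕ.∸ 2)) · d t ≤ ((4 ℕ.+ s) ℕ.* z) · d (ℕ.suc t)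
       recur-d z z≤ rewrite d-round₁ k≤ t<m =
         recur-shrink-∸ (4 ℕ.+ s) s 2 (m ℕ.∸ t) z z≤ 0≤d (≤-reflexive (sym (mix-≈₀₀ s t≡ (m ℕ.∸ t) _)))

       recur-c : ∀ z → z ℕ.≤ (m ℕ.∸ t) →
         (s ℕ.* (z ℕ.∸ 1)) · c t + (2 ℕ.* (z ℕ.∸ 1)) · d t ≤ ((4 ℕ.+ s) ℕ.* z) · c (ℕ.suc t)
       recur-c z z≤ rewrite c-round₁ k≤ t<m = ·-cancel-≤ (m ℕ.∸ t) (begin
         (m ℕ.∸ t) · ((s ℕ.* (z ℕ.∸ 1)) · c t + (2 ℕ.* (z ℕ.∸ 1)) · d t)
           ≈⟨ trans (·-distrib-+ (m ℕ.∸ t) _ _) (+-cong (×-congʳ (m ℕ.∸ t) (sym (×-assocˡ _ s _))) (×-congʳ (m ℕ.∸ t) (sym (×-assocˡ (d t) 2 (z ℕ.∸ 1))))) ⟩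
         (m ℕ.∸ t) · (s · ((z ℕ.∸ 1) · c t)) + (m ℕ.∸ t) · (2 · ((z ℕ.∸ 1) · d t))
           ≤⟨ +-mono-≤ (shrink-∸ s 1 (m ℕ.∸ t) z z≤ 0≤c) (shrink-∸ 2 1 (m ℕ.∸ t) z z≤ 0≤d) ⟩
         z · (s · ((m ℕ.∸ t ℕ.∸ 1) · c t)) + z · (2 · ((m ℕ.∸ t ℕ.∸ 1) · d t))
           ≈⟨ trans (sym (·-distrib-+ z _ _)) (×-congʳ z (+-comm _ _)) ⟩
         z · (2 · ((m ℕ.∸ t ℕ.∸ 1) · d t) + s · ((m ℕ.∸ t ℕ.∸ 1) · c t))
           ≈⟨ ×-congʳ z (trans (mix-≈ s t≡ (m ℕ.∸ t) 0# _ _) (+-congʳ (trans (+-congʳ (·-zeroʳ 2)) (+-identityˡ _)))) ⟨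
         z · (((4 ℕ.+ s) ℕ.* (m ℕ.∸ t)) · x′)
           ≈⟨ trans (×-assocˡ x′ z _) (·-congˡ (*-rotate z (4 ℕ.+ s) (m ℕ.∸ t))) ⟩
         ((m ℕ.∸ t) ℕ.* ((4 ℕ.+ s) ℕ.* z)) · x′
           ≈⟨ ×-assocˡ x′ (m ℕ.∸ t) _ ⟨
         (m ℕ.∸ t) · (((4 ℕ.+ s) ℕ.* z) · x′) ∎)
         where
         open ≤-Reasoning
         x′ : Carrier
         x′ = mix t (m ℕ.∸ t) 0# ((m ℕ.∸ t ℕ.∸ 1) · d t) ((m ℕ.∸ t ℕ.∸ 1) · c t)

       recur-a : ∀ z → 1 ℕ.≤ z → z ℕ.≤ (m ℕ.∸ t) →
         ((2 ℕ.+ s) ℕ.* (z ℕ.∸ 1)) · a t + (2 ℕ.+ s) · c t ≤ ((4 ℕ.+ s) ℕ.* z) · a (ℕ.suc t)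
       recur-a z 1≤z z≤ rewrite a-round₁ k≤ t<m =
         recur-shrink (4 ℕ.+ s) (2 ℕ.+ s) (m ℕ.∸ t) z 1≤z z≤ 0≤c c≤a (mix-≈₀ s t≡ (m ℕ.∸ t) _)

       recur-b : (2 ℕ.+ s) · b t + 2 · a t ≤ (4 ℕ.+ s) · b (ℕ.suc t)
       recur-b rewrite b-round₁ k≤ t<m = ≤-reflexive (begin-equality
         (2 ℕ.+ s) · b t + 2 · a t            ≈⟨ +-congʳ (×-homo-+ (b t) 2 s) ⟩
         2 · b t + s · b t + 2 · a t          ≈⟨ trans (+-comm _ _) (sym (+-assoc _ _ _)) ⟩
         2 · a t + 2 · b t + s · b t          ≈⟨ mix-≈ s t≡ 1 _ _ _ ⟨
         ((4 ℕ.+ s) ℕ.* 1) · mix t 1 (a t) (b t) (b t) ≈⟨ ·-congˡ (ℕ.*-identityʳ (4 ℕ.+ s)) ⟩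
         (4 ℕ.+ s) · mix t 1 (a t) (b t) (b t) ∎)
         where open ≤-Reasoning

       recur-e : s · e t + 4 · c t ≤ (4 ℕ.+ s) · e (ℕ.suc t)
       recur-e rewrite e-round₁ k≤ t<m = ≤-reflexive (begin-equality
         s · e t + 4 · c t                    ≈⟨ +-comm _ _ ⟩
         4 · c t + s · e t                    ≈⟨ +-congʳ (×-homo-+ (c t) 2 2) ⟩
         2 · c t + 2 · c t + s · e t          ≈⟨ mix-≈ s t≡ 1 _ _ _ ⟨
         ((4 ℕ.+ s) ℕ.* 1) · mix t 1 (c t) (c t) (e t) ≈⟨ ·-congˡ (ℕ.*-identityʳ (4 ℕ.+ s)) ⟩
         (4 ℕ.+ s) · mix t 1 (c t) (c t) (e t) ∎)
         where open ≤-Reasoning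

   module _ {t} (k≤ : k ℕ.≤ ℕ.suc t) (t<2m : t ℕ.< 2 ℕ.* m) {s} (t≡ : t ≡ 3 ℕ.+ s) where

     private
       open Ordered (ordered t (ℕ.<⇒≤ t<2m))
       instance
         y≢0 : ℕ.NonZero (2 ℕ.* m ℕ.∸ t)
         y≢0 = ∸-nonZero t<2m

     -- These also hold in the first round, where no random choice can saturate a vertex.
     recur-b₂ : ∀ z → 1 ℕ.≤ z → z ℕ.≤ (2 ℕ.* m ℕ.∸ t) →
       ((2 ℕ.+ s) ℕ.* (z ℕ.∸ 1)) · b t + (2 ℕ.+ s) · e t ≤ ((4 ℕ.+ s) ℕ.* z) · b (ℕ.suc t)
     recur-b₂ z 1≤z z≤ with t ℕ.<? m
     ... | no t≮m rewrite b-round₂ k≤ (ℕ.≮⇒≥ t≮m) =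
       recur-shrink (4 ℕ.+ s) (2 ℕ.+ s) (2 ℕ.* m ℕ.∸ t) z 1≤z z≤ 0≤e e≤b (mix-≈₀ s t≡ (2 ℕ.* m ℕ.∸ t) _)
     ... | yes t<m = begin
       ((2 ℕ.+ s) ℕ.* (z ℕ.∸ 1)) · b t + (2 ℕ.+ s) · e t   ≈⟨ trans (·-distrib-+ (2 ℕ.+ s) _ _) (+-congʳ (×-assocˡ (b t) (2 ℕ.+ s) (z ℕ.∸ 1))) ⟨
       (2 ℕ.+ s) · ((z ℕ.∸ 1) · b t + e t)                 ≤⟨ ·-monoʳ-≤ (2 ℕ.+ s) (z∸1+1 z {{ℕ.>-nonZero 1≤z}} e≤b) ⟩
       (2 ℕ.+ s) · (z · b t)                               ≈⟨ ·-comm-· (2 ℕ.+ s) z _ ⟩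
       z · ((2 ℕ.+ s) · b t)                               ≤⟨ ·-monoʳ-≤ z (≤-trans (x≤x+y (·-nonneg 2 0≤a)) (recur-b k≤ t<m t≡)) ⟩
       z · ((4 ℕ.+ s) · b (ℕ.suc t))                         ≈⟨ ×-assocˡ _ z _ ⟩
       (z ℕ.* (4 ℕ.+ s)) · b (ℕ.suc t)                       ≈⟨ ·-congˡ (ℕ.*-comm z (4 ℕ.+ s)) ⟩
       ((4 ℕ.+ s) ℕ.* z) · b (ℕ.suc t)                       ∎
       where open ≤-Reasoning

     recur-e₂ : ∀ z → z ℕ.≤ (2 ℕ.* m ℕ.∸ t) → (s ℕ.* (z ℕ.∸ 2)) · e t ≤ ((4 ℕ.+ s) ℕ.* z) · e (ℕ.suc t)
     recur-e₂ z z≤ with t ℕ.<? m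
     ... | no t≮m rewrite e-round₂ k≤ (ℕ.≮⇒≥ t≮m) =
       recur-shrink-∸ (4 ℕ.+ s) s 2 (2 ℕ.* m ℕ.∸ t) z z≤ 0≤e (≤-reflexive (sym (mix-≈₀₀ s t≡ (2 ℕ.* m ℕ.∸ t) _)))
     ... | yes t<m = begin
       (s ℕ.* (z ℕ.∸ 2)) · e t          ≤⟨ ·-monoˡ-≤ 0≤e (ℕ.*-monoʳ-≤ s (ℕ.m∸n≤m z 2)) ⟩
       (s ℕ.* z) · e t                  ≈⟨ trans (·-congˡ (ℕ.*-comm s z)) (sym (×-assocˡ _ z s)) ⟩
       z · (s · e t)                    ≤⟨ ·-monoʳ-≤ z (≤-trans (x≤x+y (·-nonneg 4 0≤c)) (recur-e k≤ t<m t≡)) ⟩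
       z · ((4 ℕ.+ s) · e (ℕ.suc t))      ≈⟨ ×-assocˡ _ z _ ⟩
       (z ℕ.* (4 ℕ.+ s)) · e (ℕ.suc t)    ≈⟨ ·-congˡ (ℕ.*-comm z (4 ℕ.+ s)) ⟩
       ((4 ℕ.+ s) ℕ.* z) · e (ℕ.suc t)    ∎
       where open ≤-Reasoning

-- For u = 3 + s these are u (u - 1), u (u - 1) (u - 2) and u (u - 1) (u - 2) (u - 3).
falling₂ falling₃ falling₄ : ℕ → ℕ
falling₂ s = (3 ℕ.+ s) ℕ.* (2 ℕ.+ s)
falling₃ s = falling₂ s ℕ.* (1 ℕ.+ s)
falling₄ s = falling₃ s ℕ.* s

falling₂-mono : ∀ {s s′} → s ℕ.≤ s′ → falling₂ s ℕ.≤ falling₂ s′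
falling₂-mono s≤ = ℕ.*-mono-≤ (ℕ.+-monoʳ-≤ 3 s≤) (ℕ.+-monoʳ-≤ 2 s≤)

falling₃-mono : ∀ {s s′} → s ℕ.≤ s′ → falling₃ s ℕ.≤ falling₃ s′
falling₃-mono s≤ = ℕ.*-mono-≤ (falling₂-mono s≤) (ℕ.+-monoʳ-≤ 1 s≤)

∸-suc-view : ∀ {j z} → j ℕ.< z → ∃ λ w → z ℕ.∸ j ≡ ℕ.suc w × z ℕ.∸ ℕ.suc j ≡ w × z ≡ ℕ.suc (w ℕ.+ j)
∸-suc-view {ℕ.zero} {ℕ.suc z} _ = z , ≡.refl , ≡.refl , ≡.cong ℕ.suc (≡.sym (ℕ.+-identityʳ z))
∸-suc-view {ℕ.suc j} {ℕ.suc z} (ℕ.s≤s j<z) =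
  let (w , p , q , r) = ∸-suc-view j<z in w , p , q , ≡.cong ℕ.suc (≡.trans r (≡.sym (ℕ.+-suc w j)))

private
  D-eq : ∀ s f w Z → ℕ.suc w ℕ.* ((4 ℕ.+ s) ℕ.* f ℕ.* Z) ≡ (f ℕ.* Z) ℕ.* ((4 ℕ.+ s) ℕ.* ℕ.suc w)
  D-eq = solve-∀
  κ-eq : ∀ f s A Z → (f ℕ.* Z) ℕ.* (s ℕ.* A) ≡ A ℕ.* (f ℕ.* s ℕ.* Z)
  κ-eq = solve-∀
  falling₄-suc-eq : ∀ s → (4 ℕ.+ s) ℕ.* (3 ℕ.+ s) ℕ.* (2 ℕ.+ s) ℕ.* (1 ℕ.+ s) ≡ (4 ℕ.+ s) ℕ.* ((3 ℕ.+ s) ℕ.* (2 ℕ.+ s) ℕ.* (1 ℕ.+ s))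
  falling₄-suc-eq = solve-∀
  falling₄-suc : ∀ s → falling₄ (ℕ.suc s) ≡ (4 ℕ.+ s) ℕ.* falling₃ s
  falling₄-suc = falling₄-suc-eq
  swap₃ : ∀ w F A → ℕ.suc w ℕ.* (F ℕ.* A) ≡ A ℕ.* (F ℕ.* ℕ.suc w)
  swap₃ = solve-∀

-- Telescoping over a block of arrivals

module BlockSums {ℓ ℓ₁ ℓ₂} (K : OrderedField ℓ ℓ₁ ℓ₂) (q s₀ : ℕ) where

  open OrderedField K hiding (zero)
  open OrderedFieldProperties K
  open LinearForms K

  -- The factors `s / (4 + s)` multiply to a ratio of values of `falling₄`, and the factors
  -- `(y - 2) / y` to a ratio of values of `y * (y - 1)`. The vanishing summand gives the inequality
  -- the two-term shape that `advance` expects.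
  decay-block : ∀ z₀ (x : ℕ → Carrier) → q ℕ.≤ z₀ → 0# ≤ x 0 →
    (∀ j → j ℕ.< q → ((j ℕ.+ s₀) ℕ.* (z₀ ℕ.∸ j ℕ.∸ 2)) · x j ≤ ((4 ℕ.+ (j ℕ.+ s₀)) ℕ.* (z₀ ℕ.∸ j)) · x (ℕ.suc j)) →
    ∀ j → j ℕ.≤ q →
    (falling₄ s₀ ℕ.* ((z₀ ℕ.∸ j) ℕ.* (z₀ ℕ.∸ j ℕ.∸ 1))) · x 0 + 0 · 0# ≤
    (falling₄ (j ℕ.+ s₀) ℕ.* (z₀ ℕ.* (z₀ ℕ.∸ 1))) · x j
  decay-block z₀ x q≤ 0≤x rec ℕ.zero    j≤ = ≤-reflexive (+-identityʳ _)
  decay-block z₀ x q≤ 0≤x rec (ℕ.suc j) j< with decay-block z₀ x q≤ 0≤x rec j (ℕ.<⇒≤ j<) | rec j j< | ∸-suc-view (ℕ.<-≤-trans j< q≤)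
  ... | prev | step | w , eq₁ , eq₂ , _ rewrite eq₁ | eq₂ =
    advance {N = falling₄ s₀ ℕ.* (ℕ.suc w ℕ.* w)} {falling₄ s₀ ℕ.* (w ℕ.* (w ℕ.∸ 1))} {0} {0} {g = 0} (ℕ.suc w) (falling₃ s ℕ.* Z) (w ℕ.∸ 1) 0≤x ≤-refl
      (≤-trans (≤-reflexive (+-identityʳ _)) step)
      (≡.trans (≡.cong (λ f → ℕ.suc w ℕ.* (f ℕ.* Z)) (falling₄-suc s)) (D-eq s (falling₃ s) w Z))
      (κ-eq (falling₃ s) s (w ℕ.∸ 1) Z)
      (ℕ.≤-reflexive (N-eq w (falling₄ s₀) (w ℕ.∸ 1)))
      (ℕ.≤-trans (ℕ.≤-reflexive (ℕ.*-zeroʳ (ℕ.suc w))) ℕ.z≤n)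
      prev
    where
    s = j ℕ.+ s₀
    Z = z₀ ℕ.* (z₀ ℕ.∸ 1)
    N-eq : ∀ w F A → ℕ.suc w ℕ.* (F ℕ.* (w ℕ.* A)) ≡ A ℕ.* (F ℕ.* (ℕ.suc w ℕ.* w))
    N-eq = solve-∀

  -- Apart from the telescoping ratio of `falling₂`, each step moves `x` towards `y` with weight one
  -- over the number of choices left; after `j` steps `x 0` keeps `(z₀ - j) / z₀` and `y` has
  -- `j / z₀`. For `y` this is a lower bound, obtained by replacing `falling₂ s` by the smaller
  -- `falling₂ s₀`.
  average-block : ∀ z₀ (x : ℕ → Carrier) y → q ℕ.≤ z₀ → 0# ≤ x 0 → 0# ≤ y →
    (∀ j → j ℕ.< q → ((2 ℕ.+ (j ℕ.+ s₀)) ℕ.* (z₀ ℕ.∸ j ℕ.∸ 1)) · x j + (2 ℕ.+ (j ℕ.+ s₀)) · y ≤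
                     ((4 ℕ.+ (j ℕ.+ s₀)) ℕ.* (z₀ ℕ.∸ j)) · x (ℕ.suc j)) →
    ∀ j → j ℕ.≤ q →
    (falling₂ s₀ ℕ.* (z₀ ℕ.∸ j)) · x 0 + (falling₂ s₀ ℕ.* j) · y ≤ (falling₂ (j ℕ.+ s₀) ℕ.* z₀) · x j
  average-block z₀ x y q≤ 0≤x 0≤y rec ℕ.zero    j≤ =
    ≤-reflexive (trans (+-congˡ (·-congˡ {k = 0} (ℕ.*-zeroʳ (falling₂ s₀)))) (+-identityʳ _))
  average-block z₀ x y q≤ 0≤x 0≤y rec (ℕ.suc j) j< with average-block z₀ x y q≤ 0≤x 0≤y rec j (ℕ.<⇒≤ j<) | rec j j< | ∸-suc-view (ℕ.<-≤-trans j< q≤)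
  ... | prev | step | w , eq₁ , eq₂ , eq₃ rewrite eq₁ | eq₂ =
    advance {N = falling₂ s₀ ℕ.* ℕ.suc w} {falling₂ s₀ ℕ.* w} {falling₂ s₀ ℕ.* j} {falling₂ s₀ ℕ.* ℕ.suc j} {g = 2 ℕ.+ s} (ℕ.suc w) ((3 ℕ.+ s) ℕ.* z₀) w 0≤x 0≤y step
      (D-eq s (3 ℕ.+ s) w z₀)
      (κ-eq (3 ℕ.+ s) (2 ℕ.+ s) w z₀)
      (ℕ.≤-reflexive (swap₃ w (falling₂ s₀) w))
      G-ineq prev
    where
    s = j ℕ.+ s₀
    G-eq : ∀ w F j → ℕ.suc w ℕ.* (F ℕ.* ℕ.suc j) ≡ w ℕ.* (F ℕ.* j) ℕ.+ F ℕ.* ℕ.suc (w ℕ.+ j)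
    G-eq = solve-∀
    κg-eq : ∀ s z → (3 ℕ.+ s) ℕ.* z ℕ.* (2 ℕ.+ s) ≡ (3 ℕ.+ s) ℕ.* (2 ℕ.+ s) ℕ.* z
    κg-eq = solve-∀
    G-ineq : ℕ.suc w ℕ.* (falling₂ s₀ ℕ.* ℕ.suc j) ℕ.≤ w ℕ.* (falling₂ s₀ ℕ.* j) ℕ.+ (3 ℕ.+ s) ℕ.* z₀ ℕ.* (2 ℕ.+ s)
    G-ineq = ℕ.≤-trans (ℕ.≤-reflexive (G-eq w (falling₂ s₀) j)) (ℕ.+-monoʳ-≤ (w ℕ.* (falling₂ s₀ ℕ.* j))
      (ℕ.≤-trans (ℕ.*-mono-≤ (falling₂-mono (ℕ.m≤n+m s₀ j)) (ℕ.≤-reflexive (≡.sym eq₃))) (ℕ.≤-reflexive (≡.sym (κg-eq s z₀)))))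

  -- The contribution of `y` in one step has the factor `falling₃ s * z₀`. Lowering it to
  -- `falling₃ s₀ * (z₀ ∸ j)` lets the coefficient of `y` keep its form from step to step.
  c-block : ∀ z₀ (x : ℕ → Carrier) y → q ℕ.≤ z₀ → 0# ≤ x 0 → 0# ≤ y →
    (∀ j → j ℕ.< q → ((j ℕ.+ s₀) ℕ.* (z₀ ℕ.∸ j ℕ.∸ 1)) · x j + (2 ℕ.* (z₀ ℕ.∸ j ℕ.∸ 1)) · y ≤
                     ((4 ℕ.+ (j ℕ.+ s₀)) ℕ.* (z₀ ℕ.∸ j)) · x (ℕ.suc j)) →
    ∀ j → j ℕ.≤ q →
    (falling₄ s₀ ℕ.* (z₀ ℕ.∸ j)) · x 0 + (2 ℕ.* j ℕ.* falling₃ s₀ ℕ.* (z₀ ℕ.∸ j)) · y ≤ (falling₄ (j ℕ.+ s₀) ℕ.* z₀) · x j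
  c-block z₀ x y q≤ 0≤x 0≤y rec ℕ.zero    j≤ = ≤-reflexive (+-identityʳ _)
  c-block z₀ x y q≤ 0≤x 0≤y rec (ℕ.suc j) j< with c-block z₀ x y q≤ 0≤x 0≤y rec j (ℕ.<⇒≤ j<) | rec j j< | ∸-suc-view (ℕ.<-≤-trans j< q≤)
  ... | prev | step | w , eq₁ , eq₂ , eq₃ rewrite eq₁ | eq₂ =
    advance {N = falling₄ s₀ ℕ.* ℕ.suc w} {falling₄ s₀ ℕ.* w} {2 ℕ.* j ℕ.* falling₃ s₀ ℕ.* ℕ.suc w} {2 ℕ.* ℕ.suc j ℕ.* falling₃ s₀ ℕ.* w} {g = 2 ℕ.* w} (ℕ.suc w) (falling₃ s ℕ.* z₀) w 0≤x 0≤y step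
      (≡.trans (≡.cong (λ f → ℕ.suc w ℕ.* (f ℕ.* z₀)) (falling₄-suc s)) (D-eq s (falling₃ s) w z₀))
      (κ-eq (falling₃ s) s w z₀)
      (ℕ.≤-reflexive (swap₃ w (falling₄ s₀) w))
      G-ineq prev
    where
    s = j ℕ.+ s₀
    G-eq : ∀ w F j → ℕ.suc w ℕ.* (2 ℕ.* ℕ.suc j ℕ.* F ℕ.* w) ≡ w ℕ.* (2 ℕ.* j ℕ.* F ℕ.* ℕ.suc w) ℕ.+ F ℕ.* ℕ.suc w ℕ.* (2 ℕ.* w)
    G-eq = solve-∀
    G-ineq : ℕ.suc w ℕ.* (2 ℕ.* ℕ.suc j ℕ.* falling₃ s₀ ℕ.* w) ℕ.≤
             w ℕ.* (2 ℕ.* j ℕ.* falling₃ s₀ ℕ.* ℕ.suc w) ℕ.+ falling₃ s ℕ.* z₀ ℕ.* (2 ℕ.* w)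
    G-ineq = ℕ.≤-trans (ℕ.≤-reflexive (G-eq w (falling₃ s₀) j)) (ℕ.+-monoʳ-≤ (w ℕ.* (2 ℕ.* j ℕ.* falling₃ s₀ ℕ.* ℕ.suc w))
      (ℕ.*-monoˡ-≤ (2 ℕ.* w) (ℕ.*-mono-≤ (falling₃-mono (ℕ.m≤n+m s₀ j)) (ℕ.≤-trans (ℕ.s≤s (ℕ.m≤m+n w j)) (ℕ.≤-reflexive (≡.sym eq₃))))))

  b-block : ∀ (x : ℕ → Carrier) y → 0# ≤ x 0 → 0# ≤ y →
    (∀ j → j ℕ.< q → (2 ℕ.+ (j ℕ.+ s₀)) · x j + 2 · y ≤ (4 ℕ.+ (j ℕ.+ s₀)) · x (ℕ.suc j)) →
    ∀ j → j ℕ.≤ q →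
    falling₂ s₀ · x 0 + (2 ℕ.* j ℕ.* (3 ℕ.+ s₀)) · y ≤ falling₂ (j ℕ.+ s₀) · x j
  b-block x y 0≤x 0≤y rec ℕ.zero    j≤ = ≤-reflexive (+-identityʳ _)
  b-block x y 0≤x 0≤y rec (ℕ.suc j) j< =
    advance {N = falling₂ s₀} {falling₂ s₀} {2 ℕ.* j ℕ.* (3 ℕ.+ s₀)} {2 ℕ.* ℕ.suc j ℕ.* (3 ℕ.+ s₀)} {p = 4 ℕ.+ s} {r = 2 ℕ.+ s} {g = 2} 1 (3 ℕ.+ s) 1 0≤x 0≤y (rec j j<) (D s) (κ s) ℕ.≤-refl G-ineq
      (b-block x y 0≤x 0≤y rec j (ℕ.<⇒≤ j<))
    where
    s = j ℕ.+ s₀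
    D : ∀ s → 1 ℕ.* ((4 ℕ.+ s) ℕ.* (3 ℕ.+ s)) ≡ (3 ℕ.+ s) ℕ.* (4 ℕ.+ s)
    D = solve-∀
    κ : ∀ s → (3 ℕ.+ s) ℕ.* (2 ℕ.+ s) ≡ 1 ℕ.* ((3 ℕ.+ s) ℕ.* (2 ℕ.+ s))
    κ = solve-∀
    G-eq : ∀ u j → 1 ℕ.* (2 ℕ.* ℕ.suc j ℕ.* u) ≡ 1 ℕ.* (2 ℕ.* j ℕ.* u) ℕ.+ u ℕ.* 2
    G-eq = solve-∀
    G-ineq = ℕ.≤-trans (ℕ.≤-reflexive (G-eq (3 ℕ.+ s₀) j))
      (ℕ.+-monoʳ-≤ (1 ℕ.* (2 ℕ.* j ℕ.* (3 ℕ.+ s₀))) (ℕ.*-monoˡ-≤ 2 (ℕ.+-monoʳ-≤ 3 (ℕ.m≤n+m s₀ j))))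

  e-block : ∀ (x : ℕ → Carrier) y → 0# ≤ x 0 → 0# ≤ y →
    (∀ j → j ℕ.< q → (j ℕ.+ s₀) · x j + 4 · y ≤ (4 ℕ.+ (j ℕ.+ s₀)) · x (ℕ.suc j)) →
    ∀ j → j ℕ.≤ q →
    falling₄ s₀ · x 0 + (4 ℕ.* j ℕ.* falling₃ s₀) · y ≤ falling₄ (j ℕ.+ s₀) · x j
  e-block x y 0≤x 0≤y rec ℕ.zero    j≤ = ≤-reflexive (+-identityʳ _)
  e-block x y 0≤x 0≤y rec (ℕ.suc j) j< =
    advance {N = falling₄ s₀} {falling₄ s₀} {4 ℕ.* j ℕ.* falling₃ s₀} {4 ℕ.* ℕ.suc j ℕ.* falling₃ s₀} {p = 4 ℕ.+ s} {r = s} {g = 4} 1 (falling₃ s) 1 0≤x 0≤y (rec j j<)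
      (≡.trans (ℕ.*-identityˡ (falling₄ (ℕ.suc s))) (≡.trans (falling₄-suc s) (ℕ.*-comm (4 ℕ.+ s) (falling₃ s))))
      (≡.sym (ℕ.*-identityˡ (falling₄ s))) ℕ.≤-refl G-ineq
      (e-block x y 0≤x 0≤y rec j (ℕ.<⇒≤ j<))
    where
    s = j ℕ.+ s₀
    G-eq : ∀ u j → 1 ℕ.* (4 ℕ.* ℕ.suc j ℕ.* u) ≡ 1 ℕ.* (4 ℕ.* j ℕ.* u) ℕ.+ u ℕ.* 4
    G-eq = solve-∀
    G-ineq = ℕ.≤-trans (ℕ.≤-reflexive (G-eq (falling₃ s₀) j))
      (ℕ.+-monoʳ-≤ (1 ℕ.* (4 ℕ.* j ℕ.* falling₃ s₀)) (ℕ.*-monoˡ-≤ 4 (falling₃-mono (ℕ.m≤n+m s₀ j))))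

-- A block of q arrivals starting at time 3 + s is compared with the single step from 3 + i to 4 + i.
module BlockRatios (q i s : ℕ) .{{_ : ℕ.NonZero q}} (i≤s : (3 ℕ.+ i) ℕ.* q ℕ.≤ 3 ℕ.+ s) where

  ratio-pred : ∀ x y → ℕ.suc x ℕ.* q ℕ.≤ ℕ.suc y → x ℕ.* q ℕ.≤ y
  ratio-pred x y le = ℕ.s≤s⁻¹ (ℕ.≤-trans (ℕ.+-monoˡ-≤ (x ℕ.* q) (ℕ.>-nonZero⁻¹ q)) le)

  -- In fractions, `x / (1 + x) ≤ y / (q + y)`: a time `y` of at least `x` blocks loses no more over
  -- `q` arrivals than the time `x` does over one.
  ratio : ∀ x y → x ℕ.* q ℕ.≤ y → x ℕ.* (q ℕ.+ y) ℕ.≤ ℕ.suc x ℕ.* y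
  ratio x y le = ℕ.≤-trans (ℕ.≤-reflexive (ℕ.*-distribˡ-+ x q y)) (ℕ.+-monoˡ-≤ (x ℕ.* y) le)

  shifted : ∀ r → r ℕ.+ (q ℕ.+ s) ≡ q ℕ.+ (r ℕ.+ s)
  shifted r = ≡.trans (≡.sym (ℕ.+-assoc r q s)) (≡.trans (≡.cong (ℕ._+ s) (ℕ.+-comm r q)) (ℕ.+-assoc q r s))

  ratio-at : ∀ r → (r ℕ.+ i) ℕ.* q ℕ.≤ r ℕ.+ s → (r ℕ.+ i) ℕ.* (r ℕ.+ (q ℕ.+ s)) ℕ.≤ ℕ.suc (r ℕ.+ i) ℕ.* (r ℕ.+ s)
  ratio-at r le = ≡.subst (λ v → (r ℕ.+ i) ℕ.* v ℕ.≤ ℕ.suc (r ℕ.+ i) ℕ.* (r ℕ.+ s)) (≡.sym (shifted r)) (ratio (r ℕ.+ i) (r ℕ.+ s) le)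

  i₂ : (2 ℕ.+ i) ℕ.* q ℕ.≤ 2 ℕ.+ s
  i₂ = ratio-pred (2 ℕ.+ i) (2 ℕ.+ s) i≤s
  i₁ : (1 ℕ.+ i) ℕ.* q ℕ.≤ 1 ℕ.+ s
  i₁ = ratio-pred (1 ℕ.+ i) (1 ℕ.+ s) i₂
  i₀ : i ℕ.* q ℕ.≤ s
  i₀ = ratio-pred i s i₁

  -- The product of `c₁ / c₂ ≤ A′ / A` and `c₀ / c₁ ≤ B′ / B`; `c₁` serves as a link, so the coarse
  -- factors telescope as well.
  chain : ∀ c₀ c₁ c₂ A A′ B B′ → c₁ ℕ.* A ℕ.≤ c₂ ℕ.* A′ → c₀ ℕ.* B ℕ.≤ c₁ ℕ.* B′ →
    c₀ ℕ.* (A ℕ.* B) ℕ.≤ c₂ ℕ.* (A′ ℕ.* B′)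
  chain c₀ c₁ c₂ A A′ B B′ p q = begin
    c₀ ℕ.* (A ℕ.* B)    ≡⟨ rotate c₀ A B ⟩
    A ℕ.* (c₀ ℕ.* B)    ≤⟨ ℕ.*-monoʳ-≤ A q ⟩
    A ℕ.* (c₁ ℕ.* B′)   ≡⟨ rotate₂ A c₁ B′ ⟩
    (c₁ ℕ.* A) ℕ.* B′   ≤⟨ ℕ.*-monoˡ-≤ B′ p ⟩
    (c₂ ℕ.* A′) ℕ.* B′  ≡⟨ ℕ.*-assoc c₂ A′ B′ ⟩
    c₂ ℕ.* (A′ ℕ.* B′)  ∎
    where
    open ℕ.≤-Reasoning
    rotate : ∀ c A B → c ℕ.* (A ℕ.* B) ≡ A ℕ.* (c ℕ.* B)
    rotate = solve-∀
    rotate₂ : ∀ A c B → A ℕ.* (c ℕ.* B) ≡ (c ℕ.* A) ℕ.* B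
    rotate₂ = solve-∀

  falling₂-ratio : (2 ℕ.+ i) ℕ.* falling₂ (q ℕ.+ s) ℕ.≤ (4 ℕ.+ i) ℕ.* falling₂ s
  falling₂-ratio = chain (2 ℕ.+ i) (3 ℕ.+ i) (4 ℕ.+ i) (3 ℕ.+ (q ℕ.+ s)) (3 ℕ.+ s) (2 ℕ.+ (q ℕ.+ s)) (2 ℕ.+ s) (ratio-at 3 i≤s) (ratio-at 2 i₂)

  falling₃-ratio : (1 ℕ.+ i) ℕ.* falling₃ (q ℕ.+ s) ℕ.≤ (4 ℕ.+ i) ℕ.* falling₃ s
  falling₃-ratio = chain (1 ℕ.+ i) (2 ℕ.+ i) (4 ℕ.+ i) (falling₂ (q ℕ.+ s)) (falling₂ s) (1 ℕ.+ (q ℕ.+ s)) (1 ℕ.+ s) falling₂-ratio (ratio-at 1 i₁)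

  falling₄-ratio : i ℕ.* falling₄ (q ℕ.+ s) ℕ.≤ (4 ℕ.+ i) ℕ.* falling₄ s
  falling₄-ratio = chain i (1 ℕ.+ i) (4 ℕ.+ i) (falling₃ (q ℕ.+ s)) (falling₃ s) (q ℕ.+ s) s falling₃-ratio (ratio-at 0 i₀)

  z-ratio : ∀ Z → (Z ℕ.∸ 1) ℕ.* (q ℕ.* Z) ≡ Z ℕ.* (q ℕ.* Z ℕ.∸ q)
  z-ratio Z = begin
    (Z ℕ.∸ 1) ℕ.* (q ℕ.* Z)         ≡⟨ swap (Z ℕ.∸ 1) q Z ⟩
    Z ℕ.* (q ℕ.* (Z ℕ.∸ 1))         ≡⟨ ≡.cong (Z ℕ.*_) (ℕ.*-distribˡ-∸ q Z 1) ⟩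
    Z ℕ.* (q ℕ.* Z ℕ.∸ q ℕ.* 1)     ≡⟨ ≡.cong (λ r → Z ℕ.* (q ℕ.* Z ℕ.∸ r)) (ℕ.*-identityʳ q) ⟩
    Z ℕ.* (q ℕ.* Z ℕ.∸ q)           ∎
    where
    open ≡.≡-Reasoning
    swap : ∀ A q Z → A ℕ.* (q ℕ.* Z) ≡ Z ℕ.* (q ℕ.* A)
    swap = solve-∀

  -- With `z = q * Z`, one factor is the equality `z-ratio`. The other is `(Z - 2) / (Z - 1) ≤ (z -
  -- q - 1) / (z - 1)`, which amounts to `1 ≤ q` after cross-multiplication when `Z` is at least 2.
  z-ratio₂ : ∀ Z → (Z ℕ.∸ 2) ℕ.* (q ℕ.* Z ℕ.* (q ℕ.* Z ℕ.∸ 1)) ℕ.≤ Z ℕ.* ((q ℕ.* Z ℕ.∸ q) ℕ.* (q ℕ.* Z ℕ.∸ q ℕ.∸ 1))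
  z-ratio₂ Z = chain (Z ℕ.∸ 2) (Z ℕ.∸ 1) Z z (z ℕ.∸ q) (z ℕ.∸ 1) (z ℕ.∸ q ℕ.∸ 1) (ℕ.≤-reflexive (z-ratio Z)) (begin
    (Z ℕ.∸ 2) ℕ.* (z ℕ.∸ 1)                                     ≡⟨ ℕ.*-distribˡ-∸ (Z ℕ.∸ 2) z 1 ⟩
    (Z ℕ.∸ 2) ℕ.* z ℕ.∸ (Z ℕ.∸ 2) ℕ.* 1                         ≤⟨ bound Z ⟩
    (Z ℕ.∸ 1) ℕ.* (z ℕ.∸ q) ℕ.∸ (Z ℕ.∸ 1) ℕ.* 1                 ≡⟨ ℕ.*-distribˡ-∸ (Z ℕ.∸ 1) (z ℕ.∸ q) 1 ⟨
    (Z ℕ.∸ 1) ℕ.* (z ℕ.∸ q ℕ.∸ 1)                               ∎)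
    where
    open ℕ.≤-Reasoning
    z = q ℕ.* Z
    expand : ∀ q W → (1 ℕ.+ W) ℕ.* (q ℕ.* (1 ℕ.+ W)) ≡ W ℕ.* (q ℕ.* (2 ℕ.+ W)) ℕ.+ q
    expand = solve-∀
    q*suc∸q : ∀ W → q ℕ.* ℕ.suc W ℕ.∸ q ≡ q ℕ.* W
    q*suc∸q W = ≡.trans (≡.cong (ℕ._∸ q) (ℕ.*-suc q W)) (ℕ.m+n∸m≡n q (q ℕ.* W))
    bound : ∀ Z → (Z ℕ.∸ 2) ℕ.* (q ℕ.* Z) ℕ.∸ (Z ℕ.∸ 2) ℕ.* 1 ℕ.≤ (Z ℕ.∸ 1) ℕ.* (q ℕ.* Z ℕ.∸ q) ℕ.∸ (Z ℕ.∸ 1) ℕ.* 1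
    bound ℕ.zero          = ℕ.z≤n
    bound (ℕ.suc ℕ.zero)    = ℕ.z≤n
    bound (ℕ.suc (ℕ.suc W)) rewrite q*suc∸q (ℕ.suc W) | ℕ.*-identityʳ W = begin
      W ℕ.* (q ℕ.* (2 ℕ.+ W)) ℕ.∸ W                    ≡⟨ ℕ.[m+n]∸[m+o]≡n∸o 1 (W ℕ.* (q ℕ.* (2 ℕ.+ W))) W ⟨
      ℕ.suc (W ℕ.* (q ℕ.* (2 ℕ.+ W))) ℕ.∸ ℕ.suc W          ≤⟨ ℕ.∸-monoˡ-≤ (ℕ.suc W) (ℕ.≤-trans
        (ℕ.≤-trans (ℕ.≤-reflexive (ℕ.+-comm 1 _)) (ℕ.+-monoʳ-≤ (W ℕ.* (q ℕ.* (2 ℕ.+ W))) (ℕ.>-nonZero⁻¹ q)))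
        (ℕ.≤-reflexive (≡.sym (expand q W)))) ⟩
      ℕ.suc W ℕ.* (q ℕ.* ℕ.suc W) ℕ.∸ ℕ.suc W                ∎

  module _ (s≤i : 3 ℕ.+ s ℕ.≤ (4 ℕ.+ i) ℕ.* q) where

    private
      j = 4 ℕ.+ i

    s≤jq : s ℕ.≤ q ℕ.* j
    s≤jq = ℕ.≤-trans (ℕ.m≤n+m s 3) (ℕ.≤-trans s≤i (ℕ.≤-reflexive (ℕ.*-comm j q)))

    -- This and the next bound serve the terms that are added rather than carried over. For `b`, a
    -- block adds a share of about `2 * q / (2 + s)`, which is at least the coarse `2 / j` because
    -- the time is at most `j * q`.
    falling₂-≤ : falling₂ s ℕ.≤ j ℕ.* (q ℕ.* (3 ℕ.+ s))
    falling₂-≤ = ℕ.≤-trans (ℕ.*-monoʳ-≤ (3 ℕ.+ s) (ℕ.≤-trans (ℕ.n≤1+n (2 ℕ.+ s)) s≤i)) (ℕ.≤-reflexive (swap (3 ℕ.+ s) j q))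
      where
      swap : ∀ u j q → u ℕ.* (j ℕ.* q) ≡ j ℕ.* (q ℕ.* u)
      swap = solve-∀

    falling₄-≤ : falling₄ s ℕ.≤ j ℕ.* (q ℕ.* falling₃ s)
    falling₄-≤ = ℕ.≤-trans (ℕ.*-monoʳ-≤ (falling₃ s) s≤jq) (ℕ.≤-reflexive (swap (falling₃ s) q j))
      where
      swap : ∀ f q j → f ℕ.* (q ℕ.* j) ≡ j ℕ.* (q ℕ.* f)
      swap = solve-∀

    d-coefficient : ∀ Z → falling₄ (q ℕ.+ s) ℕ.* (q ℕ.* Z ℕ.* (q ℕ.* Z ℕ.∸ 1)) ℕ.* (i ℕ.* (Z ℕ.∸ 2)) ℕ.≤
      j ℕ.* Z ℕ.* (falling₄ s ℕ.* ((q ℕ.* Z ℕ.∸ q) ℕ.* (q ℕ.* Z ℕ.∸ q ℕ.∸ 1)))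
    d-coefficient Z = ℕ.≤-trans (ℕ.≤-reflexive (regroup (falling₄ (q ℕ.+ s)) (q ℕ.* Z ℕ.* (q ℕ.* Z ℕ.∸ 1)) i (Z ℕ.∸ 2)))
      (ℕ.≤-trans (ℕ.*-mono-≤ falling₄-ratio (z-ratio₂ Z)) (ℕ.≤-reflexive (regroup′ j (falling₄ s) Z ((q ℕ.* Z ℕ.∸ q) ℕ.* (q ℕ.* Z ℕ.∸ q ℕ.∸ 1)))))
      where
      regroup : ∀ f z i Z → f ℕ.* z ℕ.* (i ℕ.* Z) ≡ (i ℕ.* f) ℕ.* (Z ℕ.* z)
      regroup = solve-∀
      regroup′ : ∀ j f Z z → (j ℕ.* f) ℕ.* (Z ℕ.* z) ≡ j ℕ.* Z ℕ.* (f ℕ.* z)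
      regroup′ = solve-∀

    a-coefficient : ∀ Z → falling₂ (q ℕ.+ s) ℕ.* (q ℕ.* Z) ℕ.* ((2 ℕ.+ i) ℕ.* (Z ℕ.∸ 1)) ℕ.≤
      j ℕ.* Z ℕ.* (falling₂ s ℕ.* (q ℕ.* Z ℕ.∸ q))
    a-coefficient Z = ℕ.≤-trans (ℕ.≤-reflexive (regroup (falling₂ (q ℕ.+ s)) (q ℕ.* Z) (2 ℕ.+ i) (Z ℕ.∸ 1)))
      (ℕ.≤-trans (ℕ.*-mono-≤ falling₂-ratio (ℕ.≤-reflexive (z-ratio Z))) (ℕ.≤-reflexive (regroup′ j (falling₂ s) Z (q ℕ.* Z ℕ.∸ q))))
      where
      regroup : ∀ f z i Z → f ℕ.* z ℕ.* (i ℕ.* Z) ≡ (i ℕ.* f) ℕ.* (Z ℕ.* z)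
      regroup = solve-∀
      regroup′ : ∀ j f Z z → (j ℕ.* f) ℕ.* (Z ℕ.* z) ≡ j ℕ.* Z ℕ.* (f ℕ.* z)
      regroup′ = solve-∀

    a-coefficient-c : ∀ Z → falling₂ (q ℕ.+ s) ℕ.* (q ℕ.* Z) ℕ.* (2 ℕ.+ i) ℕ.≤ j ℕ.* Z ℕ.* (falling₂ s ℕ.* q)
    a-coefficient-c Z = ℕ.≤-trans (ℕ.≤-reflexive (regroup (falling₂ (q ℕ.+ s)) (q ℕ.* Z) (2 ℕ.+ i)))
      (ℕ.≤-trans (ℕ.*-monoˡ-≤ (q ℕ.* Z) falling₂-ratio) (ℕ.≤-reflexive (regroup′ j (falling₂ s) q Z)))
      where
      regroup : ∀ f z i → f ℕ.* z ℕ.* i ≡ (i ℕ.* f) ℕ.* z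
      regroup = solve-∀
      regroup′ : ∀ j f q Z → (j ℕ.* f) ℕ.* (q ℕ.* Z) ≡ j ℕ.* Z ℕ.* (f ℕ.* q)
      regroup′ = solve-∀

    c-coefficient : ∀ Z → falling₄ (q ℕ.+ s) ℕ.* (q ℕ.* Z) ℕ.* (i ℕ.* (Z ℕ.∸ 1) ℕ.* j) ℕ.≤
      j ℕ.* Z ℕ.* j ℕ.* (falling₄ s ℕ.* (q ℕ.* Z ℕ.∸ q))
    c-coefficient Z = ℕ.≤-trans (ℕ.≤-reflexive (regroup (falling₄ (q ℕ.+ s)) (q ℕ.* Z) i (Z ℕ.∸ 1) j))
      (ℕ.≤-trans (ℕ.*-monoˡ-≤ j (ℕ.*-mono-≤ falling₄-ratio (ℕ.≤-reflexive (z-ratio Z)))) (ℕ.≤-reflexive (regroup′ j (falling₄ s) Z (q ℕ.* Z ℕ.∸ q))))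
      where
      regroup : ∀ f z i Z j → f ℕ.* z ℕ.* (i ℕ.* Z ℕ.* j) ≡ (i ℕ.* f) ℕ.* (Z ℕ.* z) ℕ.* j
      regroup = solve-∀
      regroup′ : ∀ j f Z z → (j ℕ.* f) ℕ.* (Z ℕ.* z) ℕ.* j ≡ j ℕ.* Z ℕ.* j ℕ.* (f ℕ.* z)
      regroup′ = solve-∀

    c-coefficient-d : ∀ Z → falling₄ (q ℕ.+ s) ℕ.* (q ℕ.* Z) ℕ.* (2 ℕ.* i ℕ.* (Z ℕ.∸ 1)) ℕ.≤
      j ℕ.* Z ℕ.* j ℕ.* (2 ℕ.* q ℕ.* falling₃ s ℕ.* (q ℕ.* Z ℕ.∸ q))
    c-coefficient-d Z = ℕ.≤-trans (ℕ.≤-reflexive (regroup (falling₄ (q ℕ.+ s)) (q ℕ.* Z) i (Z ℕ.∸ 1)))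
      (ℕ.≤-trans (ℕ.*-monoˡ-≤ 2 (ℕ.*-mono-≤ (ℕ.≤-trans falling₄-ratio (ℕ.*-monoʳ-≤ j falling₄-≤)) (ℕ.≤-reflexive (z-ratio Z))))
        (ℕ.≤-reflexive (regroup′ j q (falling₃ s) Z (q ℕ.* Z ℕ.∸ q))))
      where
      regroup : ∀ f z i Z → f ℕ.* z ℕ.* (2 ℕ.* i ℕ.* Z) ≡ (i ℕ.* f) ℕ.* (Z ℕ.* z) ℕ.* 2
      regroup = solve-∀
      regroup′ : ∀ j q f Z z → (j ℕ.* (j ℕ.* (q ℕ.* f))) ℕ.* (Z ℕ.* z) ℕ.* 2 ≡ j ℕ.* Z ℕ.* j ℕ.* (2 ℕ.* q ℕ.* f ℕ.* z)
      regroup′ = solve-∀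

    b-coefficient : falling₂ (q ℕ.+ s) ℕ.* ((2 ℕ.+ i) ℕ.* j) ℕ.≤ j ℕ.* j ℕ.* falling₂ s
    b-coefficient = ℕ.≤-trans (ℕ.≤-reflexive (regroup (falling₂ (q ℕ.+ s)) (2 ℕ.+ i) j))
      (ℕ.≤-trans (ℕ.*-monoˡ-≤ j falling₂-ratio) (ℕ.≤-reflexive (regroup′ j (falling₂ s))))
      where
      regroup : ∀ f i j → f ℕ.* (i ℕ.* j) ≡ (i ℕ.* f) ℕ.* j
      regroup = solve-∀
      regroup′ : ∀ j f → (j ℕ.* f) ℕ.* j ≡ j ℕ.* j ℕ.* f
      regroup′ = solve-∀

    b-coefficient-a : falling₂ (q ℕ.+ s) ℕ.* (2 ℕ.* (2 ℕ.+ i)) ℕ.≤ j ℕ.* j ℕ.* (2 ℕ.* q ℕ.* (3 ℕ.+ s))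
    b-coefficient-a = ℕ.≤-trans (ℕ.≤-reflexive (regroup (falling₂ (q ℕ.+ s)) (2 ℕ.+ i)))
      (ℕ.≤-trans (ℕ.*-monoˡ-≤ 2 (ℕ.≤-trans falling₂-ratio (ℕ.*-monoʳ-≤ j falling₂-≤))) (ℕ.≤-reflexive (regroup′ j q (3 ℕ.+ s))))
      where
      regroup : ∀ f i → f ℕ.* (2 ℕ.* i) ≡ (i ℕ.* f) ℕ.* 2
      regroup = solve-∀
      regroup′ : ∀ j q u → (j ℕ.* (j ℕ.* (q ℕ.* u))) ℕ.* 2 ≡ j ℕ.* j ℕ.* (2 ℕ.* q ℕ.* u)
      regroup′ = solve-∀

    e-coefficient : falling₄ (q ℕ.+ s) ℕ.* (i ℕ.* j) ℕ.≤ j ℕ.* j ℕ.* falling₄ s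
    e-coefficient = ℕ.≤-trans (ℕ.≤-reflexive (regroup (falling₄ (q ℕ.+ s)) i j))
      (ℕ.≤-trans (ℕ.*-monoˡ-≤ j falling₄-ratio) (ℕ.≤-reflexive (regroup′ j (falling₄ s))))
      where
      regroup : ∀ f i j → f ℕ.* (i ℕ.* j) ≡ (i ℕ.* f) ℕ.* j
      regroup = solve-∀
      regroup′ : ∀ j f → (j ℕ.* f) ℕ.* j ≡ j ℕ.* j ℕ.* f
      regroup′ = solve-∀

    e-coefficient-c : falling₄ (q ℕ.+ s) ℕ.* (4 ℕ.* i) ℕ.≤ j ℕ.* j ℕ.* (4 ℕ.* q ℕ.* falling₃ s)
    e-coefficient-c = ℕ.≤-trans (ℕ.≤-reflexive (regroup (falling₄ (q ℕ.+ s)) i))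
      (ℕ.≤-trans (ℕ.*-monoˡ-≤ 4 (ℕ.≤-trans falling₄-ratio (ℕ.*-monoʳ-≤ j falling₄-≤))) (ℕ.≤-reflexive (regroup′ j q (falling₃ s))))
      where
      regroup : ∀ f i → f ℕ.* (4 ℕ.* i) ≡ (i ℕ.* f) ℕ.* 4
      regroup = solve-∀
      regroup′ : ∀ j q f → (j ℕ.* (j ℕ.* (q ℕ.* f))) ℕ.* 4 ≡ j ℕ.* j ℕ.* (4 ℕ.* q ℕ.* f)
      regroup′ = solve-∀

-- Estimates at the ends of blocks

module BlockEstimates {ℓ ℓ₁ ℓ₂} (K : OrderedField ℓ ℓ₁ ℓ₂) (σ : ℕ) .{{_ : ℕ.NonZero σ}}
                      (m k : ℕ) (k≤m : k ℕ.≤ m) (q : ℕ) .{{_ : ℕ.NonZero q}} where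

  open OrderedField K hiding (zero)
  open OrderedFieldProperties K
  open Sequences K
  open LinearForms K
  open Estimation K σ
  open Recursion m k k≤m

  0≲ : ∀ {x} → 0# ≤ x → 0 ≲ x
  0≲ 0≤x = bounded (·-nonneg σ 0≤x)

  -- Trades the telescoped coefficients `N / D` and `G / D`, which involve `q`, for the smaller
  -- `R / den` and `H / den`, which do not, and then rounds.
  refine : ∀ {N G D R H} den .{{_ : ℕ.NonZero den}} .{{_ : ℕ.NonZero D}} {x₀ y x₁ x̂ ŷ} → 0# ≤ x₀ → 0# ≤ y →
    x̂ ≲ x₀ → ŷ ≲ y → D ℕ.* R ℕ.≤ den ℕ.* N → D ℕ.* H ℕ.≤ den ℕ.* G →
    N · x₀ + G · y ≤ D · x₁ → (R ℕ.* x̂ ℕ.+ H ℕ.* ŷ) ÷ℕ den ≲ x₁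
  refine {N} {G} {D} {R} {H} den {x₀} {y} {x₁} 0≤x₀ 0≤y x̂≲ ŷ≲ DR DH le =
    ≲-÷ den (≲-≤ (·-cancel-≤ D (begin
      D · (R · x₀ + H · y)                       ≈⟨ ·-linear D R H x₀ y ⟩
      (D ℕ.* R) · x₀ + (D ℕ.* H) · y             ≤⟨ linear-mono 0≤x₀ 0≤y DR DH ⟩
      (den ℕ.* N) · x₀ + (den ℕ.* G) · y         ≈⟨ ·-linear den N G x₀ y ⟨
      den · (N · x₀ + G · y)                     ≤⟨ ·-monoʳ-≤ den le ⟩
      den · (D · x₁)                             ≈⟨ ·-comm-· den D x₁ ⟩
      D · (den · x₁)                             ∎))
      (≲-+ (≲-· R x̂≲) (≲-· H ŷ≲)))
    where open ≤-Reasoning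

  refine₀ : ∀ {N D R} den .{{_ : ℕ.NonZero den}} .{{_ : ℕ.NonZero D}} {x₀ x₁ x̂} → 0# ≤ x₀ →
    x̂ ≲ x₀ → D ℕ.* R ℕ.≤ den ℕ.* N → N · x₀ + 0 · 0# ≤ D · x₁ → (R ℕ.* x̂) ÷ℕ den ≲ x₁
  refine₀ {N} {D} {R} den {x₁ = x₁} {x̂ = x̂} 0≤x₀ x̂≲ DR le =
    ≡.subst (λ r → r ÷ℕ den ≲ x₁) (ℕ.+-identityʳ (R ℕ.* x̂))
      (refine {N} {0} {D} {R} {0} den 0≤x₀ ≤-refl x̂≲ 0≲0 DR (ℕ.≤-trans (ℕ.≤-reflexive (ℕ.*-zeroʳ D)) ℕ.z≤n) le)

  antitone : ∀ (x : ℕ → Carrier) → (∀ j → j ℕ.< q → x (ℕ.suc j) ≤ x j) → ∀ j → j ℕ.≤ q → x q ≤ x j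
  antitone x dec j j≤q = ≡.subst (λ r → x r ≤ x j) (ℕ.m∸n+n≡m j≤q) (go (q ℕ.∸ j) (ℕ.≤-reflexive (ℕ.m∸n+n≡m j≤q)))
    where
    go : ∀ δ → δ ℕ.+ j ℕ.≤ q → x (δ ℕ.+ j) ≤ x j
    go ℕ.zero  _  = ≤-refl
    go (ℕ.suc δ) le = ≤-trans (dec (δ ℕ.+ j) le) (go δ (ℕ.<⇒≤ le))

  -- In each block all `q` gains are at least the value of `b` at its end; hence the estimate of the
  -- gain counts once per block and is multiplied by `q` here.
  record BlockEstimate (u : ℕ) (s : Estimates) : Set ℓ₂ where
    private module E = Estimates s
    field
      a≲ : E.a ≲ a u
      b≲ : E.b ≲ b u
      c≲ : E.c ≲ c u
      d≲ : E.d ≲ d u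
      e≲ : E.e ≲ e u
      g≲ : q ℕ.* E.g ≲ G u

  module Block (i s : ℕ) .{{_ : ℕ.NonZero s}} (i≤s : (3 ℕ.+ i) ℕ.* q ℕ.≤ 3 ℕ.+ s)
               (s≤i : 3 ℕ.+ s ℕ.≤ (4 ℕ.+ i) ℕ.* q) (k≤u : k ℕ.≤ 3 ℕ.+ s)
               (Z : ℕ) .{{_ : ℕ.NonZero Z}} where

    open BlockRatios q i s i≤s
    open BlockSums K q s

    private
      u = 3 ℕ.+ s
      j = 4 ℕ.+ i
      z₀ = q ℕ.* Z
      instance
        falling₄≢0 : ℕ.NonZero (falling₄ (q ℕ.+ s))
        falling₄≢0 = ℕ.m*n≢0 (falling₃ (q ℕ.+ s)) (q ℕ.+ s) {{_}} {{ℕ.>-nonZero (ℕ.<-≤-trans (ℕ.>-nonZero⁻¹ q) (ℕ.m≤m+n q s))}}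
        z₀≢0 : ℕ.NonZero (q ℕ.* Z)
        z₀≢0 = ℕ.m*n≢0 q Z
        jZ≢0 : ℕ.NonZero ((4 ℕ.+ i) ℕ.* Z)
        jZ≢0 = ℕ.m*n≢0 (4 ℕ.+ i) Z
        jZj≢0 : ℕ.NonZero ((4 ℕ.+ i) ℕ.* Z ℕ.* (4 ℕ.+ i))
        jZj≢0 = ℕ.m*n≢0 ((4 ℕ.+ i) ℕ.* Z) (4 ℕ.+ i)

    q≤z₀ : q ℕ.≤ z₀
    q≤z₀ = ℕ.m≤m*n q Z

    time : ∀ r → r ℕ.+ u ≡ 3 ℕ.+ (r ℕ.+ s)
    time r = ≡.trans (≡.sym (ℕ.+-assoc r 3 s)) (≡.trans (≡.cong (ℕ._+ s) (ℕ.+-comm r 3)) (ℕ.+-assoc 3 r s))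

    k≤suc : ∀ r → k ℕ.≤ ℕ.suc (r ℕ.+ u)
    k≤suc r = ℕ.m≤n⇒m≤1+n (ℕ.≤-trans k≤u (ℕ.m≤n+m u r))

    1≤z : ∀ {r} → r ℕ.< q → 1 ℕ.≤ z₀ ℕ.∸ r
    1≤z r<q = ℕ.m<n⇒0<n∸m (ℕ.<-≤-trans r<q q≤z₀)

    z≤ : ∀ {M} → z₀ ℕ.+ u ℕ.≤ M → ∀ r → z₀ ℕ.∸ r ℕ.≤ M ℕ.∸ (r ℕ.+ u)
    z≤ {M} fits r = ℕ.≤-trans (ℕ.≤-reflexive (≡.trans (≡.sym (ℕ.[m+n]∸[m+o]≡n∸o u z₀ r)) (≡.cong₂ ℕ._∸_ (ℕ.+-comm u z₀) (ℕ.+-comm u r))))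
      (ℕ.∸-monoˡ-≤ (r ℕ.+ u) fits)

    t< : ∀ {M} → z₀ ℕ.+ u ℕ.≤ M → ∀ {r} → r ℕ.< q → r ℕ.+ u ℕ.< M
    t< fits r<q = ℕ.<-≤-trans (ℕ.+-monoˡ-< u r<q) (ℕ.≤-trans (ℕ.+-monoˡ-≤ u q≤z₀) fits)

    G-block : ∀ {y} → (∀ r → r ℕ.≤ q → y ≤ b (r ℕ.+ u)) → ∀ r → r ℕ.≤ q → G u + r · y ≤ G (r ℕ.+ u)
    G-block y≤ ℕ.zero  r≤ = ≤-reflexive (+-identityʳ _)
    G-block {y} y≤ (ℕ.suc r) r< = begin
      G u + (y + r · y)        ≈⟨ trans (+-congˡ (+-comm _ _)) (sym (+-assoc _ _ _)) ⟩
      G u + r · y + y          ≤⟨ +-mono-≤ (G-block y≤ r (ℕ.<⇒≤ r<)) (y≤ r (ℕ.<⇒≤ r<)) ⟩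
      G (r ℕ.+ u) + b (r ℕ.+ u) ≡⟨ G-step (k≤suc r) ⟨
      G (ℕ.suc r ℕ.+ u)          ∎
      where open ≤-Reasoning

    module _ (fits₂ : q ℕ.+ u ℕ.≤ 2 ℕ.* m) where

      b-antitone : ∀ r → r ℕ.≤ q → b (q ℕ.+ u) ≤ b (r ℕ.+ u)
      b-antitone = antitone (λ r → b (r ℕ.+ u)) λ r r<q →
        decreasing-b (r ℕ.+ u) (ℕ.<-≤-trans (ℕ.+-monoˡ-< u r<q) fits₂) (k≤suc r)

      g-estimate : ∀ {ĝ b̂} → q ℕ.* ĝ ≲ G u → b̂ ≲ b (q ℕ.+ u) → q ℕ.* (ĝ ℕ.+ b̂) ≲ G (q ℕ.+ u)
      g-estimate {ĝ} {b̂} ĝ≲ b̂≲ = ≡.subst (_≲ G (q ℕ.+ u)) (≡.sym (ℕ.*-distribˡ-+ q ĝ b̂))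
        (≲-≤ (G-block b-antitone q ℕ.≤-refl) (≲-+ ĝ≲ (≲-· q b̂≲)))

    decay-estimate : ∀ (x : ℕ → Carrier) {x̂} → 0# ≤ x 0 → 0# ≤ x q → x̂ ≲ x 0 →
      (∀ r → r ℕ.< q → ((r ℕ.+ s) ℕ.* (z₀ ℕ.∸ r ℕ.∸ 2)) · x r ≤ ((4 ℕ.+ (r ℕ.+ s)) ℕ.* (z₀ ℕ.∸ r)) · x (ℕ.suc r)) →
      (i ℕ.* (Z ℕ.∸ 2) ℕ.* x̂) ÷ℕ (j ℕ.* Z) ≲ x q
    decay-estimate x {x̂} 0≤x₀ 0≤x₁ x̂≲ rec with Z ℕ.≤? 1
    -- With `Z = 1` and `q = 1` the denominator `z₀ * (z₀ ∸ 1)` vanishes; for `Z ≤ 1` the claimed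
    -- bound is 0 anyway.
    ... | yes Z≤1 rewrite ℕ.m≤n⇒m∸n≡0 (ℕ.m≤n⇒m≤1+n Z≤1) | ℕ.*-zeroʳ i =
      ≡.subst (_≲ x q) (≡.sym (0÷ℕ (j ℕ.* Z))) (0≲ 0≤x₁)
      where
      0÷ℕ : ∀ z → 0 ÷ℕ z ≡ 0
      0÷ℕ ℕ.zero  = ≡.refl
      0÷ℕ (ℕ.suc z) = ℕ.0/n≡0 (ℕ.suc z)
    ... | no Z≰1 = refine₀ {falling₄ s ℕ.* ((z₀ ℕ.∸ q) ℕ.* (z₀ ℕ.∸ q ℕ.∸ 1))} {falling₄ (q ℕ.+ s) ℕ.* (z₀ ℕ.* (z₀ ℕ.∸ 1))}
        {i ℕ.* (Z ℕ.∸ 2)} (j ℕ.* Z) {{jZ≢0}} {{D≢0}} 0≤x₀ x̂≲ (d-coefficient s≤i Z)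
        (decay-block z₀ x q≤z₀ 0≤x₀ rec q ℕ.≤-refl)
      where
      2≤z₀ : 2 ℕ.≤ z₀
      2≤z₀ = ℕ.≤-trans (ℕ.≰⇒> Z≰1) (ℕ.m≤n*m Z q)
      D≢0 : ℕ.NonZero (falling₄ (q ℕ.+ s) ℕ.* (z₀ ℕ.* (z₀ ℕ.∸ 1)))
      D≢0 = ℕ.m*n≢0 (falling₄ (q ℕ.+ s)) (z₀ ℕ.* (z₀ ℕ.∸ 1)) {{falling₄≢0}} {{ℕ.m*n≢0 z₀ (z₀ ℕ.∸ 1) {{z₀≢0}} {{ℕ.>-nonZero (ℕ.m<n⇒0<n∸m 2≤z₀)}}}}

    average-estimate : ∀ (x : ℕ → Carrier) {x̂ ŷ y} → 0# ≤ x 0 → 0# ≤ y → x̂ ≲ x 0 → ŷ ≲ y →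
      (∀ r → r ℕ.< q → ((2 ℕ.+ (r ℕ.+ s)) ℕ.* (z₀ ℕ.∸ r ℕ.∸ 1)) · x r + (2 ℕ.+ (r ℕ.+ s)) · y ≤
                       ((4 ℕ.+ (r ℕ.+ s)) ℕ.* (z₀ ℕ.∸ r)) · x (ℕ.suc r)) →
      ((2 ℕ.+ i) ℕ.* (Z ℕ.∸ 1) ℕ.* x̂ ℕ.+ (2 ℕ.+ i) ℕ.* ŷ) ÷ℕ (j ℕ.* Z) ≲ x q
    average-estimate x {y = y} 0≤x₀ 0≤y x̂≲ ŷ≲ rec =
      refine {falling₂ s ℕ.* (z₀ ℕ.∸ q)} {falling₂ s ℕ.* q} {falling₂ (q ℕ.+ s) ℕ.* z₀}
        {(2 ℕ.+ i) ℕ.* (Z ℕ.∸ 1)} {2 ℕ.+ i} (j ℕ.* Z) {{jZ≢0}} {{ℕ.m*n≢0 (falling₂ (q ℕ.+ s)) z₀}}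
        0≤x₀ 0≤y x̂≲ ŷ≲ (a-coefficient s≤i Z) (a-coefficient-c s≤i Z)
        (average-block z₀ x y q≤z₀ 0≤x₀ 0≤y rec q ℕ.≤-refl)

    -- Within a block a recurrence refers to another sequence at varying times. As these sequences
    -- decrease, that reference is replaced by the value at the end of the block. This forces the
    -- order `d′`, `c′`, `a′` and `e′`, `b′`.
    block₁-estimate : z₀ ℕ.+ u ℕ.≤ m → ∀ {est} → BlockEstimate u est →
      BlockEstimate (q ℕ.+ u) (block₁ℕ (3 ℕ.+ i) Z est)
    block₁-estimate fits {estimates a₀ b₀ c₀ d₀ e₀ g₀} be = record
      { a≲ = a′ ; b≲ = b′ ; c≲ = c′ ; d≲ = d′ ; e≲ = e′ ; g≲ = g-estimate fits₂ g≲ b′ }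
      where
      open BlockEstimate be
      fits₁ : q ℕ.+ u ℕ.≤ m
      fits₁ = ℕ.≤-trans (ℕ.+-monoˡ-≤ u q≤z₀) fits
      fits₂ : q ℕ.+ u ℕ.≤ 2 ℕ.* m
      fits₂ = ℕ.≤-trans fits₁ (ℕ.m≤m+n m _)
      0≤x = ordered u (ℕ.≤-trans (ℕ.m≤n+m u q) fits₂)
      0≤y = ordered (q ℕ.+ u) fits₂
      a-antitone : ∀ r → r ℕ.≤ q → a (q ℕ.+ u) ≤ a (r ℕ.+ u)
      a-antitone = antitone (λ r → a (r ℕ.+ u)) λ r r<q → decreasing-a (k≤suc r) (t< fits r<q)
      c-antitone : ∀ r → r ℕ.≤ q → c (q ℕ.+ u) ≤ c (r ℕ.+ u)
      c-antitone = antitone (λ r → c (r ℕ.+ u)) λ r r<q → decreasing-c (k≤suc r) (t< fits r<q)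
      d-antitone : ∀ r → r ℕ.≤ q → d (q ℕ.+ u) ≤ d (r ℕ.+ u)
      d-antitone = antitone (λ r → d (r ℕ.+ u)) λ r r<q → decreasing-d (k≤suc r) (t< fits r<q)

      d′ = decay-estimate (λ r → d (r ℕ.+ u)) (Ordered.0≤d 0≤x) (Ordered.0≤d 0≤y) d≲
        (λ r r<q → recur-d (k≤suc r) (t< fits r<q) (time r) (z₀ ℕ.∸ r) (z≤ fits r))

      c′ = refine {falling₄ s ℕ.* (z₀ ℕ.∸ q)} {2 ℕ.* q ℕ.* falling₃ s ℕ.* (z₀ ℕ.∸ q)} {falling₄ (q ℕ.+ s) ℕ.* z₀}
        {i ℕ.* (Z ℕ.∸ 1) ℕ.* j} {2 ℕ.* i ℕ.* (Z ℕ.∸ 1)} (j ℕ.* Z ℕ.* j) {{jZj≢0}} {{ℕ.m*n≢0 (falling₄ (q ℕ.+ s)) z₀}}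
        (Ordered.0≤c 0≤x) (Ordered.0≤d 0≤y) c≲ d′ (c-coefficient s≤i Z) (c-coefficient-d s≤i Z)
        (c-block z₀ (λ r → c (r ℕ.+ u)) (d (q ℕ.+ u)) q≤z₀ (Ordered.0≤c 0≤x) (Ordered.0≤d 0≤y)
          (λ r r<q → ≤-trans (+-monoʳ-≤ _ (·-monoʳ-≤ (2 ℕ.* (z₀ ℕ.∸ r ℕ.∸ 1)) (d-antitone r (ℕ.<⇒≤ r<q))))
            (recur-c (k≤suc r) (t< fits r<q) (time r) (z₀ ℕ.∸ r) (z≤ fits r))) q ℕ.≤-refl)

      a′ = average-estimate (λ r → a (r ℕ.+ u)) (Ordered.0≤a 0≤x) (Ordered.0≤c 0≤y) a≲ c′
        (λ r r<q → ≤-trans (+-monoʳ-≤ _ (·-monoʳ-≤ (2 ℕ.+ (r ℕ.+ s)) (c-antitone r (ℕ.<⇒≤ r<q))))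
          (recur-a (k≤suc r) (t< fits r<q) (time r) (z₀ ℕ.∸ r) (1≤z r<q) (z≤ fits r)))

      e′ = refine {falling₄ s} {4 ℕ.* q ℕ.* falling₃ s} {falling₄ (q ℕ.+ s)} {i ℕ.* j} {4 ℕ.* i} (j ℕ.* j)
        (Ordered.0≤e 0≤x) (Ordered.0≤c 0≤y) e≲ c′ (e-coefficient s≤i) (e-coefficient-c s≤i)
        (e-block (λ r → e (r ℕ.+ u)) (c (q ℕ.+ u)) (Ordered.0≤e 0≤x) (Ordered.0≤c 0≤y)
          (λ r r<q → ≤-trans (+-monoʳ-≤ _ (·-monoʳ-≤ 4 (c-antitone r (ℕ.<⇒≤ r<q))))
            (recur-e (k≤suc r) (t< fits r<q) (time r))) q ℕ.≤-refl)

      b′ = refine {falling₂ s} {2 ℕ.* q ℕ.* (3 ℕ.+ s)} {falling₂ (q ℕ.+ s)} {(2 ℕ.+ i) ℕ.* j} {2 ℕ.* (2 ℕ.+ i)} (j ℕ.* j)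
        (Ordered.0≤b 0≤x) (Ordered.0≤a 0≤y) b≲ a′ (b-coefficient s≤i) (b-coefficient-a s≤i)
        (b-block (λ r → b (r ℕ.+ u)) (a (q ℕ.+ u)) (Ordered.0≤b 0≤x) (Ordered.0≤a 0≤y)
          (λ r r<q → ≤-trans (+-monoʳ-≤ _ (·-monoʳ-≤ 2 (a-antitone r (ℕ.<⇒≤ r<q))))
            (recur-b (k≤suc r) (t< fits r<q) (time r))) q ℕ.≤-refl)

    -- The block may start before time `m`, because `2 * p` blocks can end earlier than that;
    -- `recur-b₂` and `recur-e₂` hold there too.
    block₂-estimate : z₀ ℕ.+ u ℕ.≤ 2 ℕ.* m → ∀ {est} → BlockEstimate u est →
      BlockEstimate (q ℕ.+ u) (block₂ℕ (3 ℕ.+ i) Z est)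
    block₂-estimate fits {estimates a₀ b₀ c₀ d₀ e₀ g₀} be = record
      { a≲ = 0≲ (Ordered.0≤a 0≤y) ; b≲ = b′ ; c≲ = 0≲ (Ordered.0≤c 0≤y) ; d≲ = 0≲ (Ordered.0≤d 0≤y)
      ; e≲ = e′ ; g≲ = g-estimate fits₂ g≲ b′ }
      where
      open BlockEstimate be
      fits₂ : q ℕ.+ u ℕ.≤ 2 ℕ.* m
      fits₂ = ℕ.≤-trans (ℕ.+-monoˡ-≤ u q≤z₀) fits
      0≤x = ordered u (ℕ.≤-trans (ℕ.m≤n+m u q) fits₂)
      0≤y = ordered (q ℕ.+ u) fits₂
      e-antitone : ∀ r → r ℕ.≤ q → e (q ℕ.+ u) ≤ e (r ℕ.+ u)
      e-antitone = antitone (λ r → e (r ℕ.+ u)) λ r r<q →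
        decreasing-e (r ℕ.+ u) (ℕ.<-≤-trans (ℕ.+-monoˡ-< u r<q) fits₂) (k≤suc r)

      e′ = decay-estimate (λ r → e (r ℕ.+ u)) (Ordered.0≤e 0≤x) (Ordered.0≤e 0≤y) e≲
        (λ r r<q → recur-e₂ (k≤suc r) (t< fits r<q) (time r) (z₀ ℕ.∸ r) (z≤ fits r))

      b′ = average-estimate (λ r → b (r ℕ.+ u)) (Ordered.0≤b 0≤x) (Ordered.0≤e 0≤y) b≲ e′
        (λ r r<q → ≤-trans (+-monoʳ-≤ _ (·-monoʳ-≤ (2 ℕ.+ (r ℕ.+ s)) (e-antitone r (ℕ.<⇒≤ r<q))))
          (recur-b₂ (k≤suc r) (t< fits r<q) (time r) (z₀ ℕ.∸ r) (1≤z r<q) (z≤ fits r)))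

-- From exploration to the first exploitation step

module Start {ℓ ℓ₁ ℓ₂} (K : OrderedField ℓ ℓ₁ ℓ₂) (m k : ℕ) (k≤m : k ℕ.≤ m) where

  open OrderedField K hiding (zero)
  open OrderedFieldProperties K
  open Sequences K
  open LinearForms K
  open Recursion m k k≤m

  propagate : ∀ M z w A A′ .{{_ : ℕ.NonZero z}} {x x′} → A · 1# ≤ M · x → w · x ≤ z · x′ →
    z ℕ.* A′ ℕ.≤ w ℕ.* A → A′ · 1# ≤ M · x′
  propagate M z w A A′ {x} {x′} A≤ w≤ arith = ·-cancel-≤ z (begin
    z · (A′ · 1#)     ≈⟨ ×-assocˡ 1# z A′ ⟩
    (z ℕ.* A′) · 1#   ≤⟨ ·-monoˡ-≤ 0≤1 arith ⟩
    (w ℕ.* A) · 1#    ≈⟨ ×-assocˡ 1# w A ⟨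
    w · (A · 1#)      ≤⟨ ·-monoʳ-≤ w A≤ ⟩
    w · (M · x)       ≈⟨ ·-comm-· w M x ⟩
    M · (w · x)       ≤⟨ ·-monoʳ-≤ M w≤ ⟩
    M · (z · x′)      ≈⟨ ·-comm-· M z x′ ⟩
    z · (M · x′)      ∎)
    where open ≤-Reasoning

  record Explored (t : ℕ) : Set ℓ₂ where
    field
      a≥ : (m ℕ.∸ t) · 1# ≤ m · a t
      b≥ : 1# ≤ b t
      c≥ : (m ℕ.∸ t) · 1# ≤ m · c t
      d≥ : ((m ℕ.∸ t) ℕ.* (m ℕ.∸ t ℕ.∸ 1)) · 1# ≤ (m ℕ.* (m ℕ.∸ 1)) · d t
      e≥ : 1# ≤ e t

  -- With `z = m ∸ t` the factors `(z - 1) / z` telescope to `(m - t) / m`, and the factors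
  -- `(z - 2) / z` to the ratio for two vertices.
  explored : ∀ t → t ℕ.< k → Explored t
  explored ℕ.zero t<k = record
    { a≥ = ≤-reflexive (×-congʳ m (reflexive (≡.sym (≡.cong Values.a start))))
    ; b≥ = ≤-reflexive (reflexive (≡.sym (≡.cong Values.b start)))
    ; c≥ = ≤-reflexive (×-congʳ m (reflexive (≡.sym (≡.cong Values.c start))))
    ; d≥ = ≤-reflexive (×-congʳ (m ℕ.* (m ℕ.∸ 1)) (reflexive (≡.sym (≡.cong Values.d start))))
    ; e≥ = ≤-reflexive (reflexive (≡.sym (≡.cong Values.e start)))
    }
  explored (ℕ.suc t) t<k = record
    { a≥ = propagate m z (z ℕ.∸ 1) z (m ℕ.∸ ℕ.suc t) a≥ (explore-step Values.a (z ℕ.∸ 1) (a t) ≡.refl)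
             (ℕ.≤-reflexive (≡.trans (≡.cong (z ℕ.*_) pred) (ℕ.*-comm z (z ℕ.∸ 1))))
    ; b≥ = ≤-trans b≥ (≤-reflexive (reflexive (≡.sym (≡.cong Values.b (explore-equations t<k)))))
    ; c≥ = propagate m z (z ℕ.∸ 1) z (m ℕ.∸ ℕ.suc t) c≥ (explore-step Values.c (z ℕ.∸ 1) (c t) ≡.refl)
             (ℕ.≤-reflexive (≡.trans (≡.cong (z ℕ.*_) pred) (ℕ.*-comm z (z ℕ.∸ 1))))
    ; d≥ = propagate (m ℕ.* (m ℕ.∸ 1)) z (z ℕ.∸ 2) (z ℕ.* (z ℕ.∸ 1)) ((m ℕ.∸ ℕ.suc t) ℕ.* (m ℕ.∸ ℕ.suc t ℕ.∸ 1)) d≥ (explore-step Values.d (z ℕ.∸ 2) (d t) ≡.refl)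
             (ℕ.≤-reflexive (≡.trans (≡.cong (λ y → z ℕ.* (y ℕ.* (y ℕ.∸ 1))) pred)
               (≡.trans (≡.cong (λ y → z ℕ.* ((z ℕ.∸ 1) ℕ.* y)) (ℕ.∸-+-assoc z 1 1)) (rotate z (z ℕ.∸ 1) (z ℕ.∸ 2)))))
    ; e≥ = ≤-trans e≥ (≤-reflexive (reflexive (≡.sym (≡.cong Values.e (explore-equations t<k)))))
    }
    where
    open Explored (explored t (ℕ.<⇒≤ t<k))
    z = m ℕ.∸ t
    instance _ = ∸-nonZero (ℕ.<-≤-trans (ℕ.<⇒≤ t<k) k≤m)
    pred : m ℕ.∸ ℕ.suc t ≡ z ℕ.∸ 1
    pred = ≡.trans (≡.cong (m ℕ.∸_) (ℕ.+-comm 1 t)) (≡.sym (ℕ.∸-+-assoc m t 1))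
    rotate : ∀ x y w → x ℕ.* (y ℕ.* w) ≡ w ℕ.* (x ℕ.* y)
    rotate = solve-∀
    explore-step : ∀ (f : Values → Carrier) w x → f (exploreNext z (values (a t) (b t) (c t) (d t) (e t))) ≡ (w · x) ÷ z →
      w · x ≤ z · f (values (a (ℕ.suc t)) (b (ℕ.suc t)) (c (ℕ.suc t)) (d (ℕ.suc t)) (e (ℕ.suc t)))
    explore-step f w x eq = ≤-reflexive (trans (sym (·-÷ z (w · x)))
      (×-congʳ z (reflexive (≡.sym (≡.trans (≡.cong f (explore-equations t<k)) eq)))))

  module _ {s} (k≡ : k ≡ 4 ℕ.+ s) (2k≤m : 2 ℕ.* k ℕ.≤ m) where

    private
      -- This is `k - 1`, the time of the arrival numbered `k`, which is the first that is not
      -- explored.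
      t = 3 ℕ.+ s
      t<k : t ℕ.< k
      t<k = ℕ.≤-reflexive (≡.sym k≡)
      t<m = ℕ.<-≤-trans t<k k≤m
      open Explored (explored t t<k)
      y = m ℕ.∸ k
      k+y≡m : k ℕ.+ y ≡ m
      k+y≡m = ℕ.m+[n∸m]≡n k≤m
      z≡ : m ℕ.∸ t ≡ ℕ.suc y
      z≡ = ≡.trans (≡.cong (ℕ._∸ t) (≡.trans (≡.sym k+y≡m) (≡.trans (≡.cong (ℕ._+ y) k≡) (≡.sym (ℕ.+-suc t y))))) (ℕ.m+n∸m≡n t (ℕ.suc y))
      k≤y : k ℕ.≤ y
      k≤y = ℕ.+-cancelˡ-≤ k _ _ (ℕ.≤-trans (ℕ.≤-reflexive (≡.cong (k ℕ.+_) (≡.sym (ℕ.+-identityʳ k)))) (ℕ.≤-trans 2k≤m (ℕ.≤-reflexive (≡.sym k+y≡m))))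
      m≤2y : m ℕ.≤ 2 ℕ.* y
      m≤2y = ℕ.≤-trans (ℕ.≤-reflexive (≡.sym k+y≡m)) (ℕ.≤-trans (ℕ.+-monoˡ-≤ y k≤y) (ℕ.≤-reflexive (≡.cong (y ℕ.+_) (≡.sym (ℕ.+-identityʳ y)))))
      ordered-t = ordered t (ℕ.≤-trans (ℕ.<⇒≤ t<m) (ℕ.m≤m+n m _))
      instance
        m≢0 : ℕ.NonZero m
        m≢0 = ℕ.>-nonZero (ℕ.≤-<-trans ℕ.z≤n t<m)

    start-b : (2 ℕ.+ s) · 1# ≤ (1 ℕ.* (4 ℕ.+ s)) · b (4 ℕ.+ s)
    start-b = begin
      (2 ℕ.+ s) · 1#                   ≤⟨ ·-monoʳ-≤ (2 ℕ.+ s) b≥ ⟩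
      (2 ℕ.+ s) · b t                  ≤⟨ x≤x+y (·-nonneg 2 (Ordered.0≤a ordered-t)) ⟩
      (2 ℕ.+ s) · b t + 2 · a t        ≤⟨ recur-b (ℕ.≤-reflexive k≡) t<m ≡.refl ⟩
      (4 ℕ.+ s) · b (4 ℕ.+ s)          ≈⟨ ·-congˡ (ℕ.*-identityˡ (4 ℕ.+ s)) ⟨
      (1 ℕ.* (4 ℕ.+ s)) · b (4 ℕ.+ s)  ∎
      where open ≤-Reasoning

    start-e : s · 1# ≤ (1 ℕ.* (4 ℕ.+ s)) · e (4 ℕ.+ s)
    start-e = begin
      s · 1#                           ≤⟨ ·-monoʳ-≤ s e≥ ⟩
      s · e t                          ≤⟨ x≤x+y (·-nonneg 4 (Ordered.0≤c ordered-t)) ⟩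
      s · e t + 4 · c t                ≤⟨ recur-e (ℕ.≤-reflexive k≡) t<m ≡.refl ⟩
      (4 ℕ.+ s) · e (4 ℕ.+ s)          ≈⟨ ·-congˡ (ℕ.*-identityˡ (4 ℕ.+ s)) ⟨
      (1 ℕ.* (4 ℕ.+ s)) · e (4 ℕ.+ s)  ∎
      where open ≤-Reasoning

    finish : ∀ M r w κ A {x x′} .{{_ : ℕ.NonZero (M ℕ.* r)}} → A · 1# ≤ M · x → w · x ≤ ((4 ℕ.+ s) ℕ.* r) · x′ →
      ∀ B → M ℕ.* r ℕ.* B ℕ.≤ κ ℕ.* (w ℕ.* A) → B · 1# ≤ (κ ℕ.* (4 ℕ.+ s)) · x′
    finish M r w κ A {x} {x′} A≤ w≤ B arith = ·-cancel-≤ (M ℕ.* r) (begin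
      (M ℕ.* r) · (B · 1#)                         ≈⟨ ×-assocˡ 1# (M ℕ.* r) B ⟩
      (M ℕ.* r ℕ.* B) · 1#                         ≤⟨ ·-monoˡ-≤ 0≤1 arith ⟩
      (κ ℕ.* (w ℕ.* A)) · 1#                       ≈⟨ trans (×-congʳ κ (×-assocˡ 1# w A)) (×-assocˡ 1# κ (w ℕ.* A)) ⟨
      κ · (w · (A · 1#))                           ≤⟨ ·-monoʳ-≤ κ (·-monoʳ-≤ w A≤) ⟩
      κ · (w · (M · x))                            ≈⟨ ×-congʳ κ (·-comm-· w M x) ⟩
      κ · (M · (w · x))                            ≤⟨ ·-monoʳ-≤ κ (·-monoʳ-≤ M w≤) ⟩
      κ · (M · (((4 ℕ.+ s) ℕ.* r) · x′))           ≈⟨ trans (×-congʳ κ (×-assocˡ x′ M _)) (×-assocˡ x′ κ _) ⟩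
      (κ ℕ.* (M ℕ.* ((4 ℕ.+ s) ℕ.* r))) · x′       ≈⟨ ·-congˡ (regroup κ M (4 ℕ.+ s) r) ⟩
      (M ℕ.* r ℕ.* (κ ℕ.* (4 ℕ.+ s))) · x′         ≈⟨ ×-assocˡ x′ (M ℕ.* r) _ ⟨
      (M ℕ.* r) · ((κ ℕ.* (4 ℕ.+ s)) · x′)         ∎)
      where
      open ≤-Reasoning
      regroup : ∀ κ M p r → κ ℕ.* (M ℕ.* (p ℕ.* r)) ≡ M ℕ.* r ℕ.* (κ ℕ.* p)
      regroup = solve-∀

    -- Exploration leaves at least `(1 + y) / m`, and the step multiplies by `y / (1 + y)` and
    -- `s / (4 + s)`; the result contains `y / m`, which is at least 1/2. The term with `d` is given
    -- up.
    start-c : s · 1# ≤ (2 ℕ.* (4 ℕ.+ s)) · c (4 ℕ.+ s)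
    start-c = finish m (ℕ.suc y) (s ℕ.* y) 2 (ℕ.suc y) {{ℕ.m*n≢0 m (ℕ.suc y)}}
      (≡.subst (λ z → z · 1# ≤ m · c t) z≡ c≥)
      (≤-trans (x≤x+y (·-nonneg (2 ℕ.* y) (Ordered.0≤d ordered-t)))
        (recur-c (ℕ.≤-reflexive k≡) t<m ≡.refl (ℕ.suc y) (ℕ.≤-reflexive (≡.sym z≡))))
      s (ℕ.≤-trans (ℕ.≤-reflexive (ℕ.*-assoc m (ℕ.suc y) s)) (ℕ.≤-trans (ℕ.*-monoˡ-≤ (ℕ.suc y ℕ.* s) m≤2y) (ℕ.≤-reflexive (regroup y s))))
      where
      regroup : ∀ y s → 2 ℕ.* y ℕ.* (ℕ.suc y ℕ.* s) ≡ 2 ℕ.* (s ℕ.* y ℕ.* ℕ.suc y)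
      regroup = solve-∀

    start-a : (2 ℕ.+ s) · 1# ≤ (2 ℕ.* (4 ℕ.+ s)) · a (4 ℕ.+ s)
    start-a = finish m (ℕ.suc y) (2 ℕ.+ s) 2 (ℕ.suc y ℕ.* ℕ.suc y) {{ℕ.m*n≢0 m (ℕ.suc y)}}
      (begin
        (ℕ.suc y ℕ.* ℕ.suc y) · 1#                        ≈⟨ trans (·-congˡ (ℕ.+-comm (ℕ.suc y) (y ℕ.* ℕ.suc y))) (×-homo-+ 1# (y ℕ.* ℕ.suc y) (ℕ.suc y)) ⟩
        (y ℕ.* ℕ.suc y) · 1# + ℕ.suc y · 1#               ≈⟨ +-congʳ (×-assocˡ 1# y (ℕ.suc y)) ⟨
        y · (ℕ.suc y · 1#) + ℕ.suc y · 1#                 ≤⟨ +-mono-≤ (·-monoʳ-≤ y (≡.subst (λ z → z · 1# ≤ m · a t) z≡ a≥)) (≡.subst (λ z → z · 1# ≤ m · c t) z≡ c≥) ⟩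
        y · (m · a t) + m · c t                       ≈⟨ +-congʳ (·-comm-· y m (a t)) ⟩
        m · (y · a t) + m · c t                       ≈⟨ ·-distrib-+ m (y · a t) (c t) ⟨
        m · (y · a t + c t)                           ∎)
      (≤-trans (≤-reflexive (trans (·-distrib-+ (2 ℕ.+ s) (y · a t) (c t)) (+-congʳ (×-assocˡ (a t) (2 ℕ.+ s) y))))
        (recur-a (ℕ.≤-reflexive k≡) t<m ≡.refl (ℕ.suc y) (ℕ.s≤s ℕ.z≤n) (ℕ.≤-reflexive (≡.sym z≡))))
      (2 ℕ.+ s) (ℕ.≤-trans (ℕ.≤-reflexive (ℕ.*-assoc m (ℕ.suc y) (2 ℕ.+ s)))
        (ℕ.≤-trans (ℕ.*-monoˡ-≤ (ℕ.suc y ℕ.* (2 ℕ.+ s)) (ℕ.≤-trans m≤2y (ℕ.*-monoʳ-≤ 2 (ℕ.n≤1+n y)))) (ℕ.≤-reflexive (regroup y s))))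
      where
      open ≤-Reasoning
      regroup : ∀ y s → 2 ℕ.* ℕ.suc y ℕ.* (ℕ.suc y ℕ.* (2 ℕ.+ s)) ≡ 2 ℕ.* ((2 ℕ.+ s) ℕ.* (ℕ.suc y ℕ.* ℕ.suc y))
      regroup = solve-∀

    -- Here the step leaves `y * (y - 1) / (m * (m - 1))` times `s / (4 + s)`. The first fraction
    -- can fall slightly short of 1/4; lowering `s` by one makes up for it.
    start-d : (s ℕ.∸ 1) · 1# ≤ (4 ℕ.* (4 ℕ.+ s)) · d (4 ℕ.+ s)
    start-d = finish (m ℕ.* (m ℕ.∸ 1)) (ℕ.suc y) (s ℕ.* (y ℕ.∸ 1)) 4 (ℕ.suc y ℕ.* y)
      {{ℕ.m*n≢0 (m ℕ.* (m ℕ.∸ 1)) (ℕ.suc y) {{ℕ.m*n≢0 m (m ℕ.∸ 1) {{m≢0}} {{ℕ.>-nonZero (ℕ.m<n⇒0<n∸m 1<m)}}}}}}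
      (≡.subst (λ z → (z ℕ.* (z ℕ.∸ 1)) · 1# ≤ (m ℕ.* (m ℕ.∸ 1)) · d t) z≡ d≥)
      (recur-d (ℕ.≤-reflexive k≡) t<m ≡.refl (ℕ.suc y) (ℕ.≤-reflexive (≡.sym z≡)))
      (s ℕ.∸ 1) arith
      where
      1<m : 1 ℕ.< m
      1<m = ℕ.≤-<-trans (ℕ.s≤s ℕ.z≤n) t<m
      -- Used with s = 1 + r, k = 4 + s and m = k + 1 + y.
      core : ∀ r y → 5 ℕ.+ r ℕ.≤ ℕ.suc y → r ℕ.* (5 ℕ.+ r ℕ.+ y) ℕ.≤ 2 ℕ.* (ℕ.suc r ℕ.* y)
      core r y le = begin
        r ℕ.* (5 ℕ.+ r ℕ.+ y)              ≤⟨ ℕ.*-monoʳ-≤ r (ℕ.+-monoˡ-≤ y le) ⟩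
        r ℕ.* (ℕ.suc y ℕ.+ y)                ≡⟨ expand r y ⟩
        2 ℕ.* (r ℕ.* y) ℕ.+ r              ≤⟨ ℕ.+-monoʳ-≤ (2 ℕ.* (r ℕ.* y)) (ℕ.≤-trans (ℕ.≤-trans (ℕ.m≤n+m r 4) (ℕ.s≤s⁻¹ le)) (ℕ.m≤m+n y (y ℕ.+ 0))) ⟩
        2 ℕ.* (r ℕ.* y) ℕ.+ 2 ℕ.* y        ≡⟨ collect r y ⟩
        2 ℕ.* (ℕ.suc r ℕ.* y)                ∎
        where
        open ℕ.≤-Reasoning
        expand : ∀ r y → r ℕ.* (ℕ.suc y ℕ.+ y) ≡ 2 ℕ.* (r ℕ.* y) ℕ.+ r
        expand = solve-∀
        collect : ∀ r y → 2 ℕ.* (r ℕ.* y) ℕ.+ 2 ℕ.* y ≡ 2 ℕ.* (ℕ.suc r ℕ.* y)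
        collect = solve-∀
      arith : m ℕ.* (m ℕ.∸ 1) ℕ.* ℕ.suc y ℕ.* (s ℕ.∸ 1) ℕ.≤ 4 ℕ.* (s ℕ.* (y ℕ.∸ 1) ℕ.* (ℕ.suc y ℕ.* y))
      arith = go s y k≡ k+y≡m k≤y m≤2y
        where
        go : ∀ s y {k m} → k ≡ 4 ℕ.+ s → k ℕ.+ y ≡ m → k ℕ.≤ y → m ℕ.≤ 2 ℕ.* y →
          m ℕ.* (m ℕ.∸ 1) ℕ.* ℕ.suc y ℕ.* (s ℕ.∸ 1) ℕ.≤ 4 ℕ.* (s ℕ.* (y ℕ.∸ 1) ℕ.* (ℕ.suc y ℕ.* y))
        go ℕ.zero  y       {m = m} _ _ _ _ = ℕ.≤-trans (ℕ.≤-reflexive (ℕ.*-zeroʳ (m ℕ.* (m ℕ.∸ 1) ℕ.* ℕ.suc y))) ℕ.z≤n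
        go (ℕ.suc r) (ℕ.suc y) {m = m} ≡.refl m≡ k≤y m≤2y = begin
          m ℕ.* (m ℕ.∸ 1) ℕ.* (2 ℕ.+ y) ℕ.* r                              ≡⟨ regroup m (m ℕ.∸ 1) (2 ℕ.+ y) r ⟩
          m ℕ.* (r ℕ.* (m ℕ.∸ 1)) ℕ.* (2 ℕ.+ y)                            ≤⟨ ℕ.*-monoˡ-≤ (2 ℕ.+ y) (ℕ.*-mono-≤ m≤2y
            (ℕ.≤-trans (ℕ.≤-reflexive (≡.cong (λ x → r ℕ.* (x ℕ.∸ 1)) (≡.trans (≡.sym m≡) (ℕ.+-suc (5 ℕ.+ r) y)))) (core r y k≤y))) ⟩
          2 ℕ.* ℕ.suc y ℕ.* (2 ℕ.* (ℕ.suc r ℕ.* y)) ℕ.* (2 ℕ.+ y)              ≡⟨ regroup′ y r ⟩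
          4 ℕ.* (ℕ.suc r ℕ.* y ℕ.* ((2 ℕ.+ y) ℕ.* ℕ.suc y))                    ∎
          where
          open ℕ.≤-Reasoning
          regroup : ∀ m n y r → m ℕ.* n ℕ.* y ℕ.* r ≡ m ℕ.* (r ℕ.* n) ℕ.* y
          regroup = solve-∀
          regroup′ : ∀ y r → 2 ℕ.* ℕ.suc y ℕ.* (2 ℕ.* (ℕ.suc r ℕ.* y)) ℕ.* (2 ℕ.+ y) ≡ 4 ℕ.* (ℕ.suc r ℕ.* y ℕ.* ((2 ℕ.+ y) ℕ.* ℕ.suc y))
          regroup′ = solve-∀

-- Running the block recursion over all arrivals

module LargeInstances {ℓ ℓ₁ ℓ₂} (K : OrderedField ℓ ℓ₁ ℓ₂) (σ : ℕ) .{{_ : ℕ.NonZero σ}}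
                      (m k : ℕ) (2k≤m : 2 ℕ.* k ℕ.≤ m) (m≤2k+1 : m ℕ.≤ ℕ.suc (2 ℕ.* k)) (k≤m : k ℕ.≤ m)
                      (q p ρ : ℕ) .{{_ : ℕ.NonZero q}} (k≡ : k ≡ p ℕ.* q ℕ.+ ρ) (ρ<q : ρ ℕ.< q) (5≤p : 5 ℕ.≤ p) where

  open OrderedField K hiding (zero)
  open OrderedFieldProperties K
  open Sequences K
  open Estimation K σ
  open LinearForms K
  open Recursion m k k≤m
  open BlockEstimates K σ m k k≤m q
  open Start K m k k≤m

  private
    2m = 2 ℕ.* m

    -- The shift by `ρ` makes block `p` start exactly at time `k`.
    time : ℕ → ℕ
    time i = i ℕ.* q ℕ.+ ρ

    i≤time : ∀ i → i ℕ.≤ time i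
    i≤time i = ℕ.≤-trans (ℕ.m≤m*n i q) (ℕ.m≤m+n _ ρ)

    p≤k : p ℕ.≤ k
    p≤k = ℕ.≤-trans (i≤time p) (ℕ.≤-reflexive (≡.sym k≡))

    s : ℕ
    s = k ℕ.∸ 4

    k≡4+s : k ≡ 4 ℕ.+ s
    k≡4+s = ≡.sym (ℕ.m+[n∸m]≡n (ℕ.≤-trans (ℕ.n≤1+n 4) (ℕ.≤-trans 5≤p p≤k)))

  -- `(k - r) / k` increases with `k`, so `k` may be replaced by the smaller `p`; the starting
  -- values then depend on `p` alone.
  start-≲ : ∀ r κ .{{κ≢0 : ℕ.NonZero κ}} {x} → (k ℕ.∸ r) · 1# ≤ (κ ℕ.* k) · x → (σ ℕ.* (p ℕ.∸ r)) ÷ℕ (κ ℕ.* p) ≲ x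
  start-≲ r κ {{κ≢0}} {x} le = ≲-÷ (κ ℕ.* p) {{κp≢0}} (bounded (·-cancel-≤ k {{k≢0}} (begin
    k · fromℕ (σ ℕ.* (p ℕ.∸ r))              ≈⟨ ×-assocˡ 1# k _ ⟩
    (k ℕ.* (σ ℕ.* (p ℕ.∸ r))) · 1#           ≤⟨ ·-monoˡ-≤ 0≤1 arith ⟩
    (σ ℕ.* p ℕ.* (k ℕ.∸ r)) · 1#             ≈⟨ ×-assocˡ 1# (σ ℕ.* p) _ ⟨
    (σ ℕ.* p) · ((k ℕ.∸ r) · 1#)             ≤⟨ ·-monoʳ-≤ (σ ℕ.* p) le ⟩
    (σ ℕ.* p) · ((κ ℕ.* k) · x)              ≈⟨ ×-assocˡ x (σ ℕ.* p) _ ⟩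
    (σ ℕ.* p ℕ.* (κ ℕ.* k)) · x              ≈⟨ ·-congˡ (regroup σ p κ k) ⟩
    (k ℕ.* (σ ℕ.* (κ ℕ.* p))) · x            ≈⟨ trans (×-congʳ k (×-assocˡ x σ _)) (×-assocˡ x k _) ⟨
    k · (σ · ((κ ℕ.* p) · x))                ∎)))
    where
    open ≤-Reasoning
    k≢0 : ℕ.NonZero k
    k≢0 = ℕ.>-nonZero (ℕ.≤-trans (ℕ.s≤s ℕ.z≤n) (ℕ.≤-trans 5≤p p≤k))
    κp≢0 : ℕ.NonZero (κ ℕ.* p)
    κp≢0 = ℕ.m*n≢0 κ p {{κ≢0}} {{ℕ.>-nonZero (ℕ.≤-trans (ℕ.s≤s ℕ.z≤n) 5≤p)}}
    regroup : ∀ σ p κ k → σ ℕ.* p ℕ.* (κ ℕ.* k) ≡ k ℕ.* (σ ℕ.* (κ ℕ.* p))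
    regroup = solve-∀
    swap : ∀ k σ P → k ℕ.* (σ ℕ.* P) ≡ σ ℕ.* (k ℕ.* P)
    swap = solve-∀
    arith : k ℕ.* (σ ℕ.* (p ℕ.∸ r)) ℕ.≤ σ ℕ.* p ℕ.* (k ℕ.∸ r)
    arith = ℕ.≤-trans (ℕ.≤-reflexive (swap k σ (p ℕ.∸ r))) (ℕ.≤-trans (ℕ.*-monoʳ-≤ σ
      (ℕ.≤-trans (ℕ.≤-reflexive (ℕ.*-distribˡ-∸ k p r)) (ℕ.≤-trans
        (ℕ.∸-mono (ℕ.≤-reflexive (ℕ.*-comm k p)) (ℕ.*-monoˡ-≤ r p≤k))
        (ℕ.≤-reflexive (≡.sym (ℕ.*-distribˡ-∸ p k r))))))
      (ℕ.≤-reflexive (≡.sym (ℕ.*-assoc σ p (k ℕ.∸ r)))))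

  from-start : ∀ {x : ℕ → Carrier} r w κ → k ℕ.∸ r ≡ w → w · 1# ≤ (κ ℕ.* (4 ℕ.+ s)) · x (4 ℕ.+ s) →
    (k ℕ.∸ r) · 1# ≤ (κ ℕ.* k) · x k
  from-start {x} r w κ ≡.refl le = ≡.subst (λ u → (k ℕ.∸ r) · 1# ≤ (κ ℕ.* u) · x u) (≡.sym k≡4+s) le

  blockStart-estimate : BlockEstimate (time p) (blockStart σ p)
  blockStart-estimate = ≡.subst (λ u → BlockEstimate u (blockStart σ p)) k≡ (record
    { a≲ = start-≲ 2 2 (from-start {a} 2 (2 ℕ.+ s) 2 (≡.cong (ℕ._∸ 2) k≡4+s) (start-a k≡4+s 2k≤m))
    ; b≲ = start-≲ 2 1 (from-start {b} 2 (2 ℕ.+ s) 1 (≡.cong (ℕ._∸ 2) k≡4+s) (start-b k≡4+s 2k≤m))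
    ; c≲ = start-≲ 4 2 (from-start {c} 4 s 2 ≡.refl (start-c k≡4+s 2k≤m))
    ; d≲ = start-≲ 5 4 (from-start {d} 5 (s ℕ.∸ 1) 4 (≡.sym (ℕ.∸-+-assoc k 4 1)) (start-d k≡4+s 2k≤m))
    ; e≲ = start-≲ 4 1 (from-start {e} 4 s 1 ≡.refl (start-e k≡4+s 2k≤m))
    ; g≲ = ≡.subst (_≲ G k) (≡.sym (ℕ.*-zeroʳ q)) (0≲ (G-nonneg k (ℕ.≤-trans k≤m (ℕ.m≤m+n m _))))
    })

  blockℕ-estimate : ∀ i est → p ℕ.≤ i → i ℕ.< p ℕ.+ 3 ℕ.* p → BlockEstimate (time i) est →
    BlockEstimate (time (ℕ.suc i)) (blockℕ p i est)
  blockℕ-estimate i est p≤i i< be = ≡.subst (λ u → BlockEstimate u (blockℕ p i est)) (≡.sym (ℕ.+-assoc q (i ℕ.* q) ρ))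
      (go i (time i ℕ.∸ 3) (≡.sym (ℕ.m+[n∸m]≡n 3≤time)) (ℕ.≤-trans 5≤p p≤i) p≤i i< be)
    where
    3≤time : 3 ℕ.≤ time i
    3≤time = ℕ.≤-trans (ℕ.≤-trans (ℕ.m≤n+m 3 2) (ℕ.≤-trans 5≤p p≤i)) (i≤time i)
    -- The coarse recursion assumes `c * p ∸ i` blocks left in the round. There is room for them,
    -- since `c * k` exceeds `c * p` blocks by `c * ρ` arrivals, which covers the shift by `ρ`. The
    -- round ends are reached with `c = 2` and `c = 4`.
    fits : ∀ c .{{_ : ℕ.NonZero c}} i → i ℕ.≤ c ℕ.* p → q ℕ.* (c ℕ.* p ℕ.∸ i) ℕ.+ time i ℕ.≤ c ℕ.* k
    fits c@(ℕ.suc c′) i i≤ = begin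
      q ℕ.* (c ℕ.* p ℕ.∸ i) ℕ.+ (i ℕ.* q ℕ.+ ρ)   ≡⟨ regroup q (c ℕ.* p ℕ.∸ i) i ρ ⟩
      q ℕ.* (c ℕ.* p ℕ.∸ i ℕ.+ i) ℕ.+ ρ           ≡⟨ ≡.cong (λ x → q ℕ.* x ℕ.+ ρ) (ℕ.m∸n+n≡m i≤) ⟩
      q ℕ.* (c ℕ.* p) ℕ.+ ρ                       ≤⟨ ℕ.+-monoʳ-≤ (q ℕ.* (c ℕ.* p)) (ℕ.m≤m+n ρ (c′ ℕ.* ρ)) ⟩
      q ℕ.* (c ℕ.* p) ℕ.+ c ℕ.* ρ                 ≡⟨ regroup′ q c p ρ ⟩
      c ℕ.* (p ℕ.* q ℕ.+ ρ)                       ≡⟨ ≡.cong (c ℕ.*_) k≡ ⟨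
      c ℕ.* k                                     ∎
      where
      open ℕ.≤-Reasoning
      regroup : ∀ q x i ρ → q ℕ.* x ℕ.+ (i ℕ.* q ℕ.+ ρ) ≡ q ℕ.* (x ℕ.+ i) ℕ.+ ρ
      regroup = solve-∀
      regroup′ : ∀ q c p ρ → q ℕ.* (c ℕ.* p) ℕ.+ c ℕ.* ρ ≡ c ℕ.* (p ℕ.* q ℕ.+ ρ)
      regroup′ = solve-∀
    4k≤2m : 4 ℕ.* k ℕ.≤ 2 ℕ.* m
    4k≤2m = ℕ.≤-trans (ℕ.≤-reflexive (ℕ.*-assoc 2 2 k)) (ℕ.*-monoʳ-≤ 2 2k≤m)
    module _ (i′ s : ℕ) (time≡ : time (3 ℕ.+ i′) ≡ 3 ℕ.+ s) (5≤ : 5 ℕ.≤ 3 ℕ.+ i′) (p≤ : p ℕ.≤ 3 ℕ.+ i′) where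

      private
        i₃ = 3 ℕ.+ i′
      s≢0 : ℕ.NonZero s
      s≢0 = ℕ.>-nonZero (ℕ.+-cancelˡ-≤ 3 _ _ (ℕ.≤-trans (ℕ.≤-trans (ℕ.n≤1+n 4) 5≤) (ℕ.≤-trans (i≤time i₃) (ℕ.≤-reflexive time≡))))
      i≤s : i₃ ℕ.* q ℕ.≤ 3 ℕ.+ s
      i≤s = ℕ.≤-trans (ℕ.m≤m+n (i₃ ℕ.* q) ρ) (ℕ.≤-reflexive time≡)
      s≤i : 3 ℕ.+ s ℕ.≤ ℕ.suc i₃ ℕ.* q
      s≤i = ℕ.≤-trans (ℕ.≤-reflexive (≡.sym time≡)) (ℕ.≤-trans (ℕ.+-monoʳ-≤ (i₃ ℕ.* q) (ℕ.<⇒≤ ρ<q)) (ℕ.≤-reflexive (ℕ.+-comm (i₃ ℕ.* q) q)))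
      k≤u : k ℕ.≤ 3 ℕ.+ s
      k≤u = ℕ.≤-trans (ℕ.≤-reflexive k≡) (ℕ.≤-trans (ℕ.+-monoˡ-≤ ρ (ℕ.*-monoˡ-≤ q p≤)) (ℕ.≤-reflexive time≡))

      block : i₃ ℕ.< p ℕ.+ 3 ℕ.* p → BlockEstimate (3 ℕ.+ s) est → BlockEstimate (q ℕ.+ (3 ℕ.+ s)) (blockℕ p i₃ est)
      block i₃< be₃ with i₃ <ᵇ 2 ℕ.* p in eq
      ... | true = Block.block₁-estimate i′ s {{s≢0}} i≤s s≤i k≤u (2 ℕ.* p ℕ.∸ i₃) {{∸-nonZero i<2p}}
            (≡.subst (λ u → q ℕ.* (2 ℕ.* p ℕ.∸ i₃) ℕ.+ u ℕ.≤ m) time≡ (ℕ.≤-trans (fits 2 i₃ (ℕ.<⇒≤ i<2p)) 2k≤m)) be₃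
        where
        i<2p : i₃ ℕ.< 2 ℕ.* p
        i<2p = true-<ᵇ {i₃} {2 ℕ.* p} eq
      ... | false = Block.block₂-estimate i′ s {{s≢0}} i≤s s≤i k≤u (4 ℕ.* p ℕ.∸ i₃) {{∸-nonZero i₃<}}
            (≡.subst (λ u → q ℕ.* (4 ℕ.* p ℕ.∸ i₃) ℕ.+ u ℕ.≤ 2 ℕ.* m) time≡ (ℕ.≤-trans (fits 4 i₃ (ℕ.<⇒≤ i₃<)) 4k≤2m)) be₃

    go : ∀ i s → time i ≡ 3 ℕ.+ s → 5 ℕ.≤ i → p ℕ.≤ i → i ℕ.< p ℕ.+ 3 ℕ.* p → BlockEstimate (time i) est →
      BlockEstimate (q ℕ.+ time i) (blockℕ p i est)
    go 1 _ _ (ℕ.s≤s ())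
    go 2 _ _ (ℕ.s≤s (ℕ.s≤s ()))
    go (ℕ.suc (ℕ.suc (ℕ.suc i′))) s time≡ 5≤i p≤i i< be =
      ≡.subst (λ u → BlockEstimate (q ℕ.+ u) (blockℕ p (3 ℕ.+ i′) est)) (≡.sym time≡)
        (block i′ s time≡ 5≤i p≤i i< (≡.subst (λ u → BlockEstimate u est) time≡ be))

  G-monotone : ∀ δ t → k ℕ.≤ t → δ ℕ.+ t ℕ.≤ 2 ℕ.* m → G t ≤ G (δ ℕ.+ t)
  G-monotone ℕ.zero  t k≤t le = ≤-refl
  G-monotone (ℕ.suc δ) t k≤t le = ≤-trans (G-monotone δ t k≤t (ℕ.<⇒≤ le))
    (≤-trans (x≤x+y (Ordered.0≤b (ordered (δ ℕ.+ t) (ℕ.<⇒≤ le))))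
      (≤-reflexive (reflexive (≡.sym (G-step (ℕ.m≤n⇒m≤1+n (ℕ.≤-trans k≤t (ℕ.m≤n+m t δ))))))))

  gain-from-blocks : ∀ A B est → BlockEstimate (time (p ℕ.+ 3 ℕ.* p)) est →
    (A ℕ.* (4 ℕ.* p ℕ.+ 4) ℕ.* σ ≤ᵇ B ℕ.* Estimates.g est) ≡ true →
    (A ℕ.* (2 ℕ.* m)) · 1# ≤ B · totalGain m k (2 ℕ.* m)
  gain-from-blocks A B est be eq = ·-cancel-≤ σ (begin
    σ · ((A ℕ.* 2m) · 1#)                               ≈⟨ ×-assocˡ 1# σ (A ℕ.* 2m) ⟩
    (σ ℕ.* (A ℕ.* 2m)) · 1#                             ≤⟨ ·-monoˡ-≤ 0≤1 arith ⟩
    (q ℕ.* (B ℕ.* Estimates.g est)) · 1#                ≈⟨ ·-congˡ (swap q B (Estimates.g est)) ⟩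
    fromℕ (B ℕ.* (q ℕ.* Estimates.g est))               ≤⟨ bound (≲-· B (≲-≤ end≤ (BlockEstimate.g≲ be))) ⟩
    σ · (B · G 2m)                                      ≡⟨ ≡.cong (λ x → σ · (B · x)) (G≡totalGain 2m) ⟩
    σ · (B · totalGain m k 2m)                          ∎)
    where
    open ≤-Reasoning
    end = time (p ℕ.+ 3 ℕ.* p)
    swap : ∀ q c g → q ℕ.* (c ℕ.* g) ≡ c ℕ.* (q ℕ.* g)
    swap = solve-∀
    k≤end : k ℕ.≤ end
    k≤end = ℕ.≤-trans (ℕ.≤-reflexive k≡) (ℕ.+-monoˡ-≤ ρ (ℕ.*-monoˡ-≤ q (ℕ.m≤m+n p _)))
    end≤2m : end ℕ.≤ 2m
    end≤2m = ℕ.≤-trans (ℕ.+-monoʳ-≤ ((p ℕ.+ 3 ℕ.* p) ℕ.* q) (ℕ.m≤m+n ρ (3 ℕ.* ρ)))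
      (ℕ.≤-trans (ℕ.≤-reflexive (≡.trans (regroup p q ρ) (≡.cong (λ x → 2 ℕ.* (2 ℕ.* x)) (≡.sym k≡)))) (ℕ.*-monoʳ-≤ 2 2k≤m))
      where
      regroup : ∀ p q ρ → (p ℕ.+ 3 ℕ.* p) ℕ.* q ℕ.+ (ρ ℕ.+ 3 ℕ.* ρ) ≡ 2 ℕ.* (2 ℕ.* (p ℕ.* q ℕ.+ ρ))
      regroup = solve-∀
    end≤ : G end ≤ G 2m
    end≤ = ≡.subst (λ u → G end ≤ G u) (ℕ.m∸n+n≡m end≤2m) (G-monotone (2m ℕ.∸ end) end k≤end (ℕ.≤-reflexive (ℕ.m∸n+n≡m end≤2m)))
    2m≤ : 2m ℕ.≤ q ℕ.* (4 ℕ.* p ℕ.+ 4)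
    2m≤ = ℕ.≤-trans (ℕ.*-monoʳ-≤ 2 (ℕ.≤-trans m≤2k+1 (ℕ.≤-reflexive (≡.cong (λ x → ℕ.suc (2 ℕ.* x)) k≡))))
      (ℕ.≤-trans (ℕ.m≤m+n _ 2) (ℕ.≤-trans (ℕ.≤-reflexive (regroup p q ρ)) (ℕ.≤-trans (ℕ.+-monoʳ-≤ (4 ℕ.* (p ℕ.* q)) (ℕ.*-monoʳ-≤ 4 ρ<q))
        (ℕ.≤-reflexive (regroup′ p q)))))
      where
      regroup : ∀ p q ρ → 2 ℕ.* ℕ.suc (2 ℕ.* (p ℕ.* q ℕ.+ ρ)) ℕ.+ 2 ≡ 4 ℕ.* (p ℕ.* q) ℕ.+ 4 ℕ.* ℕ.suc ρ
      regroup = solve-∀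
      regroup′ : ∀ p q → 4 ℕ.* (p ℕ.* q) ℕ.+ 4 ℕ.* q ≡ q ℕ.* (4 ℕ.* p ℕ.+ 4)
      regroup′ = solve-∀
    arith : σ ℕ.* (A ℕ.* 2m) ℕ.≤ q ℕ.* (B ℕ.* Estimates.g est)
    arith = ℕ.≤-trans (ℕ.*-monoʳ-≤ σ (ℕ.*-monoʳ-≤ A 2m≤)) (ℕ.≤-trans (ℕ.≤-reflexive (regroup σ A q (4 ℕ.* p ℕ.+ 4)))
      (ℕ.*-monoʳ-≤ q (ℕ.≤ᵇ⇒≤ _ _ (≡.subst T (≡.sym eq) tt))))
      where
      regroup : ∀ σ c q x → σ ℕ.* (c ℕ.* (q ℕ.* x)) ≡ q ℕ.* (c ℕ.* x ℕ.* σ)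
      regroup = solve-∀

  totalGain-large : ∀ A B →
    iterate (blockℕ p) (λ s → A ℕ.* (4 ℕ.* p ℕ.+ 4) ℕ.* σ ≤ᵇ B ℕ.* Estimates.g s) (3 ℕ.* p) p (blockStart σ p) ≡ true →
    (A ℕ.* (2 ℕ.* m)) · 1# ≤ B · totalGain m k (2 ℕ.* m)
  totalGain-large A B check =
    let (est , be , eq) = iterate-estimate {blockℕ p} (λ i est → BlockEstimate (time i) est) (3 ℕ.* p) p (blockStart σ p)
          blockℕ-estimate blockStart-estimate check
    in gain-from-blocks A B est be eq

k-bounds : ∀ m → let k = (2 ℕ.* m) ℕ./ 4 in 2 ℕ.* k ℕ.≤ m × m ℕ.≤ ℕ.suc (2 ℕ.* k) × k ℕ.≤ m
k-bounds m = 2k≤m , m≤ , ℕ.≤-trans (ℕ.m≤m+n k _) 2k≤m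
  where
  k = (2 ℕ.* m) ℕ./ 4
  4k≡ : 2 ℕ.* (2 ℕ.* k) ≡ k ℕ.* 4
  4k≡ = ≡.trans (≡.sym (ℕ.*-assoc 2 2 k)) (ℕ.*-comm 4 k)
  2k≤m : 2 ℕ.* k ℕ.≤ m
  2k≤m = ℕ.*-cancelˡ-≤ 2 (ℕ.≤-trans (ℕ.≤-reflexive 4k≡) (ℕ.m/n*n≤m (2 ℕ.* m) 4))
  m≤ : m ℕ.≤ ℕ.suc (2 ℕ.* k)
  m≤ = ℕ.s≤s⁻¹ (ℕ.*-cancelˡ-< 2 m (ℕ.suc (ℕ.suc (2 ℕ.* k))) (begin-strict
    2 ℕ.* m                                ≡⟨ ℕ.m≡m%n+[m/n]*n (2 ℕ.* m) 4 ⟩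
    (2 ℕ.* m) ℕ.% 4 ℕ.+ k ℕ.* 4            <⟨ ℕ.+-monoˡ-< (k ℕ.* 4) (ℕ.m%n<n (2 ℕ.* m) 4) ⟩
    4 ℕ.+ k ℕ.* 4                          ≡⟨ ≡.cong (4 ℕ.+_) 4k≡ ⟨
    4 ℕ.+ 2 ℕ.* (2 ℕ.* k)                  ≡⟨ ℕ.*-distribˡ-+ 2 2 (2 ℕ.* k) ⟨
    2 ℕ.* ℕ.suc (ℕ.suc (2 ℕ.* k))              ∎))
    where open ℕ.≤-Reasoning

-- Both ranges of `m`, and the competitive ratio

module Total {ℓ ℓ₁ ℓ₂} (K : OrderedField ℓ ℓ₁ ℓ₂) where

  open OrderedField K hiding (zero)
  open OrderedFieldProperties K
  open Sequences K

  totalGain-bound : ∀ m → (100 ℕ.* (2 ℕ.* m)) · 1# ≤ 462 · totalGain m ((2 ℕ.* m) ℕ./ 4) (2 ℕ.* m)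
  totalGain-bound m with k-bounds m | m ℕ.<? 600
  ... | _ , _ , k≤m | yes m<600 = SmallInstances.totalGain-small K m m<600 k≤m
  ... | 2k≤m , m≤2k+1 , k≤m | no m≮600 =
    LargeInstances.totalGain-large K scale m k 2k≤m m≤2k+1 k≤m q p ρ k≡ (ℕ.m%n<n k q) (ℕ.≤-trans (ℕ.m≤m+n 5 295) 300≤p)
      100 462 (largeChecks p 300≤p p<600)
    where
    k = (2 ℕ.* m) ℕ./ 4
    300≤k : 300 ℕ.≤ k
    300≤k = ℕ./-monoˡ-≤ 4 (ℕ.*-monoʳ-≤ 2 (ℕ.≮⇒≥ m≮600))
    -- From `300 * q ≤ k < 300 * (q + 1)` and `q + 1 ≤ 2 * q` it follows that `k / q` lies between
    -- 300 and 600, so finitely many `p` serve all `k` from 300 on.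
    q = k ℕ./ 300
    1≤q : 1 ℕ.≤ q
    1≤q = ℕ./-monoˡ-≤ 300 300≤k
    instance
      q≢0 : ℕ.NonZero q
      q≢0 = ℕ.>-nonZero 1≤q
    p = k ℕ./ q
    ρ = k ℕ.% q
    k≡ : k ≡ p ℕ.* q ℕ.+ ρ
    k≡ = ≡.trans (ℕ.m≡m%n+[m/n]*n k q) (ℕ.+-comm ρ (p ℕ.* q))
    300≤p : 300 ℕ.≤ p
    300≤p = ℕ.≤-trans (ℕ.≤-reflexive (≡.sym (ℕ.m*n/n≡m 300 q)))
      (ℕ./-monoˡ-≤ q (ℕ.≤-trans (ℕ.≤-reflexive (ℕ.*-comm 300 q)) (ℕ.m/n*n≤m k 300)))
    p<600 : p ℕ.< 600
    p<600 = ℕ.m<n*o⇒m/o<n (begin-strict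
      k                                ≡⟨ ℕ.m≡m%n+[m/n]*n k 300 ⟩
      k ℕ.% 300 ℕ.+ q ℕ.* 300          <⟨ ℕ.+-monoˡ-< (q ℕ.* 300) (ℕ.m%n<n k 300) ⟩
      300 ℕ.+ q ℕ.* 300                ≤⟨ ℕ.+-monoˡ-≤ (q ℕ.* 300) (ℕ.*-monoˡ-≤ 300 1≤q) ⟩
      q ℕ.* 300 ℕ.+ q ℕ.* 300          ≡⟨ ℕ.*-distribˡ-+ q 300 300 ⟨
      q ℕ.* 600                        ≡⟨ ℕ.*-comm q 600 ⟩
      600 ℕ.* q                        ∎)
      where open ℕ.≤-Reasoning

theorem2 : ∀ {c ℓ₁ ℓ₂} (K : OrderedField c ℓ₁ ℓ₂) (let open OrderedField K)
    (m n : ℕ) → n ≡ 2 ℕ.* m →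
    (w : Weights K m n) → (∀ l r → 0# ≤ w l r) →
    (opt : Subset n → Edges m n) →
    (∀ R′ → IsMaxWeightMatchingOf K w R′ (opt R′)) →
    (OPT : Edges m n) → IsMaxWeightMatchingOf K w ⊤ OPT →
    weight K w OPT / (fromℕ 462 / fromℕ 100) ≤ 𝔼 K (ALG2 K opt) (weight K w)
-- With no vertices both sides are 0. The case is separate because the invariant of the initial
-- state needs a nonempty `L_a`.
theorem2 K ℕ.zero n ≡.refl w 0≤w opt optimal [] OPT-max = /-≤ 100 462
  (≤-trans (≤-reflexive (·-zeroʳ 100)) (·-nonneg 462 (≤-reflexive (sym (trans (+-identityʳ _) (zeroʳ _))))))
  where
  open OrderedField K hiding (zero)
  open OrderedFieldProperties K
theorem2 K m@(ℕ.suc _) n ≡.refl w 0≤w opt optimal OPT OPT-max = /-≤ 100 462 (·-cancel-≤ n (begin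
    n · (100 · W)                ≈⟨ trans (×-assocˡ W n 100) (·-congˡ (ℕ.*-comm n 100)) ⟩
    (100 ℕ.* n) · W              ≈⟨ trans (×-assoc-* (100 ℕ.* n) 1# W) (×-congʳ (100 ℕ.* n) (*-identityˡ W)) ⟨
    (100 ℕ.* n) · 1# * W         ≈⟨ *-comm _ _ ⟩
    W * ((100 ℕ.* n) · 1#)       ≤⟨ *-monoˡ-≤ (weight-nonneg OPT) (Total.totalGain-bound K m) ⟩
    W * (462 · gains)                ≈⟨ trans (*-comm _ _) (×-assoc-* 462 gains W) ⟩
    462 · (gains * W)                ≤⟨ ·-monoʳ-≤ 462 (ALG2-weight OPT OPT-max) ⟩
    462 · (n · E)                ≈⟨ ·-comm-· 462 n E ⟩
    n · (462 · E)                ∎))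
  where
  open OrderedField K hiding (zero)
  open OrderedFieldProperties K
  open WeightBound K ≡.refl w 0≤w opt optimal
  open ≤-Reasoning
  W = weight K w OPT
  E = 𝔼 K (ALG2 K opt) (weight K w)
  gains = Sequences.totalGain K m (n ℕ./ 4) n
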